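{- Let $R(q)=\dfrac{(q;q^5)_\infty(q^4;q^5)_\infty}{(q^2;q^5)_\infty(q^3;q^5)_\infty}$ and define integers $A(n)$ by the power series expansion $\dfrac{1}{R^5(q)}=\sum_{n=0}^{\infty}A(n)q^{n}$. Then for all nonnegative integers $n$, $$A(5n+1)>0,\quad A(5n+2)>0,\quad A(5n+3)>0,\quad A(5n+4)<0.$$
   Context: For complex $a,q$ with $|q|<1$, $(a;q)_\infty:=\prod_{k=0}^{\infty}(1-aq^k)$. All series are formal power series in $q$ (convergent for $|q|<1$). $R(q)$ equals $q^{ -1/5}$ times the Rogers–Ramanujan continued fraction. -}

module Defs where

open import Data.Nat as ℕ using (ℕ; zero; suc; _∸_; _≡ᵇ_)
open import Data.Nat.Divisibility using (_∣?_)
open import Data.Integer using (ℤ; _+_; _-_; _*_; 0ℤ; 1ℤ)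
open import Data.Bool using (Bool; if_then_else_)
open import Relation.Nullary.Decidable using (⌊_⌋)

-- Formal power series in q with integer coefficients: n ↦ coefficient of q^n.
PS : Set
PS = ℕ → ℤ

Σ< : ℕ → (ℕ → ℤ) → ℤ
Σ< zero    f = 0ℤ
Σ< (suc n) f = Σ< n f + f n

_⊛_ : PS → PS → PS
(f ⊛ g) n = Σ< (suc n) (λ i → f i * g (n ∸ i))
infixl 7 _⊛_

onePS : PS
onePS n = if n ≡ᵇ 0 then 1ℤ else 0ℤ

_^PS_ : PS → ℕ → PS
f ^PS zero  = onePS
f ^PS suc k = f ⊛ (f ^PS k)

oneMinusQ^ : ℕ → PS
oneMinusQ^ m n = (if n ≡ᵇ 0 then 1ℤ else 0ℤ) - (if n ≡ᵇ m then 1ℤ else 0ℤ)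

-- the series 1/(1 - q^m) = Σ_{j≥0} q^{mj}   (meaningful for m ≥ 1)
invOneMinusQ^ : ℕ → PS
invOneMinusQ^ m n = if ⌊ m ∣? n ⌋ then 1ℤ else 0ℤ

ΠPS : ℕ → (ℕ → PS) → PS
ΠPS zero    F = onePS
ΠPS (suc N) F = ΠPS N F ⊛ F N

-- (q^a ; q^d)_∞ for a, d ≥ 1: the coefficient of q^n only depends on the
-- factors with a + d j ≤ n, so it equals the coefficient of q^n in the
-- finite product Π_{j ≤ n} (1 - q^{a + d j}).
poch∞ : ℕ → ℕ → PS
poch∞ a d n = ΠPS (suc n) (λ j → oneMinusQ^ (a ℕ.+ d ℕ.* j)) n

-- 1/(q^a ; q^d)_∞ for a, d ≥ 1, likewise = Π_{j} 1/(1 - q^{a+dj}).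
invPoch∞ : ℕ → ℕ → PS
invPoch∞ a d n = ΠPS (suc n) (λ j → invOneMinusQ^ (a ℕ.+ d ℕ.* j)) n

recipR5 : PS
recipR5 = ((poch∞ 2 5 ⊛ poch∞ 3 5) ^PS 5) ⊛ ((invPoch∞ 1 5 ⊛ invPoch∞ 4 5) ^PS 5)

A : ℕ → ℤ
A n = recipR5 n

{-# OPTIONS --safe #-}

-- Write R = a/b with a = (q,q⁴;q⁵)_∞ and b = (q²,q³;q⁵)_∞, put G = 1/a and H = 1/b, and let a bar denote q ↦ q⁵.
-- Specialising the Jacobi triple product at fifth roots of unity z and multiplying the cases z = ζ, ζ² gives
-- b̄² - v b̄ - v² = ab(āb̄)² with v = qā.  Its norm over q ↦ ζ^i q is Ramanujan's b¹⁰ - 11q a⁵b⁵ - q²a¹⁰ = (ab)¹¹.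
-- Together they determine R⁵ as a rational function of v and b̄ (the root of a quadratic that is a power series), whence
-- 1/R⁵ = Σ_k c_k q^k Ḡ^(12-k) H̄^k with c = (1,5,10,5,-15,-36,-40,-30,-15,-5,-1).  So A(5n+r) is the coefficient of q^n in
--   r = 1:  5G¹¹H - 40qG⁶H⁶ = 5(1 + 3qG⁶H⁶ + q²GH¹¹), by Ramanujan's identity again;
--   r = 2, 3:  10G⁵H²T and 5G⁴H³T with T = G⁵ - 3qH⁵;
--   r = 4:  -(15G⁸H⁴ + 5qG³H⁹).
-- T/((1-q)(1-q²)) has nonnegative coefficients: apart from their first factors, G exceeds H by (1-q)(1-q²) times a nonnegative
-- series, and the first factors contribute the polynomial (1+q+q²)⁵ - 3q(1+q²)⁵, whose partial sums are positive.
module Submission where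

open import Defs
open import Algebra.Bundles using (CommutativeRing)
import Algebra.Solver.Ring
open import Algebra.Solver.Ring.AlmostCommutativeRing using (_-Raw-AlmostCommutative⟶_; fromCommutativeRing; Induced-equivalence)
open import Data.Bool.Base using (true; false; if_then_else_)
open import Data.Empty using (⊥-elim)
open import Data.Integer.Base using (ℤ; +_; -[1+_]; 0ℤ; 1ℤ)
import Data.Integer.Base as ℤ
import Data.Integer.Properties as ℤₚ
open import Data.Integer.Solver using (module +-*-Solver)
open import Data.Maybe.Base using (map)
open import Data.Nat.Base as ℕ using (ℕ; zero; suc; z≤n; s≤s; _≤_; _≡ᵇ_)
open import Data.Nat.Divisibility using (_∣_; _∣?_; ∣m∣n⇒∣m+n; ∣m+n∣m⇒∣n; ∣-refl; _∣0; ∣⇒≤; 1∣_)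
import Data.Nat.Properties as ℕₚ
open import Data.Product using (Σ; _,_; proj₁; proj₂)
open import Level using (0ℓ; _⊔_)
open import Relation.Binary.Definitions using (WeaklyDecidable)
import Relation.Binary.PropositionalEquality as ≡
open ≡ using (_≡_)
open import Relation.Nullary using (¬_)
open import Relation.Nullary.Decidable using (⌊_⌋; yes; no; dec⇒maybe)

-- The theta argument needs fifth roots of unity among the coefficients, while the theorem is about
-- signs of integers. Hence the theory is developed over an arbitrary commutative ring `R` with a
-- map `ι` from the integers and instantiated at ℤ[ζ]. Signs survive because positivity is taken to
-- mean being the image of a positive integer.
--
-- Division has to be replaced twice. Quotients of series are multiplied out, and a series with
-- constant term 1 can be cancelled over any `R`. The factor 1 - ζ⁴, which the triple product
-- contributes at q = 0, is not a unit of ℤ[ζ]; it is completed to the product of all 1 - ζⁱ, which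
-- is 5, and then removed because there is no 5-torsion.
--
-- Nor is a square root extracted to pick the root of the quadratic for R⁵: the difference of the
-- two candidates is one factor of a vanishing product whose other factor has constant term 1.

module PowerSeriesRing {c ℓ} (R : CommutativeRing c ℓ) where
  open CommutativeRing R
  open import Relation.Binary.Reasoning.Setoid setoid
  open import Algebra.Properties.CommutativeSemigroup +-commutativeSemigroup using (x∙yz≈y∙xz; interchange)

  Series : Set c
  Series = ℕ → Carrier

  infix 4 _≐_
  _≐_ : Series → Series → Set ℓ
  f ≐ g = ∀ n → f n ≈ g n

  infix 4 _≋_
  -- Wrapping the pointwise relation in a record lets Agda recover `f` and `g` from the type of a
  -- proof, which a bare function type does not allow.
  record _≋_ (f g : Series) : Set ℓ where
    constructor mk≋
    field at : f ≐ g
  open _≋_ public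

  tail : Series → Series
  tail f n = f (suc n)

  const : Carrier → Series
  const r zero    = r
  const r (suc n) = 0#

  infixl 6 _⊕_
  infixl 7 _⊗_
  infix  8 ⊖_
  -- The Cauchy product `_⊗_` follows f = f 0 + q * `tail f`, so the ring laws become inductions on
  -- the index instead of manipulations of double sums.
  _⊕_ _⊗_ : Series → Series → Series
  (f ⊕ g) n = f n + g n
  (f ⊗ g) zero    = f 0 * g 0
  (f ⊗ g) (suc n) = f 0 * g (suc n) + (tail f ⊗ g) n

  ⊖_ : Series → Series
  (⊖ f) n = - f n

  𝟘 𝟙 : Series
  𝟘 n = 0#
  𝟙 = const 1#

  ⊗-cong : ∀ {f f′ g g′} → f ≐ f′ → g ≐ g′ → f ⊗ g ≐ f′ ⊗ g′
  ⊗-cong p r zero    = *-cong (p 0) (r 0)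
  ⊗-cong p r (suc n) = +-cong (*-cong (p 0) (r (suc n))) (⊗-cong (λ i → p (suc i)) r n)

  ⊗-zeroˡ : ∀ f → 𝟘 ⊗ f ≐ 𝟘
  ⊗-zeroˡ f zero    = zeroˡ (f 0)
  ⊗-zeroˡ f (suc n) = trans (+-cong (zeroˡ (f (suc n))) (⊗-zeroˡ f n)) (+-identityˡ 0#)

  ⊗-const : ∀ r f n → (const r ⊗ f) n ≈ r * f n
  ⊗-const r f zero    = refl
  ⊗-const r f (suc n) = trans (+-congˡ (⊗-zeroˡ f n)) (+-identityʳ _)

  ⊗-distribʳ : ∀ h f g → (f ⊕ g) ⊗ h ≐ f ⊗ h ⊕ g ⊗ h
  ⊗-distribʳ h f g zero    = distribʳ (h 0) (f 0) (g 0)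
  ⊗-distribʳ h f g (suc n) = begin
    (f 0 + g 0) * h (suc n) + ((tail f ⊕ tail g) ⊗ h) n
      ≈⟨ +-cong (distribʳ _ _ _) (⊗-distribʳ h (tail f) (tail g) n) ⟩
    (f 0 * h (suc n) + g 0 * h (suc n)) + ((tail f ⊗ h) n + (tail g ⊗ h) n)
      ≈⟨ interchange _ _ _ _ ⟩
    (f ⊗ h ⊕ g ⊗ h) (suc n) ∎

  -- The definition strips the left factor; stripping the right factor as well makes commutativity a
  -- plain induction.
  ⊗-suc : ∀ f g n → (f ⊗ g) (suc n) ≈ f (suc n) * g 0 + (f ⊗ tail g) n
  ⊗-suc f g zero    = +-comm _ _
  ⊗-suc f g (suc n) = begin
    f 0 * g (suc (suc n)) + (tail f ⊗ g) (suc n)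
      ≈⟨ +-congˡ (⊗-suc (tail f) g n) ⟩
    f 0 * g (suc (suc n)) + (f (suc (suc n)) * g 0 + (tail f ⊗ tail g) n)
      ≈⟨ x∙yz≈y∙xz _ _ _ ⟩
    f (suc (suc n)) * g 0 + (f ⊗ tail g) (suc n) ∎

  ⊗-comm : ∀ f g → f ⊗ g ≐ g ⊗ f
  ⊗-comm f g zero    = *-comm _ _
  ⊗-comm f g (suc n) = trans (+-cong (*-comm _ _) (⊗-comm (tail f) g n)) (sym (⊗-suc g f n))

  ⊗-assoc : ∀ f g h → (f ⊗ g) ⊗ h ≐ f ⊗ (g ⊗ h)
  ⊗-assoc f g h zero    = *-assoc _ _ _
  ⊗-assoc f g h (suc n) = begin
    f 0 * g 0 * h (suc n) + (tail (f ⊗ g) ⊗ h) n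
      ≈⟨ +-cong (*-assoc _ _ _)
           (trans (⊗-cong (λ i → +-congʳ (sym (⊗-const (f 0) (tail g) i))) (λ _ → refl) n)
                  (⊗-distribʳ h (const (f 0) ⊗ tail g) (tail f ⊗ g) n)) ⟩
    f 0 * (g 0 * h (suc n)) + (((const (f 0) ⊗ tail g) ⊗ h) n + ((tail f ⊗ g) ⊗ h) n)
      ≈⟨ +-congˡ (+-cong (scaled (f 0) (tail g) h n) (⊗-assoc (tail f) g h n)) ⟩
    f 0 * (g 0 * h (suc n)) + (f 0 * (tail g ⊗ h) n + (tail f ⊗ (g ⊗ h)) n)
      ≈⟨ +-assoc _ _ _ ⟨
    f 0 * (g 0 * h (suc n)) + f 0 * (tail g ⊗ h) n + (tail f ⊗ (g ⊗ h)) n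
      ≈⟨ +-congʳ (distribˡ _ _ _) ⟨
    (f ⊗ (g ⊗ h)) (suc n) ∎
    where
    scaled : ∀ r f g n → ((const r ⊗ f) ⊗ g) n ≈ r * (f ⊗ g) n
    scaled r f g zero    = *-assoc _ _ _
    scaled r f g (suc n) = begin
      r * f 0 * g (suc n) + (tail (const r ⊗ f) ⊗ g) n
        ≈⟨ +-cong (*-assoc _ _ _) (⊗-cong (λ i → trans (⊗-const r f (suc i)) (sym (⊗-const r (tail f) i))) (λ _ → refl) n) ⟩
      r * (f 0 * g (suc n)) + ((const r ⊗ tail f) ⊗ g) n
        ≈⟨ +-congˡ (scaled r (tail f) g n) ⟩
      r * (f 0 * g (suc n)) + r * (tail f ⊗ g) n
        ≈⟨ distribˡ _ _ _ ⟨
      r * (f ⊗ g) (suc n) ∎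

  seriesRing : CommutativeRing c ℓ
  seriesRing = record
    { Carrier = Series
    ; _≈_ = _≋_
    ; _+_ = _⊕_
    ; _*_ = _⊗_
    ; -_ = ⊖_
    ; 0# = 𝟘
    ; 1# = 𝟙
    ; isCommutativeRing = record
      { isRing = record
        { +-isAbelianGroup = record
          { isGroup = record
            { isMonoid = record
              { isSemigroup = record
                { isMagma = record
                  { isEquivalence = record
                    { refl = mk≋ λ _ → refl
                    ; sym = λ p → mk≋ λ n → sym (at p n)
                    ; trans = λ p r → mk≋ λ n → trans (at p n) (at r n)
                    }
                  ; ∙-cong = λ p r → mk≋ λ n → +-cong (at p n) (at r n)
                  }
                ; assoc = λ f g h → mk≋ λ n → +-assoc (f n) (g n) (h n)
                }
              ; identity = (λ f → mk≋ λ n → +-identityˡ (f n)) , (λ f → mk≋ λ n → +-identityʳ (f n))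
              }
            ; inverse = (λ f → mk≋ λ n → -‿inverseˡ (f n)) , (λ f → mk≋ λ n → -‿inverseʳ (f n))
            ; ⁻¹-cong = λ p → mk≋ λ n → -‿cong (at p n)
            }
          ; comm = λ f g → mk≋ λ n → +-comm (f n) (g n)
          }
        ; *-cong = λ p r → mk≋ (⊗-cong (at p) (at r))
        ; *-assoc = λ f g h → mk≋ (⊗-assoc f g h)
        ; *-identity = (λ f → mk≋ (⊗-identityˡ f)) , λ f → mk≋ λ n → trans (⊗-comm f 𝟙 n) (⊗-identityˡ f n)
        ; distrib = (λ f g h → mk≋ λ n → trans (⊗-comm f (g ⊕ h) n) (trans (⊗-distribʳ f g h n) (+-cong (⊗-comm g f n) (⊗-comm h f n))))
                  , λ h f g → mk≋ (⊗-distribʳ h f g)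
        }
      ; *-comm = λ f g → mk≋ (⊗-comm f g)
      }
    }
    where
    ⊗-identityˡ : ∀ f → 𝟙 ⊗ f ≐ f
    ⊗-identityˡ f n = trans (⊗-const 1# f n) (*-identityˡ (f n))

-- Integer coefficients for the ring solver

IntegerMap : ∀ {c ℓ} → CommutativeRing c ℓ → Set _
IntegerMap A = ℤ.+-*-rawRing -Raw-AlmostCommutative⟶ fromCommutativeRing A

-- The integers 0 and 1 are sent to 0# and 1# on the nose, so that the solver can mention these constants.
module IntegerSolver {c ℓ} (A : CommutativeRing c ℓ) (ι : IntegerMap A) where
  open CommutativeRing A
  private module ι = _-Raw-AlmostCommutative⟶_ ι

  int : ℤ → Carrier
  int (+ 0)      = 0#
  int (+ 1)      = 1#
  int z          = ι.⟦ z ⟧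

  int≈ι : ∀ z → int z ≈ ι.⟦ z ⟧
  int≈ι (+ 0)           = sym ι.0-homo
  int≈ι (+ 1)           = sym ι.1-homo
  int≈ι (+ suc (suc n)) = refl
  int≈ι -[1+ n ]        = refl

  int-homo : IntegerMap A
  int-homo = record
    { ⟦_⟧ = int
    ; +-homo = λ x y → trans (int≈ι (x ℤ.+ y)) (trans (ι.+-homo x y) (sym (+-cong (int≈ι x) (int≈ι y))))
    ; *-homo = λ x y → trans (int≈ι (x ℤ.* y)) (trans (ι.*-homo x y) (sym (*-cong (int≈ι x) (int≈ι y))))
    ; -‿homo = λ x → trans (int≈ι (ℤ.- x)) (trans (ι.-‿homo x) (sym (-‿cong (int≈ι x))))
    ; 0-homo = refl
    ; 1-homo = refl
    }

  coefficient? : WeaklyDecidable (Induced-equivalence int-homo)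
  coefficient? x y = map (λ p → reflexive (≡.cong int p)) (dec⇒maybe (x ℤₚ.≟ y))

  open Algebra.Solver.Ring ℤ.+-*-rawRing (fromCommutativeRing A) int-homo coefficient? public
    using (Polynomial; solve; con; _:+_; _:*_; _:-_; :-_; _:^_; _:=_)

-- Truncation, infinite products and continuous endomorphisms of power series

module SeriesCalculus {c ℓ} (R : CommutativeRing c ℓ) (ι : IntegerMap R) where
  private module R = CommutativeRing R
  private module ι = _-Raw-AlmostCommutative⟶_ ι
  open PowerSeriesRing R public using (Series; mk≋; at; tail; const; ⊗-cong; ⊗-const; ⊗-zeroˡ; seriesRing)
  open CommutativeRing seriesRing public hiding (Carrier)
  open import Algebra.Properties.CommutativeSemiring.Exp commutativeSemiring public
  open import Algebra.Properties.AbelianGroup R.+-abelianGroup using (ε⁻¹≈ε)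
  open import Relation.Binary.Reasoning.Setoid R.setoid

  seriesMap : IntegerMap seriesRing
  seriesMap = record
    { ⟦_⟧ = λ z → const ι.⟦ z ⟧
    ; +-homo = λ x y → mk≋ λ { zero → ι.+-homo x y ; (suc n) → R.sym (R.+-identityˡ R.0#) }
    ; *-homo = λ x y → mk≋ λ
      { zero → ι.*-homo x y
      ; (suc n) → R.sym (R.trans (⊗-const ι.⟦ x ⟧ (const ι.⟦ y ⟧) (suc n)) (R.zeroʳ _)) }
    ; -‿homo = λ x → mk≋ λ { zero → ι.-‿homo x ; (suc n) → R.sym ε⁻¹≈ε }
    ; 0-homo = mk≋ λ { zero → ι.0-homo ; (suc n) → R.refl }
    ; 1-homo = mk≋ λ { zero → ι.1-homo ; (suc n) → R.refl }
    }

  open IntegerSolver seriesRing seriesMap public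

  X : Series
  X zero    = R.0#
  X (suc n) = 1# n

  X*-zero : ∀ f → (X * f) 0 R.≈ R.0#
  X*-zero f = R.zeroˡ _

  X*-suc : ∀ f n → (X * f) (suc n) R.≈ f n
  X*-suc f n = R.trans (R.+-cong (R.zeroˡ _) (at (*-identityˡ f) n)) (R.+-identityˡ _)

  X^*-≥ : ∀ k f n → (X ^ k * f) (k ℕ.+ n) R.≈ f n
  X^*-≥ zero    f n = at (*-identityˡ f) n
  X^*-≥ (suc k) f n = begin
    (X ^ suc k * f) (suc k ℕ.+ n)   ≈⟨ at (*-assoc X (X ^ k) f) (suc k ℕ.+ n) ⟩
    (X * (X ^ k * f)) (suc k ℕ.+ n) ≈⟨ X*-suc (X ^ k * f) (k ℕ.+ n) ⟩
    (X ^ k * f) (k ℕ.+ n)           ≈⟨ X^*-≥ k f n ⟩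
    f n ∎

  1^ : ∀ k → 1# ^ k ≈ 1#
  1^ zero    = refl
  1^ (suc k) = trans (*-identityˡ _) (1^ k)

  infix 4 _≡[_]_
  -- Congruence modulo q^n. It stands in for the q-adic topology: a limit is a family of
  -- congruences, and `≡[]⇒≈` turns a full family into an equality.
  record _≡[_]_ (f : Series) (n : ℕ) (g : Series) : Set ℓ where
    constructor mk≡
    field at< : ∀ i → i ℕ.< n → f i R.≈ g i
  open _≡[_]_ public

  ≈⇒≡[] : ∀ {n f g} → f ≈ g → f ≡[ n ] g
  ≈⇒≡[] p = mk≡ λ i _ → at p i

  ≡[]⇒≈ : ∀ {f g} → (∀ n → f ≡[ n ] g) → f ≈ g
  ≡[]⇒≈ p = mk≋ λ n → at< (p (suc n)) n ℕₚ.≤-refl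

  ≡[]-refl : ∀ {n f} → f ≡[ n ] f
  ≡[]-refl = mk≡ λ _ _ → R.refl

  ≡[]-sym : ∀ {n f g} → f ≡[ n ] g → g ≡[ n ] f
  ≡[]-sym p = mk≡ λ i i<n → R.sym (at< p i i<n)

  ≡[]-trans : ∀ {n f g h} → f ≡[ n ] g → g ≡[ n ] h → f ≡[ n ] h
  ≡[]-trans p r = mk≡ λ i i<n → R.trans (at< p i i<n) (at< r i i<n)

  ≡[]-weaken : ∀ {m n f g} → m ≤ n → f ≡[ n ] g → f ≡[ m ] g
  ≡[]-weaken m≤n p = mk≡ λ i i<m → at< p i (ℕₚ.<-≤-trans i<m m≤n)

  ≡[]-+ : ∀ {n f f′ g g′} → f ≡[ n ] f′ → g ≡[ n ] g′ → f + g ≡[ n ] f′ + g′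
  ≡[]-+ p r = mk≡ λ i i<n → R.+-cong (at< p i i<n) (at< r i i<n)

  ≡[]-neg : ∀ {n f f′} → f ≡[ n ] f′ → - f ≡[ n ] - f′
  ≡[]-neg p = mk≡ λ i i<n → R.-‿cong (at< p i i<n)

  ≡[]-* : ∀ {n f f′ g g′} → f ≡[ n ] f′ → g ≡[ n ] g′ → f * g ≡[ n ] f′ * g′
  ≡[]-* p r = mk≡ λ i i<n → go i (λ j j≤i → at< p j (ℕₚ.≤-<-trans j≤i i<n)) (λ j j≤i → at< r j (ℕₚ.≤-<-trans j≤i i<n))
    where
    go : ∀ {f f′ g g′} i → (∀ j → j ≤ i → f j R.≈ f′ j) → (∀ j → j ≤ i → g j R.≈ g′ j) → (f * g) i R.≈ (f′ * g′) i
    go zero    p r = R.*-cong (p 0 z≤n) (r 0 z≤n)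
    go (suc i) p r = R.+-cong (R.*-cong (p 0 z≤n) (r (suc i) ℕₚ.≤-refl))
      (go i (λ j j≤i → p (suc j) (s≤s j≤i)) (λ j j≤i → r j (ℕₚ.m≤n⇒m≤1+n j≤i)))

  ≡[]-^ : ∀ {n f g} → f ≡[ n ] g → ∀ k → f ^ k ≡[ n ] g ^ k
  ≡[]-^ p zero    = ≡[]-refl
  ≡[]-^ p (suc k) = ≡[]-* p (≡[]-^ p k)

  -- Orders of vanishing add up; the induction strips one zero leading coefficient off `f` at a
  -- time.
  vanish-* : ∀ {n g} m {f} → f ≡[ m ] 0# → g ≡[ n ] 0# → f * g ≡[ m ℕ.+ n ] 0#
  vanish-* zero    {f} p r = ≡[]-trans (≡[]-* (≡[]-refl {f = f}) r) (≈⇒≡[] (zeroʳ f))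
  vanish-* {n} {g} (suc m) {f} p r = mk≡ λ
    { zero    _         → R.trans (R.*-congʳ f₀≈0) (R.zeroˡ _)
    ; (suc i) (s≤s i<k) → R.trans (R.+-cong (R.trans (R.*-congʳ f₀≈0) (R.zeroˡ _))
        (at< (vanish-* m {tail f} (mk≡ λ j j<m → at< p (suc j) (s≤s j<m)) r) i i<k)) (R.+-identityˡ _) }
    where
    f₀≈0 : f 0 R.≈ R.0#
    f₀≈0 = at< p 0 (s≤s z≤n)

  vanish-^ : ∀ {f} → f ≡[ 1 ] 0# → ∀ k → f ^ k ≡[ k ] 0#
  vanish-^ p zero    = mk≡ λ _ ()
  vanish-^ p (suc k) = vanish-* 1 p (vanish-^ p k)

  X≡[1]0 : X ≡[ 1 ] 0#
  X≡[1]0 = mk≡ λ { zero _ → R.refl ; (suc i) (s≤s ()) }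

  vanish-*ˡ : ∀ {n g} f → g ≡[ n ] 0# → f * g ≡[ n ] 0#
  vanish-*ˡ f = vanish-* 0 {f} (mk≡ λ _ ())

  1+vanish : ∀ {n f} → f ≡[ n ] 0# → 1# + f ≡[ n ] 1#
  1+vanish p = ≡[]-trans (≡[]-+ ≡[]-refl p) (≈⇒≡[] (+-identityʳ 1#))

  1-vanish : ∀ {n f} → f ≡[ n ] 0# → 1# - f ≡[ n ] 1#
  1-vanish {n} {f} p = 1+vanish (≡[]-trans (≡[]-neg p) (≈⇒≡[] (solve 0 (:- con (+ 0) := con (+ 0)) refl)))

  -- With d = f - g one has d = (h f - h g) - (h - 1) d, and h - 1 is divisible by q, so every pass
  -- gains one order of vanishing. No inverse of `h` is constructed.
  *-cancel-≡[] : ∀ {h f g} → h ≡[ 1 ] 1# → ∀ n → h * f ≡[ n ] h * g → f ≡[ n ] g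
  *-cancel-≡[] {h} {f} {g} h₀ n p =
    ≡[]-trans (≈⇒≡[] (solve 2 (λ x y → x := (x :- y) :+ y) refl f g))
      (≡[]-trans (≡[]-+ (difference n p) ≡[]-refl) (≈⇒≡[] (+-identityˡ g)))
    where
    h-1 : h - 1# ≡[ 1 ] 0#
    h-1 = ≡[]-trans (≡[]-+ h₀ ≡[]-refl) (≈⇒≡[] (-‿inverseʳ 1#))

    difference : ∀ n → h * f ≡[ n ] h * g → f - g ≡[ n ] 0#
    difference zero    p = mk≡ λ _ ()
    difference (suc n) p =
      ≡[]-trans (≈⇒≡[] (solve 3 (λ h x y → x :- y := (h :* x :- h :* y) :- (h :- con (+ 1)) :* (x :- y)) refl h f g))
        (≡[]-trans (≡[]-+ (≡[]-trans (≡[]-+ p ≡[]-refl) (≈⇒≡[] (-‿inverseʳ _)))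
                          (≡[]-neg (vanish-* 1 h-1 (difference n (≡[]-weaken (ℕₚ.n≤1+n n) p)))))
          (≈⇒≡[] (-‿inverseʳ 0#)))

  *-cancel : ∀ {h f g} → h ≡[ 1 ] 1# → h * f ≈ h * g → f ≈ g
  *-cancel h₀ p = ≡[]⇒≈ λ n → *-cancel-≡[] h₀ n (≈⇒≡[] p)

  ∏ : ℕ → (ℕ → Series) → Series
  ∏ zero    F = 1#
  ∏ (suc n) F = ∏ n F * F n

  ∏-cong : ∀ {F G} → (∀ j → F j ≈ G j) → ∀ n → ∏ n F ≈ ∏ n G
  ∏-cong p zero    = refl
  ∏-cong p (suc n) = *-cong (∏-cong p n) (p n)

  ∏-* : ∀ F G n → ∏ n (λ j → F j * G j) ≈ ∏ n F * ∏ n G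
  ∏-* F G zero    = sym (*-identityˡ 1#)
  ∏-* F G (suc n) = trans (*-congʳ (∏-* F G n))
    (solve 4 (λ p q f g → (p :* q) :* (f :* g) := (p :* f) :* (q :* g)) refl (∏ n F) (∏ n G) (F n) (G n))

  -- One factor for each residue of the index modulo 5: the unit in which products in q and in q^5
  -- are compared.
  block : (ℕ → Series) → ℕ → Series
  block F k = F (k ℕ.* 5) * F (1 ℕ.+ k ℕ.* 5) * F (2 ℕ.+ k ℕ.* 5) * F (3 ℕ.+ k ℕ.* 5) * F (4 ℕ.+ k ℕ.* 5)

  ∏-block : ∀ F n → ∏ n (block F) ≈ ∏ (n ℕ.* 5) F
  ∏-block F zero    = refl
  ∏-block F (suc n) = trans (*-congʳ (∏-block F n))
    (solve 6 (λ p a b c d e → p :* (a :* b :* c :* d :* e) := p :* a :* b :* c :* d :* e) refl _ _ _ _ _ _)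

  Convergent : (ℕ → Series) → Set ℓ
  Convergent F = ∀ j → F j ≡[ j ] 1#

  -- The coefficient of q^n in the infinite product is that of its first n + 1 factors, as F j ≡ 1 mod q^j.
  ∏∞ : (ℕ → Series) → Series
  ∏∞ F n = ∏ (suc n) F n

  ∏-stable : ∀ {F} → Convergent F → ∀ {n} m k → n ≤ m → ∏ (k ℕ.+ m) F ≡[ n ] ∏ m F
  ∏-stable conv m zero    n≤m = ≡[]-refl
  ∏-stable {F} conv m (suc k) n≤m =
    ≡[]-trans (≡[]-* (∏-stable conv m k n≤m) (≡[]-weaken (ℕₚ.≤-trans n≤m (ℕₚ.m≤n+m m k)) (conv (k ℕ.+ m)))) (≈⇒≡[] (*-identityʳ _))

  ∏∞-∏ : ∀ {F} → Convergent F → ∀ {n m} → n ≤ m → ∏∞ F ≡[ n ] ∏ m F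
  ∏∞-∏ {F} conv {n} {m} n≤m = mk≡ λ i i<n → let i<m = ℕₚ.<-≤-trans i<n n≤m in
    ≡.subst (λ l → ∏∞ F i R.≈ ∏ l F i) (ℕₚ.m∸n+n≡m i<m)
      (R.sym (at< (∏-stable conv {suc i} (suc i) (m ℕ.∸ suc i) ℕₚ.≤-refl) i ℕₚ.≤-refl))

  ∏∞-cong : ∀ {F G} → (∀ j → F j ≈ G j) → ∏∞ F ≈ ∏∞ G
  ∏∞-cong p = mk≋ λ n → at (∏-cong p (suc n)) n

  Convergent-* : ∀ {F G} → Convergent F → Convergent G → Convergent (λ j → F j * G j)
  Convergent-* cf cg j = ≡[]-trans (≡[]-* (cf j) (cg j)) (≈⇒≡[] (*-identityˡ 1#))

  ∏∞-* : ∀ {F G} → Convergent F → Convergent G → ∏∞ (λ j → F j * G j) ≈ ∏∞ F * ∏∞ G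
  ∏∞-* {F} {G} cf cg = ≡[]⇒≈ λ n →
    ≡[]-trans (∏∞-∏ (Convergent-* cf cg) ℕₚ.≤-refl)
      (≡[]-trans (≈⇒≡[] (∏-* F G n)) (≡[]-sym (≡[]-* (∏∞-∏ cf ℕₚ.≤-refl) (∏∞-∏ cg ℕₚ.≤-refl))))

  Convergent-^ : ∀ {F} → Convergent F → ∀ k → Convergent (λ j → F j ^ k)
  Convergent-^ conv zero    j = ≡[]-refl
  Convergent-^ conv (suc k)   = Convergent-* conv (Convergent-^ conv k)

  ∏∞-^ : ∀ {F} → Convergent F → ∀ k → ∏∞ (λ j → F j ^ k) ≈ ∏∞ F ^ k
  ∏∞-^ conv zero    = mk≋ λ n → at (∏-1 (suc n)) n
    where
    ∏-1 : ∀ n → ∏ n (λ _ → 1#) ≈ 1#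
    ∏-1 zero    = refl
    ∏-1 (suc n) = trans (*-identityʳ _) (∏-1 n)
  ∏∞-^ conv (suc k) = trans (∏∞-* conv (Convergent-^ conv k)) (*-congˡ (∏∞-^ conv k))

  Convergent-block : ∀ {F} → Convergent F → Convergent (block F)
  Convergent-block {F} conv = Convergent-* (Convergent-* (Convergent-* (Convergent-* (entry 0) (entry 1)) (entry 2)) (entry 3)) (entry 4)
    where
    entry : ∀ r k → F (r ℕ.+ k ℕ.* 5) ≡[ k ] 1#
    entry r k = ≡[]-weaken (ℕₚ.≤-trans (ℕₚ.m≤m*n k 5) (ℕₚ.m≤n+m (k ℕ.* 5) r)) (conv (r ℕ.+ k ℕ.* 5))

  ∏∞-block : ∀ {F} → Convergent F → ∏∞ F ≈ ∏∞ (block F)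
  ∏∞-block {F} conv = ≡[]⇒≈ λ n →
    ≡[]-trans (∏∞-∏ conv (ℕₚ.m≤m*n n 5))
      (≡[]-trans (≈⇒≡[] (sym (∏-block F n))) (≡[]-sym (∏∞-∏ (Convergent-block conv) ℕₚ.≤-refl)))

  ∏∞-head : ∀ {F} → Convergent F → ∏∞ F ≈ F 0 * ∏∞ (λ j → F (suc j))
  ∏∞-head {F} conv = ≡[]⇒≈ λ n →
    ≡[]-trans (∏∞-∏ conv (ℕₚ.n≤1+n n))
      (≡[]-trans (≈⇒≡[] (∏-head n)) (≡[]-* ≡[]-refl (≡[]-sym (∏∞-∏ (λ j → ≡[]-weaken (ℕₚ.n≤1+n j) (conv (suc j))) ℕₚ.≤-refl))))
    where
    ∏-head : ∀ n → ∏ (suc n) F ≈ F 0 * ∏ n (λ j → F (suc j))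
    ∏-head zero    = *-comm 1# (F 0)
    ∏-head (suc n) = trans (*-congʳ (∏-head n)) (*-assoc (F 0) _ (F (suc n)))

  ∏∞≡[1] : ∀ {F} → F 0 ≡[ 1 ] 1# → ∏∞ F ≡[ 1 ] 1#
  ∏∞≡[1] {F} p = mk≡ λ { zero (s≤s z≤n) → R.trans (at (*-identityˡ (F 0)) 0) (at< p 0 (s≤s z≤n)) }

  -- Common interface of q ↦ q^5 and q ↦ ωq. Respecting truncations is the continuity that carries
  -- such a map through `∏∞`.
  record ContinuousHom : Set (c ⊔ ℓ) where
    field
      ⟪_⟫     : Series → Series
      ⟪⟫-≡[]  : ∀ {n f g} → f ≡[ n ] g → ⟪ f ⟫ ≡[ n ] ⟪ g ⟫
      ⟪⟫-1    : ⟪ 1# ⟫ ≈ 1#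
      ⟪⟫-+    : ∀ f g → ⟪ f + g ⟫ ≈ ⟪ f ⟫ + ⟪ g ⟫
      ⟪⟫-neg  : ∀ f → ⟪ - f ⟫ ≈ - ⟪ f ⟫
      ⟪⟫-*    : ∀ f g → ⟪ f * g ⟫ ≈ ⟪ f ⟫ * ⟪ g ⟫

    ⟪⟫-cong : ∀ {f g} → f ≈ g → ⟪ f ⟫ ≈ ⟪ g ⟫
    ⟪⟫-cong p = ≡[]⇒≈ λ n → ⟪⟫-≡[] (≈⇒≡[] p)

    ⟪⟫-^ : ∀ f k → ⟪ f ^ k ⟫ ≈ ⟪ f ⟫ ^ k
    ⟪⟫-^ f zero    = ⟪⟫-1
    ⟪⟫-^ f (suc k) = trans (⟪⟫-* f (f ^ k)) (*-congˡ (⟪⟫-^ f k))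

    ⟪⟫-1+ : ∀ f → ⟪ 1# + f ⟫ ≈ 1# + ⟪ f ⟫
    ⟪⟫-1+ f = trans (⟪⟫-+ 1# f) (+-congʳ ⟪⟫-1)

    ⟪⟫-1- : ∀ f → ⟪ 1# - f ⟫ ≈ 1# - ⟪ f ⟫
    ⟪⟫-1- f = trans (⟪⟫-1+ (- f)) (+-congˡ (⟪⟫-neg f))

    ⟪⟫-∏ : ∀ F n → ⟪ ∏ n F ⟫ ≈ ∏ n (λ j → ⟪ F j ⟫)
    ⟪⟫-∏ F zero    = ⟪⟫-1
    ⟪⟫-∏ F (suc n) = trans (⟪⟫-* (∏ n F) (F n)) (*-congʳ (⟪⟫-∏ F n))

    ⟪⟫-∏∞ : ∀ {F} → Convergent F → ⟪ ∏∞ F ⟫ ≈ ∏∞ (λ j → ⟪ F j ⟫)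
    ⟪⟫-∏∞ {F} conv = ≡[]⇒≈ λ n →
      ≡[]-trans (⟪⟫-≡[] (∏∞-∏ conv ℕₚ.≤-refl))
        (≡[]-trans (≈⇒≡[] (⟪⟫-∏ F n)) (≡[]-sym (∏∞-∏ conv′ ℕₚ.≤-refl)))
      where
      conv′ : Convergent (λ j → ⟪ F j ⟫)
      conv′ j = ≡[]-trans (⟪⟫-≡[] (conv j)) (≈⇒≡[] ⟪⟫-1)

-- Finite sums of series

module Summation {c ℓ} (R : CommutativeRing c ℓ) (ι : IntegerMap R) where
  open SeriesCalculus R ι

  ∑ : ℕ → (ℕ → Series) → Series
  ∑ zero    f = 0#
  ∑ (suc n) f = ∑ n f + f n

  ∑-cong : ∀ {f g} n → (∀ i → f i ≈ g i) → ∑ n f ≈ ∑ n g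
  ∑-cong zero    p = refl
  ∑-cong (suc n) p = +-cong (∑-cong n p) (p n)

  ∑-≡[] : ∀ {f g m} n → (∀ i → i ℕ.< n → f i ≡[ m ] g i) → ∑ n f ≡[ m ] ∑ n g
  ∑-≡[] zero    p = ≡[]-refl
  ∑-≡[] (suc n) p = ≡[]-+ (∑-≡[] n λ i i<n → p i (ℕₚ.m<n⇒m<1+n i<n)) (p n ℕₚ.≤-refl)

  ∑-+ : ∀ n f g → ∑ n (λ i → f i + g i) ≈ ∑ n f + ∑ n g
  ∑-+ zero    f g = sym (+-identityʳ 0#)
  ∑-+ (suc n) f g = trans (+-congʳ (∑-+ n f g))
    (solve 4 (λ p q x y → (p :+ q) :+ (x :+ y) := (p :+ x) :+ (q :+ y)) refl (∑ n f) (∑ n g) (f n) (g n))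

  ∑-*ˡ : ∀ n x f → x * ∑ n f ≈ ∑ n (λ i → x * f i)
  ∑-*ˡ zero    x f = zeroʳ x
  ∑-*ˡ (suc n) x f = trans (distribˡ x (∑ n f) (f n)) (+-congʳ (∑-*ˡ n x f))

  ∑-suc : ∀ n f → ∑ (suc n) f ≈ f 0 + ∑ n (λ i → f (suc i))
  ∑-suc zero    f = +-comm 0# (f 0)
  ∑-suc (suc n) f = trans (+-congʳ (∑-suc n f)) (+-assoc (f 0) _ (f (suc n)))

  ∑-zero : ∀ n → ∑ n (λ _ → 0#) ≈ 0#
  ∑-zero zero    = refl
  ∑-zero (suc n) = trans (+-identityʳ _) (∑-zero n)

  ∑-block : ∀ f n → ∑ (n ℕ.* 5) f ≈ ∑ n (λ k → f (k ℕ.* 5) + f (1 ℕ.+ k ℕ.* 5) + f (2 ℕ.+ k ℕ.* 5) + f (3 ℕ.+ k ℕ.* 5) + f (4 ℕ.+ k ℕ.* 5))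
  ∑-block f zero    = refl
  ∑-block f (suc n) = trans (+-congʳ (+-congʳ (+-congʳ (+-congʳ (+-congʳ (∑-block f n))))))
    (solve 6 (λ p a b c d e → p :+ a :+ b :+ c :+ d :+ e := p :+ (a :+ b :+ c :+ d :+ e)) refl _ _ _ _ _ _)

-- The Jacobi triple product as the limit of its finite form

module JacobiTripleProduct {c ℓ} (R : CommutativeRing c ℓ) (ι : IntegerMap R) where
  open SeriesCalculus R ι
  open Summation R ι
  open import Relation.Binary.Reasoning.Setoid setoid

  -- (Q ; Q)_∞
  euler : Series → Series
  euler Q = ∏∞ (λ j → 1# - Q ^ suc j)

  -- (-a ; Q)_∞ (-b ; Q)_∞
  theta∏ : Series → Series → Series → Series
  theta∏ a b Q = ∏∞ (λ j → (1# + a * Q ^ j) * (1# + b * Q ^ j))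

  -- x^i Q^(i(i-1)/2)
  term : Series → Series → ℕ → Series
  term Q x zero    = 1#
  term Q x (suc i) = x * Q ^ i * term Q x i

  module _ {Q : Series} (Q₀ : Q ≡[ 1 ] 0#) where
    euler-convergent : Convergent (λ j → 1# - Q ^ suc j)
    euler-convergent j = ≡[]-weaken (ℕₚ.n≤1+n j) (1-vanish (vanish-^ Q₀ (suc j)))

    euler≡[1] : euler Q ≡[ 1 ] 1#
    euler≡[1] = ∏∞≡[1] (1-vanish (vanish-^ Q₀ 1))

    theta-convergent₁ : ∀ a → Convergent (λ j → 1# + a * Q ^ j)
    theta-convergent₁ a j = 1+vanish (vanish-*ˡ a (vanish-^ Q₀ j))

    theta-convergent : ∀ a b → Convergent (λ j → (1# + a * Q ^ j) * (1# + b * Q ^ j))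
    theta-convergent a b = Convergent-* (theta-convergent₁ a) (theta-convergent₁ b)

    term-vanish : ∀ x i → term Q x (suc i) ≡[ i ] 0#
    term-vanish x i = ≡[]-trans (≈⇒≡[] (*-comm (x * Q ^ i) _)) (vanish-*ˡ (term Q x i) (vanish-*ˡ x (vanish-^ Q₀ i)))

  module _ (a b Q : Series) (ab≈Q : a * b ≈ Q) where
    factor : ℕ → Series
    factor j = (1# + a * Q ^ j) * (1# + b * Q ^ j)

    u : ℕ → Series
    u i = term Q a i + term Q b i

    -- B n i is the Gaussian binomial coefficient [2n choose n+i] in Q.
    B : ℕ → ℕ → Series
    B zero    zero    = 1#
    B zero    (suc i) = 0#
    B (suc n) zero    = (1# + Q * (Q ^ n * Q ^ n)) * B n 0 + Q * Q ^ n * (B n 1 * (1# + 1#))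
    B (suc n) (suc i) = (1# + Q * (Q ^ n * Q ^ n)) * B n (suc i) + Q ^ (n ℕ.∸ i) * B n i + Q * Q ^ n * Q ^ suc i * B n (suc (suc i))

    B-zero : ∀ n i → n ℕ.< i → B n i ≈ 0#
    B-zero zero    (suc i) _ = refl
    B-zero (suc n) (suc i) (s≤s n<i) = begin
      (1# + Q * (Q ^ n * Q ^ n)) * B n (suc i) + Q ^ (n ℕ.∸ i) * B n i + Q * Q ^ n * Q ^ suc i * B n (suc (suc i))
        ≈⟨ +-cong (+-cong (*-congˡ (B-zero n (suc i) (ℕₚ.m<n⇒m<1+n n<i))) (*-congˡ (B-zero n i n<i)))
                  (*-congˡ (B-zero n (suc (suc i)) (ℕₚ.m<n⇒m<1+n (ℕₚ.m<n⇒m<1+n n<i)))) ⟩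
      (1# + Q * (Q ^ n * Q ^ n)) * 0# + Q ^ (n ℕ.∸ i) * 0# + Q * Q ^ n * Q ^ suc i * 0#
        ≈⟨ solve 3 (λ x y z → x :* con (+ 0) :+ y :* con (+ 0) :+ z :* con (+ 0) := con (+ 0)) refl _ _ _ ⟩
      0# ∎

    -- Multiplying an a-term by `a` moves its index up, while multiplying it by `b` moves it down
    -- and leaves ab = `Q`; b-terms behave symmetrically. The hypothesis `i < n` makes the truncated
    -- subtraction in the exponent a true one.
    raise : ∀ n i → i ℕ.< n → (a + b) * Q ^ n * u (suc i) ≈ Q ^ (n ℕ.∸ suc i) * u (suc (suc i)) + Q * Q ^ n * Q ^ i * u i
    raise n i i<n = begin
      (a + b) * Q ^ n * u (suc i)
        ≈⟨ solve 6 (λ a b y p s t → (a :+ b) :* y :* (a :* p :* s :+ b :* p :* t)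
                     := (a :* y :* (a :* p :* s) :+ b :* y :* (b :* p :* t)) :+ (a :* b) :* y :* p :* (s :+ t)) refl
             a b (Q ^ n) (Q ^ i) (term Q a i) (term Q b i) ⟩
      (a * Q ^ n * term Q a (suc i) + b * Q ^ n * term Q b (suc i)) + (a * b) * Q ^ n * Q ^ i * u i
        ≈⟨ +-cong (+-cong (*-congʳ (*-congˡ split)) (*-congʳ (*-congˡ split))) (*-congʳ (*-congʳ (*-congʳ ab≈Q))) ⟩
      (a * (Q ^ (n ℕ.∸ suc i) * Q ^ suc i) * term Q a (suc i) + b * (Q ^ (n ℕ.∸ suc i) * Q ^ suc i) * term Q b (suc i)) + Q * Q ^ n * Q ^ i * u i
        ≈⟨ +-congʳ (solve 6 (λ a b d p s t → a :* (d :* p) :* s :+ b :* (d :* p) :* t := d :* (a :* p :* s :+ b :* p :* t)) refl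
             a b (Q ^ (n ℕ.∸ suc i)) (Q ^ suc i) (term Q a (suc i)) (term Q b (suc i))) ⟩
      Q ^ (n ℕ.∸ suc i) * u (suc (suc i)) + Q * Q ^ n * Q ^ i * u i ∎
      where
      split : Q ^ n ≈ Q ^ (n ℕ.∸ suc i) * Q ^ suc i
      split = trans (^-congʳ Q (≡.sym (ℕₚ.m∸n+n≡m i<n))) (^-homo-* Q (n ℕ.∸ suc i) (suc i))

    raiseB : ∀ n i → (a + b) * Q ^ n * (B n (suc i) * u (suc i))
      ≈ Q ^ (n ℕ.∸ suc i) * B n (suc i) * u (suc (suc i)) + Q * Q ^ n * Q ^ i * B n (suc i) * u i
    raiseB n i with suc i ℕₚ.≤? n
    ... | yes i<n = begin
      (a + b) * Q ^ n * (B n (suc i) * u (suc i))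
        ≈⟨ solve 3 (λ x y z → x :* (y :* z) := y :* (x :* z)) refl ((a + b) * Q ^ n) (B n (suc i)) (u (suc i)) ⟩
      B n (suc i) * ((a + b) * Q ^ n * u (suc i))
        ≈⟨ *-congˡ (raise n i i<n) ⟩
      B n (suc i) * (Q ^ (n ℕ.∸ suc i) * u (suc (suc i)) + Q * Q ^ n * Q ^ i * u i)
        ≈⟨ solve 5 (λ β x y z w → β :* (x :* y :+ z :* w) := x :* β :* y :+ z :* β :* w) refl
             (B n (suc i)) (Q ^ (n ℕ.∸ suc i)) (u (suc (suc i))) (Q * Q ^ n * Q ^ i) (u i) ⟩
      Q ^ (n ℕ.∸ suc i) * B n (suc i) * u (suc (suc i)) + Q * Q ^ n * Q ^ i * B n (suc i) * u i ∎
    -- Here `n ∸ suc i` is cut off at 0, which is harmless because its coefficient `B n (suc i)`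
    -- vanishes.
    ... | no i≮n = begin
      (a + b) * Q ^ n * (B n (suc i) * u (suc i))
        ≈⟨ *-congˡ (*-congʳ B≈0) ⟩
      (a + b) * Q ^ n * (0# * u (suc i))
        ≈⟨ solve 6 (λ x y z w v t → x :* (con (+ 0) :* y) := z :* con (+ 0) :* w :+ v :* con (+ 0) :* t) refl
             ((a + b) * Q ^ n) (u (suc i)) (Q ^ (n ℕ.∸ suc i)) (u (suc (suc i))) (Q * Q ^ n * Q ^ i) (u i) ⟩
      Q ^ (n ℕ.∸ suc i) * 0# * u (suc (suc i)) + Q * Q ^ n * Q ^ i * 0# * u i
        ≈⟨ +-cong (*-congʳ (*-congˡ B≈0)) (*-congʳ (*-congˡ B≈0)) ⟨
      Q ^ (n ℕ.∸ suc i) * B n (suc i) * u (suc (suc i)) + Q * Q ^ n * Q ^ i * B n (suc i) * u i ∎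
      where
      B≈0 : B n (suc i) ≈ 0#
      B≈0 = B-zero n (suc i) (ℕₚ.≰⇒> i≮n)

    -- The new factor is `c₀` + (a + b) Q^n: the part `c₀` keeps every index, and `raiseB` splits
    -- the rest into moves up (`g`) and down (`h`), which reproduces the recursion of `B`. The 2 in
    -- the row entry of index 0 is `u 0`. The bound `M` is free because the hypothesis for `n` is
    -- needed with as many terms as the conclusion for `suc n`.
    finite-jacobi : ∀ n M → n ≤ M → ∏ n factor ≈ B n 0 + ∑ M (λ i → B n (suc i) * u (suc i))
    finite-jacobi zero    M _ = sym (trans (+-congˡ (trans (∑-cong M λ i → zeroˡ (u (suc i))) (∑-zero M))) (+-identityʳ 1#))
    finite-jacobi (suc n) (suc M) (s≤s n≤M) = begin
      ∏ n factor * factor n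
        ≈⟨ *-cong (finite-jacobi n (suc M) (ℕₚ.m≤n⇒m≤1+n n≤M)) factor-expand ⟩
      (B n 0 + S) * (c₀ + (a + b) * Q ^ n)
        ≈⟨ solve 4 (λ β s c d → (β :+ s) :* (c :+ d) := (c :* β :+ c :* s) :+ (d :* β :+ d :* s)) refl (B n 0) S c₀ ((a + b) * Q ^ n) ⟩
      (c₀ * B n 0 + c₀ * S) + ((a + b) * Q ^ n * B n 0 + (a + b) * Q ^ n * S)
        ≈⟨ +-congˡ (+-cong g₀-eq (trans (∑-*ˡ (suc M) _ _) (trans (∑-cong (suc M) (raiseB n)) (∑-+ (suc M) _ h)))) ⟩
      (c₀ * B n 0 + c₀ * S) + (g 0 + (∑ (suc M) (λ i → g (suc i)) + ∑ (suc M) h))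
        ≈⟨ +-congˡ (trans (sym (+-assoc (g 0) _ (∑ (suc M) h))) (+-cong g-shift h-shift)) ⟩
      (c₀ * B n 0 + c₀ * S) + (∑ (suc M) g + (h 0 + ∑ (suc M) (λ i → h (suc i))))
        ≈⟨ solve 5 (λ x y z v w → (x :+ y) :+ (z :+ (v :+ w)) := (x :+ v) :+ (y :+ z :+ w)) refl (c₀ * B n 0) (c₀ * S) (∑ (suc M) g) (h 0) _ ⟩
      (c₀ * B n 0 + h 0) + (c₀ * S + ∑ (suc M) g + ∑ (suc M) (λ i → h (suc i)))
        ≈⟨ +-cong (+-congˡ h₀-eq)
             (trans (+-congʳ (trans (+-congʳ (∑-*ˡ (suc M) c₀ _)) (sym (∑-+ (suc M) _ g)))) (trans (sym (∑-+ (suc M) _ _)) (∑-cong (suc M) collect))) ⟩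
      B (suc n) 0 + ∑ (suc M) (λ i → B (suc n) (suc i) * u (suc i)) ∎
      where
      S c₀ : Series
      S = ∑ (suc M) (λ i → B n (suc i) * u (suc i))
      c₀ = 1# + Q * (Q ^ n * Q ^ n)
      g h : ℕ → Series
      g i = Q ^ (n ℕ.∸ i) * B n i * u (suc i)
      h i = Q * Q ^ n * Q ^ i * B n (suc i) * u i
      factor-expand : factor n ≈ c₀ + (a + b) * Q ^ n
      factor-expand = trans
        (solve 3 (λ a b y → (con (+ 1) :+ a :* y) :* (con (+ 1) :+ b :* y) := con (+ 1) :+ (a :* b) :* (y :* y) :+ (a :+ b) :* y) refl a b (Q ^ n))
        (+-congʳ (+-congˡ (*-congʳ ab≈Q)))
      g₀-eq : (a + b) * Q ^ n * B n 0 ≈ g 0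
      g₀-eq = solve 4 (λ a b y β → (a :+ b) :* y :* β := y :* β :* (a :* con (+ 1) :* con (+ 1) :+ b :* con (+ 1) :* con (+ 1))) refl a b (Q ^ n) (B n 0)
      h₀-eq : h 0 ≈ Q * Q ^ n * (B n 1 * (1# + 1#))
      h₀-eq = solve 2 (λ x β → x :* con (+ 1) :* β :* (con (+ 1) :+ con (+ 1)) := x :* (β :* (con (+ 1) :+ con (+ 1)))) refl (Q * Q ^ n) (B n 1)
      g-shift : g 0 + ∑ (suc M) (λ i → g (suc i)) ≈ ∑ (suc M) g
      g-shift = trans (sym (∑-suc (suc M) g))
        (trans (+-congˡ (trans (*-congʳ (trans (*-congˡ (B-zero n (suc M) (s≤s n≤M))) (zeroʳ _))) (zeroˡ _))) (+-identityʳ _))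
      h-shift : ∑ (suc M) h ≈ h 0 + ∑ (suc M) (λ i → h (suc i))
      h-shift = trans (∑-suc M h) (+-congˡ (sym
        (trans (+-congˡ (trans (*-congʳ (trans (*-congˡ (B-zero n (suc (suc M)) (s≤s (ℕₚ.m≤n⇒m≤1+n n≤M)))) (zeroʳ _))) (zeroˡ _))) (+-identityʳ _))))
      collect : ∀ i → c₀ * (B n (suc i) * u (suc i)) + g i + h (suc i) ≈ B (suc n) (suc i) * u (suc i)
      collect i = solve 6 (λ x β y z w v → x :* (β :* v) :+ y :* v :+ z :* w :* v := (x :* β :+ y :+ z :* w) :* v) refl
        c₀ (B n (suc i)) (Q ^ (n ℕ.∸ i) * B n i) (Q * Q ^ n * Q ^ suc i) (B n (suc (suc i))) (u (suc i))

    fac : ℕ → Series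
    fac n = ∏ n (λ j → 1# - Q ^ suc j)

    fac-suc+ : ∀ m n → fac (suc (m ℕ.+ n)) ≈ fac (m ℕ.+ n) * (1# - Q * (Q ^ m * Q ^ n))
    fac-suc+ m n = *-congˡ (+-congˡ (-‿cong (*-congˡ (^-homo-* Q m n))))

    -- The product formula for the Gaussian binomial, cleared of denominators, with `j` in the role
    -- of n - i. The two companions give the neighbouring entries of the same row against the same
    -- denominators. Their factors 1 - Q^j and Q - Q^j keep them true at the edge of the row, where
    -- `B` is 0, and the extra `Q` in `B-fac-suc²` avoids the exponent j - 1.
    B-fac : ∀ n i j → i ℕ.+ j ≡ n → B n i * (fac (n ℕ.+ i) * fac j) ≈ fac (n ℕ.+ n)
    B-fac-suc : ∀ n i j → i ℕ.+ j ≡ n → B n (suc i) * (fac (suc (n ℕ.+ i)) * fac j) ≈ (1# - Q ^ j) * fac (n ℕ.+ n)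
    B-fac-suc² : ∀ n i j → i ℕ.+ j ≡ n →
      Q * (B n (suc (suc i)) * (fac (suc (suc (n ℕ.+ i))) * fac j)) ≈ (1# - Q ^ j) * (Q - Q ^ j) * fac (n ℕ.+ n)

    B-fac-suc n i zero eq = trans
      (*-congʳ (B-zero n (suc i) (s≤s (ℕₚ.≤-reflexive (≡.trans (≡.sym eq) (ℕₚ.+-identityʳ i))))))
      (solve 2 (λ x y → con (+ 0) :* x := (con (+ 1) :- con (+ 1)) :* y) refl _ _)
    B-fac-suc n i (suc j) eq = begin
      B n (suc i) * (fac (suc (n ℕ.+ i)) * (fac j * (1# - Q ^ suc j)))
        ≈⟨ solve 4 (λ x y z w → x :* (y :* (z :* w)) := w :* (x :* (y :* z))) refl _ _ (fac j) (1# - Q ^ suc j) ⟩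
      (1# - Q ^ suc j) * (B n (suc i) * (fac (suc (n ℕ.+ i)) * fac j))
        ≈⟨ *-congˡ (*-congˡ (*-congʳ (reflexive (≡.cong fac (ℕₚ.+-suc n i))))) ⟨
      (1# - Q ^ suc j) * (B n (suc i) * (fac (n ℕ.+ suc i) * fac j))
        ≈⟨ *-congˡ (B-fac n (suc i) j (≡.trans (≡.sym (ℕₚ.+-suc i j)) eq)) ⟩
      (1# - Q ^ suc j) * fac (n ℕ.+ n) ∎

    B-fac-suc² n i zero eq = trans
      (*-congˡ (*-congʳ (B-zero n (suc (suc i)) (s≤s (ℕₚ.m≤n⇒m≤1+n (ℕₚ.≤-reflexive (≡.trans (≡.sym eq) (ℕₚ.+-identityʳ i))))))))
      (solve 3 (λ q x y → q :* (con (+ 0) :* x) := (con (+ 1) :- con (+ 1)) :* (q :- con (+ 1)) :* y) refl Q _ _)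
    B-fac-suc² n i (suc j) eq = begin
      Q * (B n (suc (suc i)) * (fac (suc (suc (n ℕ.+ i))) * (fac j * (1# - Q ^ suc j))))
        ≈⟨ solve 5 (λ q x y z w → q :* (x :* (y :* (z :* w))) := q :* w :* (x :* (y :* z))) refl Q _ _ (fac j) (1# - Q ^ suc j) ⟩
      Q * (1# - Q ^ suc j) * (B n (suc (suc i)) * (fac (suc (suc (n ℕ.+ i))) * fac j))
        ≈⟨ *-congˡ (*-congˡ (*-congʳ (reflexive (≡.cong (λ k → fac (suc k)) (ℕₚ.+-suc n i))))) ⟨
      Q * (1# - Q ^ suc j) * (B n (suc (suc i)) * (fac (suc (n ℕ.+ suc i)) * fac j))
        ≈⟨ *-congˡ (B-fac-suc n (suc i) j (≡.trans (≡.sym (ℕₚ.+-suc i j)) eq)) ⟩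
      Q * (1# - Q ^ suc j) * ((1# - Q ^ j) * fac (n ℕ.+ n))
        ≈⟨ solve 3 (λ q r f → q :* (con (+ 1) :- q :* r) :* ((con (+ 1) :- r) :* f) := (con (+ 1) :- q :* r) :* (q :- q :* r) :* f) refl Q (Q ^ j) _ ⟩
      (1# - Q ^ suc j) * (Q - Q ^ suc j) * fac (n ℕ.+ n) ∎

    B-fac zero    zero    zero    eq = solve 0 (con (+ 1) :* (con (+ 1) :* con (+ 1)) := con (+ 1)) refl
    B-fac (suc n) zero (suc .n) ≡.refl = begin
      B (suc n) 0 * (fac (suc n ℕ.+ 0) * fac (suc n))
        ≈⟨ *-congˡ (*-congʳ (reflexive (≡.cong fac (ℕₚ.+-identityʳ (suc n))))) ⟩
      B (suc n) 0 * (fac (suc n) * fac (suc n))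
        ≈⟨ solve 5 (λ β₀ β₁ q y f →
             ((con (+ 1) :+ q :* (y :* y)) :* β₀ :+ q :* y :* (β₁ :* (con (+ 1) :+ con (+ 1)))) :* ((f :* (con (+ 1) :- q :* y)) :* (f :* (con (+ 1) :- q :* y)))
             := (con (+ 1) :+ q :* (y :* y)) :* (con (+ 1) :- q :* y) :* (con (+ 1) :- q :* y) :* (β₀ :* (f :* f))
                :+ q :* y :* (con (+ 1) :+ con (+ 1)) :* (con (+ 1) :- q :* y) :* (β₁ :* (f :* (con (+ 1) :- q :* y) :* f))) refl
             (B n 0) (B n 1) Q (Q ^ n) (fac n) ⟩
      (1# + Q * (Q ^ n * Q ^ n)) * (1# - Q * Q ^ n) * (1# - Q * Q ^ n) * (B n 0 * (fac n * fac n))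
        + Q * Q ^ n * (1# + 1#) * (1# - Q * Q ^ n) * (B n 1 * (fac (suc n) * fac n))
        ≈⟨ +-cong (*-congˡ α) (*-congˡ β) ⟩
      (1# + Q * (Q ^ n * Q ^ n)) * (1# - Q * Q ^ n) * (1# - Q * Q ^ n) * fac (n ℕ.+ n)
        + Q * Q ^ n * (1# + 1#) * (1# - Q * Q ^ n) * ((1# - Q ^ n) * fac (n ℕ.+ n))
        ≈⟨ solve 3 (λ q y f →
             (con (+ 1) :+ q :* (y :* y)) :* (con (+ 1) :- q :* y) :* (con (+ 1) :- q :* y) :* f
                :+ q :* y :* (con (+ 1) :+ con (+ 1)) :* (con (+ 1) :- q :* y) :* ((con (+ 1) :- y) :* f)
             := f :* (con (+ 1) :- q :* (y :* y)) :* (con (+ 1) :- q :* (y :* (q :* y)))) refl Q (Q ^ n) (fac (n ℕ.+ n)) ⟩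
      fac (n ℕ.+ n) * (1# - Q * (Q ^ n * Q ^ n)) * (1# - Q * (Q ^ n * Q ^ suc n))
        ≈⟨ fac-2+ n ⟨
      fac (suc n ℕ.+ suc n) ∎
      where
      fac-2+ : ∀ n → fac (suc n ℕ.+ suc n) ≈ fac (n ℕ.+ n) * (1# - Q * (Q ^ n * Q ^ n)) * (1# - Q * (Q ^ n * Q ^ suc n))
      fac-2+ n = trans (fac-suc+ n (suc n)) (*-congʳ (trans (reflexive (≡.cong fac (ℕₚ.+-suc n n))) (fac-suc+ n n)))
      α : B n 0 * (fac n * fac n) ≈ fac (n ℕ.+ n)
      α = trans (*-congˡ (*-congʳ (reflexive (≡.cong fac (≡.sym (ℕₚ.+-identityʳ n)))))) (B-fac n 0 n ≡.refl)
      β : B n 1 * (fac (suc n) * fac n) ≈ (1# - Q ^ n) * fac (n ℕ.+ n)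
      β = trans (*-congˡ (*-congʳ (reflexive (≡.cong (λ k → fac (suc k)) (≡.sym (ℕₚ.+-identityʳ n)))))) (B-fac-suc n 0 n ≡.refl)
    B-fac (suc n) (suc i) j eq = begin
      B (suc n) (suc i) * (fac (suc (n ℕ.+ suc i)) * fac j)
        ≈⟨ *-congˡ (*-congʳ (reflexive (≡.cong (λ k → fac (suc k)) (ℕₚ.+-suc n i)))) ⟩
      B (suc n) (suc i) * (f₂ * fac j)
        ≈⟨ solve 9 (λ c β₁ d β₀ q y p β₂ f → (c :* β₁ :+ d :* β₀ :+ q :* y :* (q :* p) :* β₂) :* f
              := c :* (β₁ :* f) :+ d :* (β₀ :* f) :+ q :* y :* p :* (q :* (β₂ :* f))) refl
             (1# + Q * (Q ^ n * Q ^ n)) (B n (suc i)) (Q ^ (n ℕ.∸ i)) (B n i) Q (Q ^ n) (Q ^ i) (B n (suc (suc i))) (f₂ * fac j) ⟩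
      (1# + Q * (Q ^ n * Q ^ n)) * (B n (suc i) * (f₂ * fac j)) + Q ^ (n ℕ.∸ i) * (B n i * (f₂ * fac j))
        + Q * Q ^ n * Q ^ i * (Q * (B n (suc (suc i)) * (f₂ * fac j)))
        ≈⟨ +-cong (+-cong (*-congˡ via₁) (*-cong (^-congʳ Q n∸i≡j) via₀)) (*-congˡ (B-fac-suc² n i j i+j≡n)) ⟩
      (1# + Q * (Q ^ n * Q ^ n)) * ((1# - Q * (Q * (Q ^ n * Q ^ i))) * ((1# - Q ^ j) * F))
        + Q ^ j * ((1# - Q * (Q ^ n * Q ^ i)) * (1# - Q * (Q * (Q ^ n * Q ^ i))) * F)
        + Q * Q ^ n * Q ^ i * ((1# - Q ^ j) * (Q - Q ^ j) * F)
        -- Once Q^n is written as Q^i Q^j, an identity between polynomials in Q, Q^i, Q^j and F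
        -- remains.
        ≈⟨ +-cong (+-cong (*-cong (+-congˡ (*-congˡ (*-cong Qⁿ Qⁿ))) (*-congʳ (+-congˡ (-‿cong (*-congˡ (*-congˡ (*-congʳ Qⁿ)))))))
              (*-congˡ (*-congʳ (*-cong (+-congˡ (-‿cong (*-congˡ (*-congʳ Qⁿ)))) (+-congˡ (-‿cong (*-congˡ (*-congˡ (*-congʳ Qⁿ)))))))))
              (*-congʳ (*-congʳ (*-congˡ Qⁿ))) ⟩
      (1# + Q * ((Q ^ i * Q ^ j) * (Q ^ i * Q ^ j))) * ((1# - Q * (Q * ((Q ^ i * Q ^ j) * Q ^ i))) * ((1# - Q ^ j) * F))
        + Q ^ j * ((1# - Q * ((Q ^ i * Q ^ j) * Q ^ i)) * (1# - Q * (Q * ((Q ^ i * Q ^ j) * Q ^ i))) * F)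
        + Q * (Q ^ i * Q ^ j) * Q ^ i * ((1# - Q ^ j) * (Q - Q ^ j) * F)
        ≈⟨ solve 4 (λ q p r f →
             (con (+ 1) :+ q :* ((p :* r) :* (p :* r))) :* ((con (+ 1) :- q :* (q :* ((p :* r) :* p))) :* ((con (+ 1) :- r) :* f))
             :+ r :* ((con (+ 1) :- q :* ((p :* r) :* p)) :* (con (+ 1) :- q :* (q :* ((p :* r) :* p))) :* f)
             :+ q :* (p :* r) :* p :* ((con (+ 1) :- r) :* (q :- r) :* f)
             := f :* (con (+ 1) :- q :* ((p :* r) :* (p :* r))) :* (con (+ 1) :- q :* ((p :* r) :* (q :* (p :* r))))) refl Q (Q ^ i) (Q ^ j) F ⟩
      F * (1# - Q * ((Q ^ i * Q ^ j) * (Q ^ i * Q ^ j))) * (1# - Q * ((Q ^ i * Q ^ j) * (Q * (Q ^ i * Q ^ j))))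
        ≈⟨ *-cong (*-congˡ (+-congˡ (-‿cong (*-congˡ (*-cong Qⁿ Qⁿ))))) (+-congˡ (-‿cong (*-congˡ (*-cong Qⁿ (*-congˡ Qⁿ))))) ⟨
      F * (1# - Q * (Q ^ n * Q ^ n)) * (1# - Q * (Q ^ n * Q ^ suc n))
        ≈⟨ trans (fac-suc+ n (suc n)) (*-congʳ (trans (reflexive (≡.cong fac (ℕₚ.+-suc n n))) (fac-suc+ n n))) ⟨
      fac (suc n ℕ.+ suc n) ∎
      where
      i+j≡n : i ℕ.+ j ≡ n
      i+j≡n = ℕₚ.suc-injective eq
      n∸i≡j : n ℕ.∸ i ≡ j
      n∸i≡j = ≡.trans (≡.cong (ℕ._∸ i) (≡.sym i+j≡n)) (ℕₚ.m+n∸m≡n i j)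
      f₂ F : Series
      f₂ = fac (suc (suc (n ℕ.+ i)))
      F = fac (n ℕ.+ n)
      Qⁿ : Q ^ n ≈ Q ^ i * Q ^ j
      Qⁿ = trans (^-congʳ Q (≡.sym i+j≡n)) (^-homo-* Q i j)
      f₂-eq : f₂ ≈ fac (suc (n ℕ.+ i)) * (1# - Q * (Q * (Q ^ n * Q ^ i)))
      f₂-eq = *-congˡ (+-congˡ (-‿cong (*-congˡ (*-congˡ (^-homo-* Q n i)))))
      via₁ : B n (suc i) * (f₂ * fac j) ≈ (1# - Q * (Q * (Q ^ n * Q ^ i))) * ((1# - Q ^ j) * F)
      via₁ = trans (*-congˡ (*-congʳ f₂-eq))
        (trans (solve 4 (λ β f w g → β :* (f :* w :* g) := w :* (β :* (f :* g))) refl _ _ _ _) (*-congˡ (B-fac-suc n i j i+j≡n)))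
      via₀ : B n i * (f₂ * fac j) ≈ (1# - Q * (Q ^ n * Q ^ i)) * (1# - Q * (Q * (Q ^ n * Q ^ i))) * F
      via₀ = trans (*-congˡ (*-congʳ (trans f₂-eq (*-congʳ (fac-suc+ n i)))))
        (trans (solve 5 (λ β f v w g → β :* (f :* v :* w :* g) := v :* w :* (β :* (f :* g))) refl _ _ _ _ _) (*-congˡ (B-fac n i j i+j≡n)))

    module _ (Q₀ : Q ≡[ 1 ] 0#) where
      E : Series
      E = euler Q

      E-fac : ∀ {n m} → n ≤ m → E ≡[ n ] fac m
      E-fac = ∏∞-∏ (euler-convergent Q₀)

      -- By `B-fac`, `B n i` is a quotient of finite products that are all congruent to `E`, so E² B
      -- ≡ E and one `E` cancels. The shortest product has n - i factors, which sets the precision.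
      B-limit : ∀ n i → i ≤ n → E * B n i ≡[ n ℕ.∸ i ] 1#
      B-limit n i i≤n = *-cancel-≡[] (euler≡[1] Q₀) j
        (≡[]-trans (≈⇒≡[] (solve 2 (λ e β → e :* (e :* β) := β :* (e :* e)) refl E (B n i)))
        (≡[]-trans (≡[]-* ≡[]-refl (≡[]-* (E-fac (ℕₚ.≤-trans (ℕₚ.m∸n≤m n i) (ℕₚ.m≤m+n n i))) (E-fac ℕₚ.≤-refl)))
        (≡[]-trans (≈⇒≡[] (B-fac n i j (ℕₚ.m+[n∸m]≡n i≤n)))
        (≡[]-trans (≡[]-sym (E-fac (ℕₚ.≤-trans (ℕₚ.m∸n≤m n i) (ℕₚ.m≤m+n n n)))) (≈⇒≡[] (sym (*-identityʳ E)))))))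
        where
        j : ℕ
        j = n ℕ.∸ i

      -- `B-limit` is precise only to order m - i; the missing i orders come from `u (suc i)`, which
      -- itself vanishes to order i.
      limit-term : ∀ m i → i ≤ m → E * (B (suc m) (suc i) * u (suc i)) ≡[ m ] u (suc i)
      limit-term m i i≤m =
        ≡[]-trans (≈⇒≡[] (solve 3 (λ e β v → e :* (β :* v) := (e :* β :- con (+ 1)) :* v :+ v) refl E (B (suc m) (suc i)) (u (suc i))))
        (≡[]-trans (≡[]-+ (≡.subst (λ k → (E * B (suc m) (suc i) - 1#) * u (suc i) ≡[ k ] 0#) (ℕₚ.m∸n+n≡m i≤m) (vanish-* (m ℕ.∸ i) minus-one u-vanish)) ≡[]-refl)
          (≈⇒≡[] (+-identityˡ _)))
        where
        minus-one : E * B (suc m) (suc i) - 1# ≡[ m ℕ.∸ i ] 0#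
        minus-one = ≡[]-trans (≡[]-+ (B-limit (suc m) (suc i) (s≤s i≤m)) ≡[]-refl) (≈⇒≡[] (-‿inverseʳ 1#))
        u-vanish : u (suc i) ≡[ i ] 0#
        u-vanish = ≡[]-trans (≡[]-+ (term-vanish Q₀ a i) (term-vanish Q₀ b i)) (≈⇒≡[] (+-identityˡ 0#))

      -- A truncated bilateral sum. The a-term `i` is paired with the b-term `i + 1` because in the
      -- later application at a root of unity both carry the same power of q. The a-term left over
      -- by this pairing vanishes to order m.
      jacobi : ∀ m → E * theta∏ a b Q ≡[ m ] ∑ (suc m) (λ i → term Q a i + term Q b (suc i))
      jacobi m =
        ≡[]-trans (≡[]-* ≡[]-refl (∏∞-∏ (theta-convergent Q₀ a b) (ℕₚ.n≤1+n m)))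
        (≡[]-trans (≈⇒≡[] (trans (*-congˡ (finite-jacobi (suc m) (suc m) ℕₚ.≤-refl)) (trans (distribˡ _ _ _) (+-congˡ (∑-*ˡ (suc m) E _)))))
        (≡[]-trans (≡[]-+ (≡[]-weaken (ℕₚ.n≤1+n m) (B-limit (suc m) 0 z≤n)) (∑-≡[] (suc m) λ i i<n → limit-term m i (ℕₚ.≤-pred i<n)))
        (≡[]-trans (≈⇒≡[] regroup)
        (≡[]-trans (≡[]-+ ≡[]-refl (term-vanish Q₀ a m)) (≈⇒≡[] (+-identityʳ _))))))
        where
        regroup : 1# + ∑ (suc m) (λ i → u (suc i)) ≈ ∑ (suc m) (λ i → term Q a i + term Q b (suc i)) + term Q a (suc m)
        regroup = begin
          1# + ∑ (suc m) (λ i → u (suc i))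
            ≈⟨ +-congˡ (∑-+ (suc m) _ _) ⟩
          1# + (∑ (suc m) (λ i → term Q a (suc i)) + ∑ (suc m) (λ i → term Q b (suc i)))
            ≈⟨ +-assoc _ _ _ ⟨
          1# + ∑ (suc m) (λ i → term Q a (suc i)) + ∑ (suc m) (λ i → term Q b (suc i))
            ≈⟨ +-congʳ (∑-suc (suc m) (term Q a)) ⟨
          ∑ (suc m) (term Q a) + term Q a (suc m) + ∑ (suc m) (λ i → term Q b (suc i))
            ≈⟨ solve 3 (λ x y z → x :+ y :+ z := x :+ z :+ y) refl _ _ _ ⟩
          ∑ (suc m) (term Q a) + ∑ (suc m) (λ i → term Q b (suc i)) + term Q a (suc m)
            ≈⟨ +-congʳ (∑-+ (suc m) _ _) ⟨
          ∑ (suc m) (λ i → term Q a i + term Q b (suc i)) + term Q a (suc m) ∎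

-- The substitutions q ↦ q^5 and q ↦ ωq

module Substitutions {c ℓ} (R : CommutativeRing c ℓ) (ι : IntegerMap R) where
  open SeriesCalculus R ι
  private module R = CommutativeRing R
  private module Rᵉ where
    open import Algebra.Properties.CommutativeSemiring.Exp R.commutativeSemiring public
    open import Algebra.Properties.Ring R.ring public using (-‿distribʳ-*)
    open import Algebra.Properties.AbelianGroup R.+-abelianGroup public using (ε⁻¹≈ε)
    open import Algebra.Properties.CommutativeSemigroup R.*-commutativeSemigroup public using (interchange)
  open import Relation.Binary.Reasoning.Setoid R.setoid

  -- f(q) ↦ f(q^5)
  up : Series → Series
  up f 0 = f 0
  up f 1 = R.0#
  up f 2 = R.0#
  up f 3 = R.0#
  up f 4 = R.0#
  up f (suc (suc (suc (suc (suc n))))) = up (tail f) n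

  private
    up-0 : ∀ n → up 0# n R.≈ R.0#
    up-0 0 = R.refl
    up-0 1 = R.refl
    up-0 2 = R.refl
    up-0 3 = R.refl
    up-0 4 = R.refl
    up-0 (suc (suc (suc (suc (suc n))))) = up-0 n

  up-const : ∀ r n → up (const r) n R.≈ const r n
  up-const r 0 = R.refl
  up-const r 1 = R.refl
  up-const r 2 = R.refl
  up-const r 3 = R.refl
  up-const r 4 = R.refl
  up-const r (suc (suc (suc (suc (suc n))))) = up-0 n

  private
    0*+ : ∀ {x y} → R.0# R.* x R.+ y R.≈ y
    0*+ = R.trans (R.+-congʳ (R.zeroˡ _)) (R.+-identityˡ _)

    *0+ : ∀ {x y} → x R.* R.0# R.+ y R.≈ y
    *0+ = R.trans (R.+-congʳ (R.zeroʳ _)) (R.+-identityˡ _)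

    up-local : ∀ {f g} n → (∀ j → j ≤ n → f j R.≈ g j) → up f n R.≈ up g n
    up-local 0 p = p 0 z≤n
    up-local 1 p = R.refl
    up-local 2 p = R.refl
    up-local 3 p = R.refl
    up-local 4 p = R.refl
    up-local (suc (suc (suc (suc (suc n))))) p =
      up-local n (λ j j≤n → p (suc j) (s≤s (ℕₚ.m≤n⇒m≤1+n (ℕₚ.m≤n⇒m≤1+n (ℕₚ.m≤n⇒m≤1+n (ℕₚ.m≤n⇒m≤1+n j≤n))))))

    -- Stated for r f + g because `tail (f * g)` has exactly this shape, which is what the induction
    -- in `up-*` meets.
    up-linear : ∀ r f g n → up (λ i → r R.* f i R.+ g i) n R.≈ r R.* up f n R.+ up g n
    up-linear r f g 0 = R.refl
    up-linear r f g 1 = R.sym *0+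
    up-linear r f g 2 = R.sym *0+
    up-linear r f g 3 = R.sym *0+
    up-linear r f g 4 = R.sym *0+
    up-linear r f g (suc (suc (suc (suc (suc n))))) = up-linear r (tail f) (tail g) n

    up-neg : ∀ f n → up (- f) n R.≈ R.- up f n
    up-neg f 0 = R.refl
    up-neg f 1 = R.sym Rᵉ.ε⁻¹≈ε
    up-neg f 2 = R.sym Rᵉ.ε⁻¹≈ε
    up-neg f 3 = R.sym Rᵉ.ε⁻¹≈ε
    up-neg f 4 = R.sym Rᵉ.ε⁻¹≈ε
    up-neg f (suc (suc (suc (suc (suc n))))) = up-neg (tail f) n

    up-* : ∀ f g n → (up f * up g) n R.≈ up (f * g) n
    up-* f g 0 = R.refl
    up-* f g 1 = R.trans *0+ (R.zeroˡ _)
    up-* f g 2 = R.trans *0+ (R.trans 0*+ (R.zeroˡ _))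
    up-* f g 3 = R.trans *0+ (R.trans 0*+ (R.trans 0*+ (R.zeroˡ _)))
    up-* f g 4 = R.trans *0+ (R.trans 0*+ (R.trans 0*+ (R.trans 0*+ (R.zeroˡ _))))
    up-* f g (suc (suc (suc (suc (suc n))))) = begin
      f 0 R.* up (tail g) n R.+ (tail (up f) * up g) (suc (suc (suc (suc n))))
        ≈⟨ R.+-congˡ (R.trans 0*+ (R.trans 0*+ (R.trans 0*+ 0*+))) ⟩
      f 0 R.* up (tail g) n R.+ (up (tail f) * up g) n
        ≈⟨ R.+-congˡ (up-* (tail f) g n) ⟩
      f 0 R.* up (tail g) n R.+ up (tail f * g) n
        ≈⟨ up-linear (f 0) (tail g) (tail f * g) n ⟨
      up (tail (f * g)) n ∎

  dilation : ContinuousHom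
  dilation = record
    { ⟪_⟫ = up
    ; ⟪⟫-≡[] = λ p → mk≡ λ i i<n → up-local i (λ j j≤i → at< p j (ℕₚ.≤-<-trans j≤i i<n))
    ; ⟪⟫-1 = mk≋ (up-const R.1#)
    ; ⟪⟫-+ = λ f g → mk≋ λ n → R.trans (up-local n (λ j _ → R.sym (R.+-congʳ (R.*-identityˡ (f j)))))
        (R.trans (up-linear R.1# f g n) (R.+-congʳ (R.*-identityˡ _)))
    ; ⟪⟫-neg = λ f → mk≋ (up-neg f)
    ; ⟪⟫-* = λ f g → mk≋ λ n → R.sym (up-* f g n)
    }

  up-multiple : ∀ f n → up f (n ℕ.* 5) R.≈ f n
  up-multiple f zero    = R.refl
  up-multiple f (suc n) = up-multiple (tail f) n

  up-injective : ∀ {f g} → up f ≈ up g → f ≈ g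
  up-injective {f} {g} p = mk≋ λ n → R.trans (R.sym (up-multiple f n)) (R.trans (at p (n ℕ.* 5)) (up-multiple g n))

  up-nonmultiple : ∀ f r n → r ℕ.< 4 → up f (suc r ℕ.+ n ℕ.* 5) R.≈ R.0#
  up-nonmultiple f 0 zero _ = R.refl
  up-nonmultiple f 1 zero _ = R.refl
  up-nonmultiple f 2 zero _ = R.refl
  up-nonmultiple f 3 zero _ = R.refl
  up-nonmultiple f (suc (suc (suc (suc r)))) zero (s≤s (s≤s (s≤s (s≤s ()))))
  up-nonmultiple f 0 (suc n) r<4 = up-nonmultiple (tail f) 0 n r<4
  up-nonmultiple f 1 (suc n) r<4 = up-nonmultiple (tail f) 1 n r<4
  up-nonmultiple f 2 (suc n) r<4 = up-nonmultiple (tail f) 2 n r<4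
  up-nonmultiple f 3 (suc n) r<4 = up-nonmultiple (tail f) 3 n r<4
  up-nonmultiple f (suc (suc (suc (suc r)))) (suc n) (s≤s (s≤s (s≤s (s≤s ()))))

  up-X : up X ≈ X ^ 5
  up-X = mk≋ λ
    { 0 → low 0 (s≤s z≤n)
    ; 1 → low 1 (s≤s (s≤s z≤n))
    ; 2 → low 2 (s≤s (s≤s (s≤s z≤n)))
    ; 3 → low 3 (s≤s (s≤s (s≤s (s≤s z≤n))))
    ; 4 → low 4 (s≤s (s≤s (s≤s (s≤s (s≤s z≤n)))))
    ; (suc (suc (suc (suc (suc n))))) →
        R.trans (up-const R.1# n) (R.trans (R.sym (X^*-≥ 5 1# n)) (at (*-identityʳ (X ^ 5)) (5 ℕ.+ n))) }
    where
    low : ∀ i → i ℕ.< 5 → R.0# R.≈ (X ^ 5) i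
    low i i<5 = R.sym (at< (vanish-^ X≡[1]0 5) i i<5)

  -- f(q) ↦ f(ω q)
  rot : R.Carrier → Series → Series
  rot ω f n = ω Rᵉ.^ n R.* f n

  private
    rot-* : ∀ ω f g n → (rot ω f * rot ω g) n R.≈ rot ω (f * g) n
    rot-* ω f g zero    = R.trans (R.*-cong (R.*-identityˡ _) (R.*-identityˡ _)) (R.sym (R.*-identityˡ _))
    rot-* ω f g (suc n) = begin
      R.1# R.* f 0 R.* (ω Rᵉ.^ suc n R.* g (suc n)) R.+ (tail (rot ω f) * rot ω g) n
        ≈⟨ R.+-cong (R.trans (Rᵉ.interchange _ _ _ _) (R.*-congʳ (R.*-identityˡ _)))
             (⊗-cong (λ i → R.trans (R.*-assoc _ _ _) (R.sym (⊗-const ω (rot ω (tail f)) i))) (λ _ → R.refl) n) ⟩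
      ω Rᵉ.^ suc n R.* (f 0 R.* g (suc n)) R.+ ((const ω * rot ω (tail f)) * rot ω g) n
        ≈⟨ R.+-congˡ (at (*-assoc (const ω) (rot ω (tail f)) (rot ω g)) n) ⟩
      ω Rᵉ.^ suc n R.* (f 0 R.* g (suc n)) R.+ (const ω * (rot ω (tail f) * rot ω g)) n
        ≈⟨ R.+-congˡ (R.trans (⊗-const ω _ n) (R.trans (R.*-congˡ (rot-* ω (tail f) g n)) (R.sym (R.*-assoc _ _ _)))) ⟩
      ω Rᵉ.^ suc n R.* (f 0 R.* g (suc n)) R.+ ω Rᵉ.^ suc n R.* (tail f * g) n
        ≈⟨ R.distribˡ _ _ _ ⟨
      rot ω (f * g) (suc n) ∎

  rotation : R.Carrier → ContinuousHom
  rotation ω = record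
    { ⟪_⟫ = rot ω
    ; ⟪⟫-≡[] = λ p → mk≡ λ i i<n → R.*-congˡ (at< p i i<n)
    ; ⟪⟫-1 = mk≋ λ { zero → R.*-identityˡ _ ; (suc n) → R.zeroʳ _ }
    ; ⟪⟫-+ = λ f g → mk≋ λ n → R.distribˡ _ _ _
    ; ⟪⟫-neg = λ f → mk≋ λ n → R.sym (Rᵉ.-‿distribʳ-* _ _)
    ; ⟪⟫-* = λ f g → mk≋ λ n → R.sym (rot-* ω f g n)
    }

  rot-X : ∀ ω → rot ω X ≈ const ω * X
  rot-X ω = mk≋ λ
    { zero → R.trans (R.*-identityˡ _) (R.sym (R.zeroʳ ω))
    ; (suc zero) → R.trans (R.*-congʳ (R.*-identityʳ ω)) (R.sym (⊗-const ω X 1))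
    ; (suc (suc n)) → R.trans (R.zeroʳ _) (R.sym (R.trans (⊗-const ω X (suc (suc n))) (R.zeroʳ ω))) }

  up-rot : ∀ {ω} → ω Rᵉ.^ 5 R.≈ R.1# → ∀ f → rot ω (up f) ≈ up f
  up-rot {ω} ω⁵ f = mk≋ (go f)
    where
    step : ∀ n → ω Rᵉ.^ (5 ℕ.+ n) R.≈ ω Rᵉ.^ n
    step n = R.trans (Rᵉ.^-homo-* ω 5 n) (R.trans (R.*-congʳ ω⁵) (R.*-identityˡ _))

    go : ∀ f n → ω Rᵉ.^ n R.* up f n R.≈ up f n
    go f 0 = R.*-identityˡ _
    go f 1 = R.zeroʳ _
    go f 2 = R.zeroʳ _
    go f 3 = R.zeroʳ _
    go f 4 = R.zeroʳ _
    go f (suc (suc (suc (suc (suc n))))) = R.trans (R.*-congʳ (step n)) (go (tail f) n)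

-- Identities at a primitive fifth root of unity

module CyclotomicIdentities {c ℓ} (A : CommutativeRing c ℓ) (ι : IntegerMap A) where
  open CommutativeRing A
  open IntegerSolver A ι
  open import Algebra.Properties.CommutativeSemiring.Exp commutativeSemiring

  Φ₅ : Carrier → Carrier
  Φ₅ z = 1# + z + z ^ 2 + z ^ 3 + z ^ 4

  -- In each application the cofactor C is the polynomial quotient of x - y by φ.
  modulo : ∀ {φ x y C} → φ ≈ 0# → x ≈ y + φ * C → x ≈ y
  modulo φ≈0 p = trans p (trans (+-congˡ (trans (*-congʳ φ≈0) (zeroˡ _))) (+-identityʳ _))

  module _ {z : Carrier} (Φ : Φ₅ z ≈ 0#) where
    private
      φ : ∀ {n} → Polynomial n → Polynomial n
      φ z = con (+ 1) :+ z :+ z :^ 2 :+ z :^ 3 :+ z :^ 4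

    z⁵≈1 : z ^ 5 ≈ 1#
    z⁵≈1 = modulo Φ (solve 1 (λ z → z :^ 5 := con (+ 1) :+ φ z :* (z :- con (+ 1))) refl z)

    Φ₅-2 : Φ₅ (z ^ 2) ≈ 0#
    Φ₅-2 = modulo Φ (solve 1 (λ z → φ (z :^ 2) := con (+ 0) :+ φ z :*
      (con (+ 1) :- z :+ z :^ 2 :- z :^ 3 :+ z :^ 4)) refl z)

    Φ₅-3 : Φ₅ (z ^ 3) ≈ 0#
    Φ₅-3 = modulo Φ (solve 1 (λ z → φ (z :^ 3) := con (+ 0) :+ φ z :*
      (con (+ 1) :- z :+ z :^ 3 :- z :^ 4 :+ z :^ 5 :- z :^ 7 :+ z :^ 8)) refl z)

    Φ₅-4 : Φ₅ (z ^ 4) ≈ 0#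
    Φ₅-4 = modulo Φ (solve 1 (λ z → φ (z :^ 4) := con (+ 0) :+ φ z :*
      (con (+ 1) :- z :+ z :^ 4 :- z :^ 6 :+ z :^ 8 :- z :^ 11 :+ z :^ 12)) refl z)

    -- The value of Φ₅ at 1. It reduces the cancellation of a factor 1 - z^i, which need not be a
    -- unit, to the absence of 5-torsion.
    ∏[1-zⁱ]≈5 : (1# - z) * (1# - z ^ 2) * (1# - z ^ 3) * (1# - z ^ 4) ≈ int (+ 5)
    ∏[1-zⁱ]≈5 = modulo Φ (solve 1 (λ z →
      (con (+ 1) :- z) :* (con (+ 1) :- z :^ 2) :* (con (+ 1) :- z :^ 3) :* (con (+ 1) :- z :^ 4) := con (+ 5) :+ φ z :*
      (:- con (+ 4) :+ con (+ 3) :* z :+ z :^ 3 :- con (+ 2) :* z :^ 5 :+ z :^ 6)) refl z)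

    ∏[1-zⁱx] : ∀ x → (1# - x) * (1# - z * x) * (1# - z ^ 2 * x) * (1# - z ^ 3 * x) * (1# - z ^ 4 * x) ≈ 1# - x ^ 5
    ∏[1-zⁱx] x = modulo Φ (solve 2 (λ z x →
      (con (+ 1) :- x) :* (con (+ 1) :- z :* x) :* (con (+ 1) :- z :^ 2 :* x) :* (con (+ 1) :- z :^ 3 :* x) :* (con (+ 1) :- z :^ 4 :* x)
      := con (+ 1) :- x :^ 5 :+ φ z :*
      (:- x :+ x :^ 5 :+ z :* x :^ 2 :- z :* x :^ 5 :+ z :^ 3 :* x :^ 2 :- z :^ 3 :* x :^ 3 :- z :^ 5 :* x :^ 3
        :+ z :^ 5 :* x :^ 5 :+ z :^ 6 :* x :^ 4 :- z :^ 6 :* x :^ 5)) refl z x)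

    -- The number 1 + z + z⁴, a root of t² - t - 1, is the quotient of the two coefficients that
    -- occur when the theta series at z is dissected.
    golden-unit : (1# - z ^ 4) * (1# + z + z ^ 4) ≈ z - z ^ 3
    golden-unit = modulo Φ (solve 1 (λ z → (con (+ 1) :- z :^ 4) :* (con (+ 1) :+ z :+ z :^ 4) := z :- z :^ 3 :+ φ z :*
      (con (+ 1) :- z :+ z :^ 3 :- z :^ 4)) refl z)

    -- The numbers 1 + z + z⁴ and 1 + z² + z³ have sum 1 and product -1, and `(z ^ 2) ^ 4` reduces
    -- to z³.
    golden-norm : ∀ y w → (y - (1# + z + z ^ 4) * w) * (y - (1# + z ^ 2 + (z ^ 2) ^ 4) * w) ≈ y ^ 2 - w * y - w ^ 2
    golden-norm y w = trans
      (*-congˡ (+-congˡ (-‿cong (*-congʳ (+-congˡ (trans (solve 1 (λ z → (z :^ 2) :^ 4 := z :^ 5 :* z :^ 3) refl z) (trans (*-congʳ z⁵≈1) (*-identityˡ _))))))))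
      (modulo Φ (solve 3 (λ z y w → (y :- (con (+ 1) :+ z :+ z :^ 4) :* w) :* (y :- (con (+ 1) :+ z :^ 2 :+ z :^ 3) :* w)
        := y :^ 2 :- w :* y :- w :^ 2 :+ φ z :*
        (con (+ 2) :* w :^ 2 :- y :* w :- z :* w :^ 2 :+ z :^ 3 :* w :^ 2)) refl z y w))

    private
      quadratic : Carrier → Carrier → Carrier → Carrier
      quadratic u y w = y ^ 2 - u * w * y - (u * w) ^ 2

      :quadratic : ∀ {n} → Polynomial n → Polynomial n → Polynomial n → Polynomial n
      :quadratic u y w = y :^ 2 :- u :* w :* y :- (u :* w) :^ 2

      -- The product of the quadratics at z and 1/z, which depends on z only through α = z + z⁴. The
      -- pair z², z³ gives the same form at the conjugate -1 - α, so the product over all conjugates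
      -- is reduced in two stages: modulo Φ₅, then modulo α² + α - 1.
      quartic : Carrier → Carrier → Carrier → Carrier
      quartic α y w = y ^ 4 - α * w * y ^ 3 + (int (+ 2) + α) * w ^ 2 * y ^ 2 + α * w ^ 3 * y + w ^ 4

      :quartic : ∀ {n} → Polynomial n → Polynomial n → Polynomial n → Polynomial n
      :quartic α y w = y :^ 4 :- α :* w :* y :^ 3 :+ (con (+ 2) :+ α) :* w :^ 2 :* y :^ 2 :+ α :* w :^ 3 :* y :+ w :^ 4

      pair₁₄ : ∀ y w → quadratic z y w * quadratic (z ^ 4) y w ≈ quartic (z + z ^ 4) y w
      pair₁₄ y w = modulo Φ (solve 3 (λ z y w → :quadratic z y w :* :quadratic (z :^ 4) y w := :quartic (z :+ z :^ 4) y w :+ φ z :*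
        (:- (w :^ 4) :- con (+ 2) :* y :^ 2 :* w :^ 2 :+ z :* w :^ 4 :- z :* y :* w :^ 3 :+ z :* y :^ 2 :* w :^ 2
          :+ z :^ 2 :* y :* w :^ 3 :+ z :^ 3 :* y :^ 2 :* w :^ 2 :- z :^ 4 :* y :* w :^ 3 :- z :^ 4 :* y :^ 2 :* w :^ 2
          :- z :^ 5 :* w :^ 4 :+ z :^ 5 :* y :* w :^ 3 :+ z :^ 6 :* w :^ 4)) refl z y w)

      pair₂₃ : ∀ y w → quadratic (z ^ 2) y w * quadratic (z ^ 3) y w ≈ quartic (- 1# - (z + z ^ 4)) y w
      pair₂₃ y w = modulo Φ (solve 3 (λ z y w →
        :quadratic (z :^ 2) y w :* :quadratic (z :^ 3) y w := :quartic (:- con (+ 1) :- (z :+ z :^ 4)) y w :+ φ z :*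
        (:- (w :^ 4) :+ y :* w :^ 3 :- y :^ 2 :* w :^ 2 :- y :^ 3 :* w :+ z :* w :^ 4 :+ con (+ 2) :* z :* y :^ 2 :* w :^ 2
          :- z :^ 2 :* y :* w :^ 3 :- z :^ 2 :* y :^ 2 :* w :^ 2 :+ z :^ 4 :* y :* w :^ 3 :- z :^ 5 :* w :^ 4 :+ z :^ 6 :* w :^ 4)) refl z y w)

      golden : (z + z ^ 4) ^ 2 + (z + z ^ 4) - 1# ≈ 0#
      golden = modulo Φ (solve 1 (λ z → (z :+ z :^ 4) :^ 2 :+ (z :+ z :^ 4) :- con (+ 1) := con (+ 0) :+ φ z :*
        (:- con (+ 1) :+ con (+ 2) :* z :- z :^ 3 :+ z :^ 4)) refl z)

      conjugates : ∀ y w → quadratic 1# y w * (quartic (z + z ^ 4) y w * quartic (- 1# - (z + z ^ 4)) y w)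
        ≈ y ^ 10 - int (+ 11) * w ^ 5 * y ^ 5 - w ^ 10
      conjugates y w = modulo golden (solve 3 (λ α y w →
        :quadratic (con (+ 1)) y w :* (:quartic α y w :* :quartic (:- con (+ 1) :- α) y w)
        := y :^ 10 :- con (+ 11) :* w :^ 5 :* y :^ 5 :- w :^ 10 :+ (α :^ 2 :+ α :- con (+ 1)) :*
        (y :^ 2 :* w :^ 8 :+ con (+ 3) :* y :^ 3 :* w :^ 7 :- con (+ 5) :* y :^ 5 :* w :^ 5 :+ con (+ 3) :* y :^ 7 :* w :^ 3
          :- y :^ 8 :* w :^ 2)) refl (z + z ^ 4) y w)

    -- If φ and ψ are the roots of t² - t - 1, the quadratic at w is (y - φw)(y - ψw), so its
    -- product over the z^i w is (y⁵ - φ⁵w⁵)(y⁵ - ψ⁵w⁵). Here φ⁵ + ψ⁵ = 11 and φψ = -1.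
    ∏-quadratic : ∀ y w →
      (y ^ 2 - 1# * w * y - (1# * w) ^ 2) * (y ^ 2 - z * w * y - (z * w) ^ 2) * (y ^ 2 - z ^ 2 * w * y - (z ^ 2 * w) ^ 2)
        * (y ^ 2 - z ^ 3 * w * y - (z ^ 3 * w) ^ 2) * (y ^ 2 - z ^ 4 * w * y - (z ^ 4 * w) ^ 2)
      ≈ y ^ 10 - int (+ 11) * w ^ 5 * y ^ 5 - w ^ 10
    ∏-quadratic y w = trans
      (solve 5 (λ a b c d e → a :* b :* c :* d :* e := a :* ((b :* e) :* (c :* d))) refl _ _ _ _ _)
      (trans (*-congˡ (*-cong (pair₁₄ y w) (pair₂₃ y w))) (conjugates y w))

record PrimitiveFifthRoot {c ℓ} (R : CommutativeRing c ℓ) (ι : IntegerMap R) : Set (c ⊔ ℓ) where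
  open CommutativeRing R
  open IntegerSolver R ι using (int)
  open CyclotomicIdentities R ι using (Φ₅)
  field
    ζ              : Carrier
    Φζ             : Φ₅ ζ ≈ 0#
    5-torsion-free : ∀ {r} → int (+ 5) * r ≈ 0# → r ≈ 0#

-- Polynomial identities behind the modular equation of degree 5

module DissectionIdentities {c ℓ} (A : CommutativeRing c ℓ) (ι : IntegerMap A) where
  open CommutativeRing A
  open IntegerSolver A ι
  open import Algebra.Properties.CommutativeSemiring.Exp commutativeSemiring

  -- The three factors of b^10 - 11 w⁵b⁵ - w^10 with integer coefficients. With φ = 1 + z + z⁴ and ψ
  -- = 1 + z² + z³ for a primitive fifth root of unity z, the values of b/w at which they vanish
  -- form Galois orbits: φ, ψ for `L`; φz, φz⁴, ψz², ψz³ for `M`; φz², φz³, ψz, ψz⁴ for `P`.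
  L P M : Carrier → Carrier → Carrier
  L b w = b ^ 2 - w * b - w ^ 2
  P b w = b ^ 4 + int (+ 3) * b ^ 3 * w + int (+ 4) * b ^ 2 * w ^ 2 + int (+ 2) * b * w ^ 3 + w ^ 4
  M b w = b ^ 4 - int (+ 2) * b ^ 3 * w + int (+ 4) * b ^ 2 * w ^ 2 - int (+ 3) * b * w ^ 3 + w ^ 4

  private
    :L :P :M : ∀ {n} → Polynomial n → Polynomial n → Polynomial n
    :L b w = b :^ 2 :- w :* b :- w :^ 2
    :P b w = b :^ 4 :+ con (+ 3) :* b :^ 3 :* w :+ con (+ 4) :* b :^ 2 :* w :^ 2 :+ con (+ 2) :* b :* w :^ 3 :+ w :^ 4
    :M b w = b :^ 4 :- con (+ 2) :* b :^ 3 :* w :+ con (+ 4) :* b :^ 2 :* w :^ 2 :- con (+ 3) :* b :* w :^ 3 :+ w :^ 4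

  LPM : ∀ b w → L b w * (P b w * M b w) ≈ b ^ 10 - int (+ 11) * w ^ 5 * b ^ 5 - w ^ 10
  LPM = solve 2 (λ b w → :L b w :* (:P b w :* :M b w) := b :^ 10 :- con (+ 11) :* w :^ 5 :* b :^ 5 :- w :^ 10) refl

  -- The form s² - 11st - t² becomes a pure power at s = b P, t = w M, just as Ramanujan's identity
  -- makes it one at s = β⁵, t = qα⁵. This is what suggests that the two pairs are proportional.
  L⁵ : ∀ b w → (b * P b w) ^ 2 - int (+ 11) * (b * P b w) * (w * M b w) - (w * M b w) ^ 2 ≈ L b w ^ 5
  L⁵ = solve 2 (λ b w → (b :* :P b w) :^ 2 :- con (+ 11) :* (b :* :P b w) :* (w :* :M b w) :- (w :* :M b w) :^ 2 := :L b w :^ 5) refl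

  -- The numerator of 1/R⁵, and so the origin of the coefficients c_k. Exponents 0 and 1 and the
  -- coefficient 1 are spelled out so that every term has the shape expected by `monomial`.
  P²L : ∀ b w → P b w ^ 2 * L b w ≈
    int (+ 1) * w ^ 0 * b ^ 10 + int (+ 5) * w ^ 1 * b ^ 9 + int (+ 10) * w ^ 2 * b ^ 8 + int (+ 5) * w ^ 3 * b ^ 7
    + int (ℤ.- + 15) * w ^ 4 * b ^ 6 + int (ℤ.- + 36) * w ^ 5 * b ^ 5 + int (ℤ.- + 40) * w ^ 6 * b ^ 4 + int (ℤ.- + 30) * w ^ 7 * b ^ 3
    + int (ℤ.- + 15) * w ^ 8 * b ^ 2 + int (ℤ.- + 5) * w ^ 9 * b ^ 1 + int (ℤ.- + 1) * w ^ 10 * b ^ 0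
  P²L = solve 2 (λ b w → :P b w :^ 2 :* :L b w :=
    con (+ 1) :* w :^ 0 :* b :^ 10 :+ con (+ 5) :* w :^ 1 :* b :^ 9 :+ con (+ 10) :* w :^ 2 :* b :^ 8 :+ con (+ 5) :* w :^ 3 :* b :^ 7
    :+ con (ℤ.- + 15) :* w :^ 4 :* b :^ 6 :+ con (ℤ.- + 36) :* w :^ 5 :* b :^ 5 :+ con (ℤ.- + 40) :* w :^ 6 :* b :^ 4 :+ con (ℤ.- + 30) :* w :^ 7 :* b :^ 3
    :+ con (ℤ.- + 15) :* w :^ 8 :* b :^ 2 :+ con (ℤ.- + 5) :* w :^ 9 :* b :^ 1 :+ con (ℤ.- + 1) :* w :^ 10 :* b :^ 0) refl

-- Theta functions at fifth roots of unity and their five-dissection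

module ProductIdentities {c ℓ} (R : CommutativeRing c ℓ) (ι : IntegerMap R) where
  open SeriesCalculus R ι
  open Summation R ι
  open JacobiTripleProduct R ι using (euler; theta∏; term; euler-convergent; euler≡[1]; theta-convergent₁; theta-convergent; jacobi)
  open Substitutions R ι
  open CyclotomicIdentities seriesRing seriesMap
  open import Relation.Binary.Reasoning.Setoid setoid
  module Up = ContinuousHom dilation
  module Rot ρ = ContinuousHom (rotation ρ)

  periodic : ∀ {x} → x ^ 5 ≈ 1# → ∀ r k → x ^ (r ℕ.+ k ℕ.* 5) ≈ x ^ r
  periodic {x} x⁵ r k = begin
    x ^ (r ℕ.+ k ℕ.* 5)       ≈⟨ ^-homo-* x r (k ℕ.* 5) ⟩
    x ^ r * x ^ (k ℕ.* 5)     ≈⟨ *-congˡ (^-congʳ x (ℕₚ.*-comm k 5)) ⟩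
    x ^ r * x ^ (5 ℕ.* k)     ≈⟨ *-congˡ (^-assocʳ x 5 k) ⟨
    x ^ r * (x ^ 5) ^ k       ≈⟨ *-congˡ (trans (^-congˡ k x⁵) (1^ k)) ⟩
    x ^ r * 1#                ≈⟨ *-identityʳ _ ⟩
    x ^ r                     ∎

  X^5k : ∀ k → X ^ (k ℕ.* 5) ≈ (X ^ 5) ^ k
  X^5k k = trans (^-congʳ X (ℕₚ.*-comm k 5)) (sym (^-assocʳ X 5 k))

  X^≡[1]0 : ∀ n → X ^ suc n ≡[ 1 ] 0#
  X^≡[1]0 n = ≡[]-weaken (s≤s z≤n) (vanish-^ X≡[1]0 (suc n))

  multiple-convergent : ∀ v → Convergent (λ j → 1# - v * X ^ suc j)
  multiple-convergent v j = ≡[]-weaken (ℕₚ.n≤1+n j) (1-vanish (vanish-*ˡ v (vanish-^ X≡[1]0 (suc j))))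

  Q⁵ Q²⁵ : Series
  Q⁵ = X ^ 5
  Q²⁵ = X ^ 25

  Q⁵₀ : Q⁵ ≡[ 1 ] 0#
  Q⁵₀ = X^≡[1]0 4
  Q²⁵₀ : Q²⁵ ≡[ 1 ] 0#
  Q²⁵₀ = X^≡[1]0 24

  euler-cong : ∀ {Q Q′} → Q ≈ Q′ → euler Q ≈ euler Q′
  euler-cong p = ∏∞-cong λ j → +-congˡ (-‿cong (^-congˡ (suc j) p))

  theta∏-cong : ∀ {a a′ b b′ Q Q′} → a ≈ a′ → b ≈ b′ → Q ≈ Q′ → theta∏ a b Q ≈ theta∏ a′ b′ Q′
  theta∏-cong p r s = ∏∞-cong λ j → *-cong (+-congˡ (*-cong p (^-congˡ j s))) (+-congˡ (*-cong r (^-congˡ j s)))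

  module _ (h : ContinuousHom) where
    open ContinuousHom h

    hom-euler : ∀ {Q} → Q ≡[ 1 ] 0# → ⟪ euler Q ⟫ ≈ euler ⟪ Q ⟫
    hom-euler {Q} Q₀ = trans (⟪⟫-∏∞ (euler-convergent Q₀))
      (∏∞-cong λ j → trans (⟪⟫-1- (Q ^ suc j)) (+-congˡ (-‿cong (⟪⟫-^ Q (suc j)))))

    hom-theta∏ : ∀ {Q} → Q ≡[ 1 ] 0# → ∀ a b → ⟪ theta∏ a b Q ⟫ ≈ theta∏ ⟪ a ⟫ ⟪ b ⟫ ⟪ Q ⟫
    hom-theta∏ {Q} Q₀ a b = trans (⟪⟫-∏∞ (theta-convergent Q₀ a b))
      (∏∞-cong λ j → trans (⟪⟫-* _ _) (*-cong (factor-hom a j) (factor-hom b j)))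
      where
      factor-hom : ∀ a j → ⟪ 1# + a * Q ^ j ⟫ ≈ 1# + ⟪ a ⟫ * ⟪ Q ⟫ ^ j
      factor-hom a j = trans (⟪⟫-1+ _) (+-congˡ (trans (⟪⟫-* a (Q ^ j)) (*-congˡ (⟪⟫-^ Q j))))

  up-X^ : ∀ k → up (X ^ k) ≈ X ^ (5 ℕ.* k)
  up-X^ k = trans (Up.⟪⟫-^ X k) (trans (^-congˡ k up-X) (^-assocʳ X 5 k))

  up--X^ : ∀ k → up (- X ^ k) ≈ - X ^ (5 ℕ.* k)
  up--X^ k = trans (Up.⟪⟫-neg _) (-‿cong (up-X^ k))

  -- α and β are the numerator (q,q⁴;q⁵)_∞ and the denominator (q²,q³;q⁵)_∞ of R, and D = (q⁵;q⁵)_∞.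
  E α β ᾱ β̄ D D̄ : Series
  E = euler X
  α = theta∏ (- X ^ 4) (- X ^ 1) Q⁵
  β = theta∏ (- X ^ 3) (- X ^ 2) Q⁵
  D = up E
  ᾱ = up α
  β̄ = up β
  D̄ = up D

  D-product : D ≈ euler Q⁵
  D-product = trans (hom-euler dilation X≡[1]0) (euler-cong up-X)

  D̄-product : D̄ ≈ euler Q²⁵
  D̄-product = trans (Up.⟪⟫-cong D-product) (trans (hom-euler dilation Q⁵₀) (euler-cong (up-X^ 5)))

  ᾱ-product : ᾱ ≈ theta∏ (- X ^ 20) (- X ^ 5) Q²⁵
  ᾱ-product = trans (hom-theta∏ dilation Q⁵₀ _ _) (theta∏-cong (up--X^ 4) (up--X^ 1) (up-X^ 5))

  β̄-product : β̄ ≈ theta∏ (- X ^ 15) (- X ^ 10) Q²⁵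
  β̄-product = trans (hom-theta∏ dilation Q⁵₀ _ _) (theta∏-cong (up--X^ 3) (up--X^ 2) (up-X^ 5))

  E≡[1]1 : E ≡[ 1 ] 1#
  E≡[1]1 = euler≡[1] X≡[1]0

  D≡[1]1 : D ≡[ 1 ] 1#
  D≡[1]1 = ≡[]-trans (Up.⟪⟫-≡[] E≡[1]1) (≈⇒≡[] Up.⟪⟫-1)

  D̄≡[1]1 : D̄ ≡[ 1 ] 1#
  D̄≡[1]1 = ≡[]-trans (Up.⟪⟫-≡[] D≡[1]1) (≈⇒≡[] Up.⟪⟫-1)

  E≈αβD : E ≈ α * β * D
  E≈αβD = begin
    E
      ≈⟨ ∏∞-block (euler-convergent X≡[1]0) ⟩
    ∏∞ (block (λ j → 1# - X ^ suc j))
      ≈⟨ ∏∞-cong five-factors ⟩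
    ∏∞ (λ k → (1# + - X ^ 4 * Q⁵ ^ k) * (1# + - X ^ 1 * Q⁵ ^ k) * ((1# + - X ^ 3 * Q⁵ ^ k) * (1# + - X ^ 2 * Q⁵ ^ k)) * (1# - Q⁵ ^ suc k))
      ≈⟨ ∏∞-* (Convergent-* (theta-convergent Q⁵₀ _ _) (theta-convergent Q⁵₀ _ _)) (euler-convergent Q⁵₀) ⟩
    ∏∞ (λ k → (1# + - X ^ 4 * Q⁵ ^ k) * (1# + - X ^ 1 * Q⁵ ^ k) * ((1# + - X ^ 3 * Q⁵ ^ k) * (1# + - X ^ 2 * Q⁵ ^ k))) * euler Q⁵
      ≈⟨ *-cong (∏∞-* (theta-convergent Q⁵₀ _ _) (theta-convergent Q⁵₀ _ _)) (sym D-product) ⟩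
    α * β * D ∎
    where
    five-factors : ∀ k → block (λ j → 1# - X ^ suc j) k
      ≈ (1# + - X ^ 4 * Q⁵ ^ k) * (1# + - X ^ 1 * Q⁵ ^ k) * ((1# + - X ^ 3 * Q⁵ ^ k) * (1# + - X ^ 2 * Q⁵ ^ k)) * (1# - Q⁵ ^ suc k)
    five-factors k = trans
      (solve 2 (λ x y →
        (con (+ 1) :- x :* y) :* (con (+ 1) :- x :* (x :* y)) :* (con (+ 1) :- x :* (x :* (x :* y)))
          :* (con (+ 1) :- x :* (x :* (x :* (x :* y)))) :* (con (+ 1) :- x :* (x :* (x :* (x :* (x :* y)))))
        := (con (+ 1) :+ (:- (x :^ 4)) :* y) :* (con (+ 1) :+ (:- (x :^ 1)) :* y)
          :* ((con (+ 1) :+ (:- (x :^ 3)) :* y) :* (con (+ 1) :+ (:- (x :^ 2)) :* y)) :* (con (+ 1) :- x :^ 5 :* y)) refl X (X ^ (k ℕ.* 5)))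
      (*-cong (*-cong (*-cong (f 4) (f 1)) (*-cong (f 3) (f 2))) (+-congˡ (-‿cong (*-congˡ (X^5k k)))))
      where
      f : ∀ i → 1# + - X ^ i * X ^ (k ℕ.* 5) ≈ 1# + - X ^ i * Q⁵ ^ k
      f i = +-congˡ (*-congˡ (X^5k k))

  D≈ᾱβ̄D̄ : D ≈ ᾱ * β̄ * D̄
  D≈ᾱβ̄D̄ = trans (Up.⟪⟫-cong E≈αβD) (trans (Up.⟪⟫-* _ _) (*-congʳ (Up.⟪⟫-* _ _)))

  -- g i = (-1)^i q^(i(i+1)/2)
  g : ℕ → Series
  g zero    = 1#
  g (suc i) = - (X * X ^ i) * g i

  g-period : ∀ m → g (5 ℕ.+ m) ≈ - (X ^ 15 * (X ^ m) ^ 5) * g m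
  g-period m = solve 3 (λ x y s →
    (:- (x :* (x :* (x :* (x :* (x :* y)))))) :* ((:- (x :* (x :* (x :* (x :* y))))) :* ((:- (x :* (x :* (x :* y)))) :* ((:- (x :* (x :* y))) :* ((:- (x :* y)) :* s))))
    := (:- (x :^ 15 :* y :^ 5)) :* s) refl X (X ^ m) (g m)

  Q²⁵^ : ∀ k → Q²⁵ ^ k ≈ (X ^ (k ℕ.* 5)) ^ 5
  Q²⁵^ k = trans (^-assocʳ X 25 k) (trans (^-congʳ X (≡.trans (ℕₚ.*-comm 25 k) (≡.sym (ℕₚ.*-assoc k 5 5)))) (sym (^-assocʳ X (k ℕ.* 5) 5)))

  -- For i = 0, 1, 2, 3, 4 modulo 5 the exponent i(i+1)/2 is 0, 1, 3, 1, 0 modulo 5. Residues 0 and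
  -- 4 will combine to `ϑ₂`, residues 1 and 3 to `X * ϑ₁`; residue 2 drops out in `U-block` and gets
  -- no formula.
  g-0 : ∀ k → g (k ℕ.* 5) ≈ term Q²⁵ (- X ^ 15) k
  g-0 zero    = refl
  g-0 (suc k) = trans (g-period (k ℕ.* 5)) (*-cong (trans (solve 2 (λ x y → :- (x :* y) := (:- x) :* y) refl (X ^ 15) _) (*-congˡ (sym (Q²⁵^ k)))) (g-0 k))

  g-1 : ∀ k → g (1 ℕ.+ k ℕ.* 5) ≈ - (X * term Q²⁵ (- X ^ 20) k)
  g-1 zero    = solve 1 (λ x → (:- (x :* con (+ 1))) :* con (+ 1) := :- (x :* con (+ 1))) refl X
  g-1 (suc k) = trans (g-period (1 ℕ.+ k ℕ.* 5)) (trans (*-congˡ (g-1 k))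
    (trans (solve 3 (λ x y t → (:- (x :^ 15 :* (x :* y) :^ 5)) :* (:- (x :* t)) := :- (x :* ((:- (x :^ 20)) :* y :^ 5 :* t))) refl X (X ^ (k ℕ.* 5)) _)
      (-‿cong (*-congˡ (*-congʳ (*-congˡ (sym (Q²⁵^ k))))))))

  g-3 : ∀ k → g (3 ℕ.+ k ℕ.* 5) ≈ X * term Q²⁵ (- X ^ 5) (suc k)
  g-3 zero    = solve 1 (λ x → (:- (x :* (x :* (x :* con (+ 1))))) :* ((:- (x :* (x :* con (+ 1)))) :* ((:- (x :* con (+ 1))) :* con (+ 1)))
    := x :* ((:- (x :^ 5)) :* con (+ 1) :* con (+ 1))) refl X
  g-3 (suc k) = trans (g-period (3 ℕ.+ k ℕ.* 5)) (trans (*-congˡ (g-3 k))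
    (trans (solve 3 (λ x y t → (:- (x :^ 15 :* (x :* (x :* (x :* y))) :^ 5)) :* (x :* t) := x :* ((:- (x :^ 5)) :* (x :^ 25 :* y :^ 5) :* t)) refl X (X ^ (k ℕ.* 5)) _)
      (*-congˡ (*-congʳ (*-congˡ (*-congˡ (sym (Q²⁵^ k))))))))

  g-4 : ∀ k → g (4 ℕ.+ k ℕ.* 5) ≈ - term Q²⁵ (- X ^ 10) (suc k)
  g-4 zero    = solve 1 (λ x → (:- (x :* (x :* (x :* (x :* con (+ 1)))))) :* ((:- (x :* (x :* (x :* con (+ 1))))) :* ((:- (x :* (x :* con (+ 1)))) :* ((:- (x :* con (+ 1))) :* con (+ 1))))
    := :- ((:- (x :^ 10)) :* con (+ 1) :* con (+ 1))) refl X
  g-4 (suc k) = trans (g-period (4 ℕ.+ k ℕ.* 5)) (trans (*-congˡ (g-4 k))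
    (trans (solve 3 (λ x y t → (:- (x :^ 15 :* (x :* (x :* (x :* (x :* y)))) :^ 5)) :* (:- t) := :- ((:- (x :^ 10)) :* (x :^ 25 :* y :^ 5) :* t)) refl X (X ^ (k ℕ.* 5)) _)
      (-‿cong (*-congʳ (*-congˡ (*-congˡ (sym (Q²⁵^ k))))))))

  ϑ₁ ϑ₂ : Series
  ϑ₁ = D̄ * ᾱ
  ϑ₂ = D̄ * β̄

  ϑ₁-sum : ∀ n → ϑ₁ ≡[ n ] ∑ (suc n) (λ i → term Q²⁵ (- X ^ 20) i + term Q²⁵ (- X ^ 5) (suc i))
  ϑ₁-sum n = ≡[]-trans (≈⇒≡[] (*-cong D̄-product ᾱ-product))
    (jacobi _ _ Q²⁵ (solve 1 (λ x → (:- (x :^ 20)) :* (:- (x :^ 5)) := x :^ 25) refl X) Q²⁵₀ n)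

  ϑ₂-sum : ∀ n → ϑ₂ ≡[ n ] ∑ (suc n) (λ i → term Q²⁵ (- X ^ 15) i + term Q²⁵ (- X ^ 10) (suc i))
  ϑ₂-sum n = ≡[]-trans (≈⇒≡[] (*-cong D̄-product β̄-product))
    (jacobi _ _ Q²⁵ (solve 1 (λ x → (:- (x :^ 15)) :* (:- (x :^ 10)) := x :^ 25) refl X) Q²⁵₀ n)

  module _ (torsion-free : ∀ {f} → int (+ 5) * f ≈ 0# → f ≈ 0#) {w : Series} (Φ : Φ₅ w ≈ 0#) where
    private
      w⁵≈1 = z⁵≈1 Φ

      term-a : ∀ i → term X (- (w * X)) i ≈ w ^ i * g i
      term-a zero    = sym (*-identityˡ 1#)
      term-a (suc i) = trans (*-congˡ (term-a i))
        (solve 5 (λ w x y v s → (:- (w :* x)) :* y :* (v :* s) := w :* v :* ((:- (x :* y)) :* s)) refl w X (X ^ i) (w ^ i) (g i))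

      term-b : ∀ i → term X (- w ^ 4) (suc i) ≈ - ((w ^ 4) ^ suc i * g i)
      term-b zero    = solve 1 (λ v → (:- v) :* con (+ 1) :* con (+ 1) := :- (v :* con (+ 1) :* con (+ 1))) refl (w ^ 4)
      term-b (suc i) = trans (*-congˡ (term-b i))
        (solve 5 (λ v x y p s → (:- v) :* (x :* y) :* (:- (p :* s)) := :- (v :* p :* ((:- (x :* y)) :* s))) refl (w ^ 4) X (X ^ i) ((w ^ 4) ^ suc i) (g i))

      U : ℕ → Series
      U i = term X (- (w * X)) i + term X (- w ^ 4) (suc i)

      U-period : ∀ r k → U (r ℕ.+ k ℕ.* 5) ≈ (w ^ r - (w ^ 4) ^ suc r) * g (r ℕ.+ k ℕ.* 5)
      U-period r k = trans (+-cong (term-a (r ℕ.+ k ℕ.* 5)) (term-b (r ℕ.+ k ℕ.* 5)))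
        (trans (+-cong (*-congʳ (periodic w⁵≈1 r k)) (-‿cong (*-congʳ (periodic v⁵≈1 (suc r) k))))
          (solve 3 (λ x y s → x :* s :- y :* s := (x :- y) :* s) refl (w ^ r) ((w ^ 4) ^ suc r) (g (r ℕ.+ k ℕ.* 5))))
        where
        v⁵≈1 : (w ^ 4) ^ 5 ≈ 1#
        v⁵≈1 = z⁵≈1 (Φ₅-4 Φ)

      T₁ T₂ : ℕ → Series
      T₁ k = term Q²⁵ (- X ^ 20) k + term Q²⁵ (- X ^ 5) (suc k)
      T₂ k = term Q²⁵ (- X ^ 15) k + term Q²⁵ (- X ^ 10) (suc k)

      U-block : ∀ k → U (k ℕ.* 5) + U (1 ℕ.+ k ℕ.* 5) + U (2 ℕ.+ k ℕ.* 5) + U (3 ℕ.+ k ℕ.* 5) + U (4 ℕ.+ k ℕ.* 5)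
        ≈ (1# - w ^ 4) * T₂ k + - (X * (w - w ^ 3)) * T₁ k
      U-block k = begin
        U (k ℕ.* 5) + U (1 ℕ.+ k ℕ.* 5) + U (2 ℕ.+ k ℕ.* 5) + U (3 ℕ.+ k ℕ.* 5) + U (4 ℕ.+ k ℕ.* 5)
          ≈⟨ +-cong (+-cong (+-cong (+-cong (U-period 0 k) (U-period 1 k)) (U-period 2 k)) (U-period 3 k)) (U-period 4 k) ⟩
        (w ^ 0 - (w ^ 4) ^ 1) * g₀ + (w ^ 1 - (w ^ 4) ^ 2) * g₁ + (w ^ 2 - (w ^ 4) ^ 3) * g₂ + (w ^ 3 - (w ^ 4) ^ 4) * g₃ + (w ^ 4 - (w ^ 4) ^ 5) * g₄
          -- Reduction modulo w⁵ - 1: the coefficients at residues 4 and 3 become the negatives of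
          -- those at 0 and 1, and the one at residue 2, w² - w^12, vanishes.
          ≈⟨ modulo (trans (+-congʳ w⁵≈1) (-‿inverseʳ 1#)) (solve 6 (λ w a b c d e →
               (w :^ 0 :- (w :^ 4) :^ 1) :* a :+ (w :^ 1 :- (w :^ 4) :^ 2) :* b :+ (w :^ 2 :- (w :^ 4) :^ 3) :* c
                 :+ (w :^ 3 :- (w :^ 4) :^ 4) :* d :+ (w :^ 4 :- (w :^ 4) :^ 5) :* e
               := (con (+ 1) :- w :^ 4) :* (a :- e) :+ (w :- w :^ 3) :* (b :- d) :+ (w :^ 5 :- con (+ 1)) :*
               (:- (w :^ 3 :* b) :- w :^ 2 :* (w :^ 5 :+ con (+ 1)) :* c :- w :* (w :^ 10 :+ w :^ 5 :+ con (+ 1)) :* d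
                 :- (w :^ 15 :+ w :^ 10 :+ w :^ 5 :+ con (+ 1)) :* e)) refl w g₀ g₁ g₂ g₃ g₄) ⟩
        (1# - w ^ 4) * (g₀ - g₄) + (w - w ^ 3) * (g₁ - g₃)
          ≈⟨ +-cong (*-congˡ (+-cong (g-0 k) (-‿cong (g-4 k)))) (*-congˡ (+-cong (g-1 k) (-‿cong (g-3 k)))) ⟩
        (1# - w ^ 4) * (term Q²⁵ (- X ^ 15) k - - term Q²⁵ (- X ^ 10) (suc k))
          + (w - w ^ 3) * (- (X * term Q²⁵ (- X ^ 20) k) - X * term Q²⁵ (- X ^ 5) (suc k))
          ≈⟨ solve 7 (λ x c d p q r s → c :* (p :- :- q) :+ d :* (:- (x :* r) :- x :* s) := c :* (p :+ q) :+ (:- (x :* d)) :* (r :+ s)) refl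
               X (1# - w ^ 4) (w - w ^ 3) _ _ _ _ ⟩
        (1# - w ^ 4) * T₂ k + - (X * (w - w ^ 3)) * T₁ k ∎
        where
        g₀ = g (k ℕ.* 5)
        g₁ = g (1 ℕ.+ k ℕ.* 5)
        g₂ = g (2 ℕ.+ k ℕ.* 5)
        g₃ = g (3 ℕ.+ k ℕ.* 5)
        g₄ = g (4 ℕ.+ k ℕ.* 5)

      ζ-theta : E * theta∏ (- (w * X)) (- w ^ 4) X ≈ (1# - w ^ 4) * ϑ₂ + - (X * (w - w ^ 3)) * ϑ₁
      ζ-theta = ≡[]⇒≈ λ n →
        -- At order 4 + 5n the sum in `jacobi` has 5(n + 1) terms, hence consists of complete
        -- blocks.
        ≡[]-trans (≡[]-weaken (ℕₚ.≤-trans (ℕₚ.m≤m*n n 5) (ℕₚ.m≤n+m (n ℕ.* 5) 4))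
          (jacobi (- (w * X)) (- w ^ 4) X
            (trans (solve 2 (λ w x → (:- (w :* x)) :* (:- (w :^ 4)) := w :^ 5 :* x) refl w X) (trans (*-congʳ w⁵≈1) (*-identityˡ X)))
            X≡[1]0 (4 ℕ.+ n ℕ.* 5)))
        (≡[]-trans (≈⇒≡[] (trans (∑-block U (suc n)) (trans (∑-cong (suc n) U-block)
            (trans (∑-+ (suc n) _ _) (sym (+-cong (∑-*ˡ (suc n) _ T₂) (∑-*ˡ (suc n) _ T₁)))))))
        (≡[]-+ (≡[]-* ≡[]-refl (≡[]-sym (ϑ₂-sum n))) (≡[]-* ≡[]-refl (≡[]-sym (ϑ₁-sum n)))))

    golden∏ : Series
    golden∏ = ∏∞ (λ j → (1# - w * X ^ suc j) * (1# - w ^ 4 * X ^ suc j))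

    -- This is `ζ-theta` divided by 1 - w⁴: on the product side that is the factor at j = 0, on the
    -- theta side `golden-unit` supplies the quotient. The division is carried out by proving the
    -- difference zero after multiplication by 1 - w⁴ and then by the remaining 1 - w^i, in total by
    -- 5.
    ϑ-golden : ϑ₂ - (1# + w + w ^ 4) * (X * ϑ₁) ≈ E * golden∏
    ϑ-golden = begin
      lhs
        ≈⟨ solve 2 (λ x y → x := (x :- y) :+ y) refl lhs (E * golden∏) ⟩
      (lhs - E * golden∏) + E * golden∏
        ≈⟨ +-congʳ (torsion-free five) ⟩
      0# + E * golden∏
        ≈⟨ +-identityˡ _ ⟩
      E * golden∏ ∎
      where
      lhs : Series
      lhs = ϑ₂ - (1# + w + w ^ 4) * (X * ϑ₁)

      split : theta∏ (- (w * X)) (- w ^ 4) X ≈ (1# - w ^ 4) * golden∏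
      split = begin
        theta∏ (- (w * X)) (- w ^ 4) X
          ≈⟨ ∏∞-* (theta-convergent₁ X≡[1]0 _) (theta-convergent₁ X≡[1]0 _) ⟩
        ∏∞ (λ j → 1# + - (w * X) * X ^ j) * ∏∞ (λ j → 1# + - w ^ 4 * X ^ j)
          ≈⟨ *-cong (∏∞-cong λ j → solve 3 (λ w x y → con (+ 1) :+ (:- (w :* x)) :* y := con (+ 1) :- w :* (x :* y)) refl w X (X ^ j))
                    (trans (∏∞-head (theta-convergent₁ X≡[1]0 _))
                      (*-cong (solve 1 (λ v → con (+ 1) :+ (:- v) :* con (+ 1) := con (+ 1) :- v) refl (w ^ 4))
                              (∏∞-cong λ j → solve 2 (λ v y → con (+ 1) :+ (:- v) :* y := con (+ 1) :- v :* y) refl (w ^ 4) (X ^ suc j)))) ⟩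
        ∏∞ (λ j → 1# - w * X ^ suc j) * ((1# - w ^ 4) * ∏∞ (λ j → 1# - w ^ 4 * X ^ suc j))
          ≈⟨ solve 3 (λ x y z → x :* (y :* z) := y :* (x :* z)) refl _ (1# - w ^ 4) _ ⟩
        (1# - w ^ 4) * (∏∞ (λ j → 1# - w * X ^ suc j) * ∏∞ (λ j → 1# - w ^ 4 * X ^ suc j))
          ≈⟨ *-congˡ (∏∞-* (multiple-convergent w) (multiple-convergent (w ^ 4))) ⟨
        (1# - w ^ 4) * golden∏ ∎

      scaled : (1# - w ^ 4) * (lhs - E * golden∏) ≈ 0#
      scaled = begin
        (1# - w ^ 4) * (lhs - E * golden∏)
          ≈⟨ solve 6 (λ u c t s x p → u :* ((t :- c :* (x :* s)) :- p) := (u :* t :+ (:- (x :* (u :* c))) :* s) :- u :* p) refl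
               (1# - w ^ 4) (1# + w + w ^ 4) ϑ₂ ϑ₁ X (E * golden∏) ⟩
        ((1# - w ^ 4) * ϑ₂ + - (X * ((1# - w ^ 4) * (1# + w + w ^ 4))) * ϑ₁) - (1# - w ^ 4) * (E * golden∏)
          ≈⟨ +-congʳ (trans (+-congˡ (*-congʳ (-‿cong (*-congˡ (golden-unit Φ))))) (sym ζ-theta)) ⟩
        E * theta∏ (- (w * X)) (- w ^ 4) X - (1# - w ^ 4) * (E * golden∏)
          ≈⟨ +-congʳ (*-congˡ split) ⟩
        E * ((1# - w ^ 4) * golden∏) - (1# - w ^ 4) * (E * golden∏)
          ≈⟨ solve 3 (λ e u p → e :* (u :* p) :- u :* (e :* p) := con (+ 0)) refl E (1# - w ^ 4) golden∏ ⟩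
        0# ∎

      five : int (+ 5) * (lhs - E * golden∏) ≈ 0#
      five = trans (*-congʳ (sym (∏[1-zⁱ]≈5 Φ))) (trans (*-assoc _ _ _) (trans (*-congˡ scaled) (zeroʳ _)))

-- The quadratic relation and Ramanujan's identity

module RogersRamanujanIdentities {c ℓ} (R : CommutativeRing c ℓ) (ι : IntegerMap R) (root : PrimitiveFifthRoot R ι) where
  private module R = CommutativeRing R
  private module Rᵉ where
    open import Algebra.Properties.CommutativeSemiring.Exp R.commutativeSemiring public
    open CyclotomicIdentities R ι public using (z⁵≈1; Φ₅-2; Φ₅-3; Φ₅-4)
  open PrimitiveFifthRoot root using (ζ; Φζ; 5-torsion-free)
  open SeriesCalculus R ι
  open JacobiTripleProduct R ι using (euler; theta∏; euler-convergent)
  open Substitutions R ι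
  open CyclotomicIdentities seriesRing seriesMap
  open DissectionIdentities seriesRing seriesMap
  open ProductIdentities R ι
  open import Relation.Binary.Reasoning.Setoid setoid

  torsion-free : ∀ {f} → int (+ 5) * f ≈ 0# → f ≈ 0#
  torsion-free {f} p = mk≋ λ n → 5-torsion-free (R.trans (R.sym (⊗-const _ f n)) (at p n))

  const-* : ∀ r s → const (r R.* s) ≈ const r * const s
  const-* r s = mk≋ λ { zero → R.refl ; (suc n) → R.sym (R.trans (⊗-const r (const s) (suc n)) (R.zeroʳ r)) }

  const-^ : ∀ r k → const (r Rᵉ.^ k) ≈ const r ^ k
  const-^ r zero    = refl
  const-^ r (suc k) = trans (const-* r (r Rᵉ.^ k)) (*-congˡ (const-^ r k))

  z : Series
  z = const ζ

  Φz : Φ₅ z ≈ 0#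
  Φz = trans (sym (trans (const-+ _ (ζ Rᵉ.^ 4)) (+-cong (trans (const-+ _ (ζ Rᵉ.^ 3)) (+-cong (trans (const-+ _ (ζ Rᵉ.^ 2))
         (+-cong (const-+ R.1# ζ) (const-^ ζ 2))) (const-^ ζ 3))) (const-^ ζ 4))))
       (mk≋ λ { zero → Φζ ; (suc n) → R.refl })
    where
    const-+ : ∀ r s → const (r R.+ s) ≈ const r + const s
    const-+ r s = mk≋ λ { zero → R.refl ; (suc n) → R.sym (R.+-identityˡ R.0#) }

  w₁ : Series
  w₁ = X * ϑ₁

  -- Over the fifth roots of unity `D` splits into `E` and the golden products at z and z². Together
  -- with the other `E`, each golden product gets an `E` of its own and becomes a linear form in
  -- `ϑ₂` and `w₁`; the two forms multiply to the quadratic by `golden-norm`.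
  E*D : E * D ≈ ϑ₂ ^ 2 - w₁ * ϑ₂ - w₁ ^ 2
  E*D = begin
    E * D
      ≈⟨ *-congˡ D-product ⟩
    E * euler Q⁵
      ≈⟨ *-congˡ (∏∞-cong λ j → trans (+-congˡ (-‿cong (trans (^-assocʳ X 5 (suc j)) (trans (^-congʳ X (ℕₚ.*-comm 5 (suc j))) (sym (^-assocʳ X (suc j) 5))))))
           (trans (sym (∏[1-zⁱx] Φz (X ^ suc j))) (regroup (X ^ suc j)))) ⟩
    E * ∏∞ (λ j → (1# - X ^ suc j) * (((1# - z * X ^ suc j) * (1# - z ^ 4 * X ^ suc j)) * ((1# - z ^ 2 * X ^ suc j) * (1# - (z ^ 2) ^ 4 * X ^ suc j))))
      ≈⟨ *-congˡ (trans (∏∞-* (euler-convergent X≡[1]0) (Convergent-* (conv₂ z) (conv₂ (z ^ 2)))) (*-congˡ (∏∞-* (conv₂ z) (conv₂ (z ^ 2))))) ⟩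
    E * (E * (golden∏ torsion-free Φz * golden∏ torsion-free (Φ₅-2 Φz)))
      ≈⟨ solve 3 (λ e x y → e :* (e :* (x :* y)) := (e :* x) :* (e :* y)) refl E _ _ ⟩
    (E * golden∏ torsion-free Φz) * (E * golden∏ torsion-free (Φ₅-2 Φz))
      ≈⟨ *-cong (ϑ-golden torsion-free Φz) (ϑ-golden torsion-free (Φ₅-2 Φz)) ⟨
    (ϑ₂ - (1# + z + z ^ 4) * w₁) * (ϑ₂ - (1# + z ^ 2 + (z ^ 2) ^ 4) * w₁)
      ≈⟨ golden-norm Φz ϑ₂ w₁ ⟩
    ϑ₂ ^ 2 - w₁ * ϑ₂ - w₁ ^ 2 ∎
    where
    z⁸≈z³ : (z ^ 2) ^ 4 ≈ z ^ 3
    z⁸≈z³ = trans (solve 1 (λ z → (z :^ 2) :^ 4 := z :^ 5 :* z :^ 3) refl z) (trans (*-congʳ (z⁵≈1 Φz)) (*-identityˡ _))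

    regroup : ∀ x → (1# - x) * (1# - z * x) * (1# - z ^ 2 * x) * (1# - z ^ 3 * x) * (1# - z ^ 4 * x)
      ≈ (1# - x) * (((1# - z * x) * (1# - z ^ 4 * x)) * ((1# - z ^ 2 * x) * (1# - (z ^ 2) ^ 4 * x)))
    regroup x = trans (solve 5 (λ a b c d e → a :* b :* c :* d :* e := a :* ((b :* e) :* (c :* d))) refl _ _ _ _ _)
      (*-congˡ (*-congˡ (*-congˡ (+-congˡ (-‿cong (*-congʳ (sym z⁸≈z³)))))))

    conv₂ : ∀ v → Convergent (λ j → (1# - v * X ^ suc j) * (1# - v ^ 4 * X ^ suc j))
    conv₂ v = Convergent-* (multiple-convergent v) (multiple-convergent (v ^ 4))

  L-value : L β̄ (X * ᾱ) ≈ α * β * (ᾱ * β̄) ^ 2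
  L-value = *-cancel D̄≡[1]1 (*-cancel D̄≡[1]1 (begin
    D̄ * (D̄ * L β̄ (X * ᾱ))
      ≈⟨ solve 4 (λ d a b x → d :* (d :* (b :^ 2 :- (x :* a) :* b :- (x :* a) :^ 2))
           := (d :* b) :^ 2 :- (x :* (d :* a)) :* (d :* b) :- (x :* (d :* a)) :^ 2) refl D̄ ᾱ β̄ X ⟩
    ϑ₂ ^ 2 - w₁ * ϑ₂ - w₁ ^ 2
      ≈⟨ E*D ⟨
    E * D
      ≈⟨ *-congʳ E≈αβD ⟩
    α * β * D * D
      ≈⟨ *-cong (*-congˡ D≈ᾱβ̄D̄) D≈ᾱβ̄D̄ ⟩
    α * β * (ᾱ * β̄ * D̄) * (ᾱ * β̄ * D̄)
      ≈⟨ solve 4 (λ s a b d → s :* (a :* b :* d) :* (a :* b :* d) := d :* (d :* (s :* (a :* b) :^ 2))) refl (α * β) ᾱ β̄ D̄ ⟩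
    D̄ * (D̄ * (α * β * (ᾱ * β̄) ^ 2)) ∎))

  module _ {ρ : R.Carrier} {s : Series} (ρ≈s : const ρ ≈ s) where
    rot-E : rot ρ E ≈ ∏∞ (λ j → 1# - (s * X) ^ suc j)
    rot-E = trans (hom-euler (rotation ρ) X≡[1]0) (euler-cong (trans (rot-X ρ) (*-congʳ ρ≈s)))

    -- `D`, `ϑ₁` and `ϑ₂` are series in q^5, hence fixed by the rotation; only the `X` inside `w₁`
    -- acquires a factor.
    rot-E*D : ρ Rᵉ.^ 5 R.≈ R.1# → rot ρ E * D ≈ ϑ₂ ^ 2 - s * w₁ * ϑ₂ - (s * w₁) ^ 2
    rot-E*D ρ⁵ = begin
      rot ρ E * D
        ≈⟨ *-congˡ (up-rot ρ⁵ E) ⟨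
      rot ρ E * rot ρ D
        ≈⟨ H.⟪⟫-* E D ⟨
      rot ρ (E * D)
        ≈⟨ H.⟪⟫-cong E*D ⟩
      rot ρ (ϑ₂ ^ 2 - w₁ * ϑ₂ - w₁ ^ 2)
        ≈⟨ trans (H.⟪⟫-+ _ _) (+-cong (trans (H.⟪⟫-+ _ _) (+-cong (H.⟪⟫-^ ϑ₂ 2) (trans (H.⟪⟫-neg _) (-‿cong (H.⟪⟫-* _ _)))))
              (trans (H.⟪⟫-neg _) (-‿cong (H.⟪⟫-^ w₁ 2)))) ⟩
      rot ρ ϑ₂ ^ 2 - rot ρ w₁ * rot ρ ϑ₂ - rot ρ w₁ ^ 2
        ≈⟨ +-cong (+-cong (^-congˡ 2 fix₂) (-‿cong (*-cong rot-w₁ fix₂))) (-‿cong (^-congˡ 2 rot-w₁)) ⟩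
      ϑ₂ ^ 2 - s * w₁ * ϑ₂ - (s * w₁) ^ 2 ∎
      where
      module H = Rot ρ
      fix : ∀ f → rot ρ (D̄ * up f) ≈ D̄ * up f
      fix f = trans (H.⟪⟫-* D̄ (up f)) (*-cong (up-rot ρ⁵ D) (up-rot ρ⁵ f))
      fix₂ : rot ρ ϑ₂ ≈ ϑ₂
      fix₂ = fix β
      rot-w₁ : rot ρ w₁ ≈ s * w₁
      rot-w₁ = trans (H.⟪⟫-* X ϑ₁) (trans (*-cong (trans (rot-X ρ) (*-congʳ ρ≈s)) (fix α)) (*-assoc s X ϑ₁))

  -- The norm of `E` over q ↦ ζ^i q. It is evaluated twice, through the theta functions and through
  -- the factors of the product, and comparing the results gives Ramanujan's identity.
  normE : Series
  normE = rot R.1# E * rot ζ E * rot (ζ Rᵉ.^ 2) E * rot (ζ Rᵉ.^ 3) E * rot (ζ Rᵉ.^ 4) E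

  normE-theta : normE * D ^ 5 ≈ ϑ₂ ^ 10 - int (+ 11) * w₁ ^ 5 * ϑ₂ ^ 5 - w₁ ^ 10
  normE-theta = begin
    normE * D ^ 5
      ≈⟨ solve 6 (λ a b c d e x → a :* b :* c :* d :* e :* x :^ 5 := (a :* x) :* (b :* x) :* (c :* x) :* (d :* x) :* (e :* x)) refl _ _ _ _ _ D ⟩
    (rot R.1# E * D) * (rot ζ E * D) * (rot (ζ Rᵉ.^ 2) E * D) * (rot (ζ Rᵉ.^ 3) E * D) * (rot (ζ Rᵉ.^ 4) E * D)
      ≈⟨ *-cong (*-cong (*-cong (*-cong (rot-E*D refl 1⁵) (rot-E*D refl (Rᵉ.z⁵≈1 Φζ)))
           (rot-E*D (const-^ ζ 2) (Rᵉ.z⁵≈1 (Rᵉ.Φ₅-2 Φζ)))) (rot-E*D (const-^ ζ 3) (Rᵉ.z⁵≈1 (Rᵉ.Φ₅-3 Φζ)))) (rot-E*D (const-^ ζ 4) (Rᵉ.z⁵≈1 (Rᵉ.Φ₅-4 Φζ))) ⟩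
    (ϑ₂ ^ 2 - 1# * w₁ * ϑ₂ - (1# * w₁) ^ 2) * (ϑ₂ ^ 2 - z * w₁ * ϑ₂ - (z * w₁) ^ 2) * (ϑ₂ ^ 2 - z ^ 2 * w₁ * ϑ₂ - (z ^ 2 * w₁) ^ 2)
      * (ϑ₂ ^ 2 - z ^ 3 * w₁ * ϑ₂ - (z ^ 3 * w₁) ^ 2) * (ϑ₂ ^ 2 - z ^ 4 * w₁ * ϑ₂ - (z ^ 4 * w₁) ^ 2)
      ≈⟨ ∏-quadratic Φz ϑ₂ w₁ ⟩
    ϑ₂ ^ 10 - int (+ 11) * w₁ ^ 5 * ϑ₂ ^ 5 - w₁ ^ 10 ∎
    where
    1⁵ : R.1# Rᵉ.^ 5 R.≈ R.1#
    1⁵ = R.trans (R.*-identityˡ _) (R.trans (R.*-identityˡ _) (R.trans (R.*-identityˡ _) (R.trans (R.*-identityˡ _) (R.*-identityˡ _))))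

  -- The product over the five conjugates of 1 - q^n is 1 - q^(5n), or (1 - q^n)^5 when 5 divides n.
  normE-product : normE * D̄ ≈ D ^ 6
  normE-product = begin
    normE * D̄
      ≈⟨ *-cong (*-cong (*-cong (*-cong (*-cong (rot-E refl) (rot-E refl)) (rot-E (const-^ ζ 2))) (rot-E (const-^ ζ 3))) (rot-E (const-^ ζ 4))) D̄-product ⟩
    ∏∞ (F 1#) * ∏∞ (F z) * ∏∞ (F (z ^ 2)) * ∏∞ (F (z ^ 3)) * ∏∞ (F (z ^ 4)) * euler Q²⁵
      ≈⟨ *-congʳ (trans (∏∞-* (C* (C* (C* (C _) (C _)) (C _)) (C _)) (C _)) (*-congʳ (trans (∏∞-* (C* (C* (C _) (C _)) (C _)) (C _)) (*-congʳ
           (trans (∏∞-* (C* (C _) (C _)) (C _)) (*-congʳ (∏∞-* (C _) (C _)))))))) ⟨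
    ∏∞ N * euler Q²⁵
      ≈⟨ *-congʳ (∏∞-block N-conv) ⟩
    ∏∞ (block N) * euler Q²⁵
      ≈⟨ ∏∞-* (Convergent-block N-conv) (euler-convergent Q²⁵₀) ⟨
    ∏∞ (λ k → block N k * (1# - Q²⁵ ^ suc k))
      ≈⟨ ∏∞-cong blocks ⟩
    ∏∞ (λ k → block (λ j → 1# - Q⁵ ^ suc j) k * (1# - Q⁵ ^ suc k) ^ 5)
      ≈⟨ ∏∞-* (Convergent-block (euler-convergent Q⁵₀)) (Convergent-^ (euler-convergent Q⁵₀) 5) ⟩
    ∏∞ (block (λ j → 1# - Q⁵ ^ suc j)) * ∏∞ (λ k → (1# - Q⁵ ^ suc k) ^ 5)
      ≈⟨ *-cong (sym (∏∞-block (euler-convergent Q⁵₀))) (∏∞-^ (euler-convergent Q⁵₀) 5) ⟩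
    euler Q⁵ * euler Q⁵ ^ 5
      ≈⟨ *-cong D-product (^-congˡ 5 D-product) ⟨
    D ^ 6 ∎
    where
    F : Series → ℕ → Series
    F s j = 1# - (s * X) ^ suc j
    C : ∀ s → Convergent (F s)
    C s = euler-convergent (vanish-*ˡ s X≡[1]0)
    C* = Convergent-*
    N : ℕ → Series
    N j = F 1# j * F z j * F (z ^ 2) j * F (z ^ 3) j * F (z ^ 4) j
    N-conv : Convergent N
    N-conv = C* (C* (C* (C* (C _) (C _)) (C _)) (C _)) (C _)

    F-power : ∀ i {t} n → z ^ suc n ≈ t → F (z ^ i) n ≈ 1# - t ^ i * X ^ suc n
    F-power i {t} n p = +-congˡ (-‿cong (trans (^-distrib-* (z ^ i) X (suc n)) (*-congʳ
      (trans (^-assocʳ z i (suc n)) (trans (^-congʳ z (ℕₚ.*-comm i (suc n))) (trans (sym (^-assocʳ z (suc n) i)) (^-congˡ i p)))))))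

    N≈ : ∀ {t} n → z ^ suc n ≈ t →
      N n ≈ (1# - X ^ suc n) * (1# - t * X ^ suc n) * (1# - t ^ 2 * X ^ suc n) * (1# - t ^ 3 * X ^ suc n) * (1# - t ^ 4 * X ^ suc n)
    N≈ {t} n p = *-cong (*-cong (*-cong (*-cong
      (trans (F-power 0 n p) (+-congˡ (-‿cong (*-identityˡ _))))
      (trans (+-congˡ (-‿cong (^-congˡ (suc n) (*-congʳ (sym (*-identityʳ z)))))) (trans (F-power 1 n p) (+-congˡ (-‿cong (*-congʳ (*-identityʳ t)))))))
      (F-power 2 n p)) (F-power 3 n p)) (F-power 4 n p)

    X^n⁵ : ∀ n → 1# - (X ^ n) ^ 5 ≈ 1# - Q⁵ ^ n
    X^n⁵ n = +-congˡ (-‿cong (trans (^-assocʳ X n 5) (trans (^-congʳ X (ℕₚ.*-comm n 5)) (sym (^-assocʳ X 5 n)))))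

    N-unit : ∀ {t} n → Φ₅ t ≈ 0# → z ^ suc n ≈ t → N n ≈ 1# - Q⁵ ^ suc n
    N-unit n Φt p = trans (N≈ n p) (trans (∏[1-zⁱx] Φt (X ^ suc n)) (X^n⁵ (suc n)))

    N-multiple : ∀ k → N (4 ℕ.+ k ℕ.* 5) ≈ (1# - Q⁵ ^ suc k) ^ 5
    N-multiple k = trans (N≈ (4 ℕ.+ k ℕ.* 5) (trans (periodic (z⁵≈1 Φz) 5 k) (z⁵≈1 Φz)))
      (trans (solve 1 (λ x → (con (+ 1) :- x) :* (con (+ 1) :- con (+ 1) :* x) :* (con (+ 1) :- con (+ 1) :^ 2 :* x)
                 :* (con (+ 1) :- con (+ 1) :^ 3 :* x) :* (con (+ 1) :- con (+ 1) :^ 4 :* x) := (con (+ 1) :- x) :^ 5) refl (X ^ (5 ℕ.+ k ℕ.* 5)))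
        (^-congˡ 5 (+-congˡ (-‿cong (X^5k (suc k))))))

    blocks : ∀ k → block N k * (1# - Q²⁵ ^ suc k) ≈ block (λ j → 1# - Q⁵ ^ suc j) k * (1# - Q⁵ ^ suc k) ^ 5
    blocks k = trans
      (*-cong (*-cong (*-cong (*-cong (*-cong
        (N-unit (k ℕ.* 5) Φz (trans (periodic (z⁵≈1 Φz) 1 k) (*-identityʳ z)))
        (N-unit (1 ℕ.+ k ℕ.* 5) (Φ₅-2 Φz) (periodic (z⁵≈1 Φz) 2 k)))
        (N-unit (2 ℕ.+ k ℕ.* 5) (Φ₅-3 Φz) (periodic (z⁵≈1 Φz) 3 k)))
        (N-unit (3 ℕ.+ k ℕ.* 5) (Φ₅-4 Φz) (periodic (z⁵≈1 Φz) 4 k)))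
        (N-multiple k))
        (+-congˡ (-‿cong (trans (Q²⁵^ (suc k)) (trans (^-assocʳ X (suc k ℕ.* 5) 5) (trans (^-congʳ X (ℕₚ.*-comm (suc k ℕ.* 5) 5)) (sym (^-assocʳ X 5 (suc k ℕ.* 5)))))))))
      (solve 6 (λ a b c d e f → a :* b :* c :* d :* e :* f := a :* b :* c :* d :* f :* e) refl _ _ _ _ _ _)

  -- Writing D^11 as D^6 D^5, the first power is `normE * D̄` by the product evaluation, and
  -- `normE * D ^ 5` is known from the theta evaluation. The latter is homogeneous of degree 10 in
  -- `D̄`, so D̄^11 cancels.
  ramanujan-up : (ᾱ * β̄) ^ 11 ≈ β̄ ^ 10 - int (+ 11) * (X * ᾱ) ^ 5 * β̄ ^ 5 - (X * ᾱ) ^ 10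
  ramanujan-up = *-cancel D̄¹¹≡1 (begin
    D̄ ^ 11 * (ᾱ * β̄) ^ 11
      ≈⟨ trans (*-comm _ _) (sym (^-distrib-* (ᾱ * β̄) D̄ 11)) ⟩
    (ᾱ * β̄ * D̄) ^ 11
      ≈⟨ ^-congˡ 11 D≈ᾱβ̄D̄ ⟨
    D ^ 11
      ≈⟨ solve 1 (λ d → d :^ 11 := d :^ 6 :* d :^ 5) refl D ⟩
    D ^ 6 * D ^ 5
      ≈⟨ *-congʳ normE-product ⟨
    normE * D̄ * D ^ 5
      ≈⟨ solve 3 (λ n e d → n :* e :* d := e :* (n :* d)) refl normE D̄ (D ^ 5) ⟩
    D̄ * (normE * D ^ 5)
      ≈⟨ *-congˡ normE-theta ⟩
    D̄ * (ϑ₂ ^ 10 - int (+ 11) * w₁ ^ 5 * ϑ₂ ^ 5 - w₁ ^ 10)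
      ≈⟨ solve 4 (λ d x a b → d :* ((d :* b) :^ 10 :- con (+ 11) :* (x :* (d :* a)) :^ 5 :* (d :* b) :^ 5 :- (x :* (d :* a)) :^ 10)
           := d :^ 11 :* (b :^ 10 :- con (+ 11) :* (x :* a) :^ 5 :* b :^ 5 :- (x :* a) :^ 10)) refl D̄ X ᾱ β̄ ⟩
    D̄ ^ 11 * (β̄ ^ 10 - int (+ 11) * (X * ᾱ) ^ 5 * β̄ ^ 5 - (X * ᾱ) ^ 10) ∎)
    where
    D̄¹¹≡1 : D̄ ^ 11 ≡[ 1 ] 1#
    D̄¹¹≡1 = ≡[]-trans (≡[]-^ D̄≡[1]1 11) (≈⇒≡[] (1^ 11))

  up-int : ∀ m → up (int m) ≈ int m
  up-int m = trans (Up.⟪⟫-cong (int≈ι m)) (trans (mk≋ (up-const _)) (sym (int≈ι m)))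

  -- A norm over the rotations sees only q^5, so the identity first appears dilated; injectivity of
  -- `up` removes the dilation.
  ramanujan : (α * β) ^ 11 ≈ β ^ 10 - int (+ 11) * X * α ^ 5 * β ^ 5 - X ^ 2 * α ^ 10
  ramanujan = up-injective (begin
    up ((α * β) ^ 11)
      ≈⟨ trans (Up.⟪⟫-^ (α * β) 11) (^-congˡ 11 (Up.⟪⟫-* α β)) ⟩
    (ᾱ * β̄) ^ 11
      ≈⟨ ramanujan-up ⟩
    β̄ ^ 10 - int (+ 11) * (X * ᾱ) ^ 5 * β̄ ^ 5 - (X * ᾱ) ^ 10
      ≈⟨ solve 3 (λ x a b → b :^ 10 :- con (+ 11) :* (x :* a) :^ 5 :* b :^ 5 :- (x :* a) :^ 10
           := b :^ 10 :- con (+ 11) :* x :^ 5 :* a :^ 5 :* b :^ 5 :- (x :^ 5) :^ 2 :* a :^ 10) refl X ᾱ β̄ ⟩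
    β̄ ^ 10 - int (+ 11) * X ^ 5 * ᾱ ^ 5 * β̄ ^ 5 - (X ^ 5) ^ 2 * ᾱ ^ 10
      ≈⟨ +-cong (+-cong (Up.⟪⟫-^ β 10) (-‿cong (*-cong (*-cong (*-cong (up-int (+ 11)) up-X) (Up.⟪⟫-^ α 5)) (Up.⟪⟫-^ β 5))))
           (-‿cong (*-cong (trans (Up.⟪⟫-^ X 2) (^-congˡ 2 up-X)) (Up.⟪⟫-^ α 10))) ⟨
    up (β ^ 10) - up (int (+ 11)) * up X * up (α ^ 5) * up (β ^ 5) - up (X ^ 2) * up (α ^ 10)
      ≈⟨ +-cong (+-congˡ (-‿cong (*-congʳ (*-congʳ (Up.⟪⟫-* _ _))))) (-‿cong (Up.⟪⟫-* _ _)) ⟨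
    up (β ^ 10) - up (int (+ 11) * X) * up (α ^ 5) * up (β ^ 5) - up (X ^ 2 * α ^ 10)
      ≈⟨ +-cong (+-congˡ (-‿cong (trans (Up.⟪⟫-* _ _) (*-congʳ (Up.⟪⟫-* _ _))))) refl ⟨
    up (β ^ 10) - up (int (+ 11) * X * α ^ 5 * β ^ 5) - up (X ^ 2 * α ^ 10)
      ≈⟨ +-cong (+-congˡ (Up.⟪⟫-neg _)) (Up.⟪⟫-neg _) ⟨
    up (β ^ 10) + up (- (int (+ 11) * X * α ^ 5 * β ^ 5)) + up (- (X ^ 2 * α ^ 10))
      ≈⟨ trans (Up.⟪⟫-+ _ _) (+-congʳ (Up.⟪⟫-+ _ _)) ⟨
    up (β ^ 10 - int (+ 11) * X * α ^ 5 * β ^ 5 - X ^ 2 * α ^ 10) ∎)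

-- Five-dissection of 1/R⁵

module Dissection {c ℓ} (R : CommutativeRing c ℓ) (ι : IntegerMap R) (root : PrimitiveFifthRoot R ι) where
  private module R = CommutativeRing R
  open SeriesCalculus R ι
  open Substitutions R ι
  open DissectionIdentities seriesRing seriesMap
  open ProductIdentities R ι
  open JacobiTripleProduct R ι using (theta∏)
  open RogersRamanujanIdentities R ι root
  open import Relation.Binary.Reasoning.Setoid setoid

  theta≡[1]1 : ∀ i j → theta∏ (- X ^ suc i) (- X ^ suc j) Q⁵ ≡[ 1 ] 1#
  theta≡[1]1 i j = ∏∞≡[1] (≡[]-trans (≡[]-* (f i) (f j)) (≈⇒≡[] (*-identityˡ 1#)))
    where
    f : ∀ i → 1# + - X ^ suc i * 1# ≡[ 1 ] 1#
    f i = ≡[]-trans (≈⇒≡[] (+-congˡ (*-identityʳ _))) (1-vanish (X^≡[1]0 i))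

  α≡[1]1 : α ≡[ 1 ] 1#
  α≡[1]1 = theta≡[1]1 3 0

  β≡[1]1 : β ≡[ 1 ] 1#
  β≡[1]1 = theta≡[1]1 2 1

  ᾱ≡[1]1 : ᾱ ≡[ 1 ] 1#
  ᾱ≡[1]1 = ≡[]-trans (Up.⟪⟫-≡[] α≡[1]1) (≈⇒≡[] Up.⟪⟫-1)

  β̄≡[1]1 : β̄ ≡[ 1 ] 1#
  β̄≡[1]1 = ≡[]-trans (Up.⟪⟫-≡[] β≡[1]1) (≈⇒≡[] Up.⟪⟫-1)

  w : Series
  w = X * ᾱ

  LPM-value : L β̄ w * (P β̄ w * M β̄ w) ≈ (ᾱ * β̄) ^ 11
  LPM-value = trans (LPM β̄ w) (sym ramanujan-up)

  PM-value : α * β * (P β̄ w * M β̄ w) ≈ (ᾱ * β̄) ^ 9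
  PM-value = *-cancel {h = (ᾱ * β̄) ^ 2} t²≡[1]1 (begin
    (ᾱ * β̄) ^ 2 * (α * β * (P β̄ w * M β̄ w))
      ≈⟨ solve 3 (λ s t p → t :* (s :* p) := s :* t :* p) refl (α * β) ((ᾱ * β̄) ^ 2) (P β̄ w * M β̄ w) ⟩
    α * β * (ᾱ * β̄) ^ 2 * (P β̄ w * M β̄ w)
      ≈⟨ *-congʳ L-value ⟨
    L β̄ w * (P β̄ w * M β̄ w)
      ≈⟨ LPM-value ⟩
    (ᾱ * β̄) ^ 11
      ≈⟨ ^-homo-* (ᾱ * β̄) 2 9 ⟩
    (ᾱ * β̄) ^ 2 * (ᾱ * β̄) ^ 9 ∎)
    where
    t²≡[1]1 : (ᾱ * β̄) ^ 2 ≡[ 1 ] 1#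
    t²≡[1]1 = ≡[]-trans (≡[]-^ (≡[]-trans (≡[]-* ᾱ≡[1]1 β̄≡[1]1) (≈⇒≡[] (*-identityˡ 1#))) 2) (≈⇒≡[] (1^ 2))

  -- R(q)^5 and its claimed value are roots of the same quadratic, and only one root is a power series.
  R⁵-value : β ^ 5 * (ᾱ * M β̄ w) ≈ α ^ 5 * (β̄ * P β̄ w)
  R⁵-value = begin
    p₁ * r₂
      ≈⟨ solve 2 (λ x y → x := (x :- y) :+ y) refl (p₁ * r₂) (p₂ * r₁) ⟩
    (p₁ * r₂ - p₂ * r₁) + p₂ * r₁
      ≈⟨ +-congʳ (*-cancel {h = p₁ * r₁ + X ^ 2 * p₂ * r₂} unit (trans factored (sym (zeroʳ _)))) ⟩
    0# + p₂ * r₁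
      ≈⟨ +-identityˡ _ ⟩
    p₂ * r₁ ∎
    where
    p₁ p₂ r₁ r₂ : Series
    p₁ = β ^ 5
    p₂ = α ^ 5
    r₁ = β̄ * P β̄ w
    r₂ = ᾱ * M β̄ w

    factored : (p₁ * r₁ + X ^ 2 * p₂ * r₂) * (p₁ * r₂ - p₂ * r₁) ≈ 0#
    factored = begin
      (p₁ * r₁ + X ^ 2 * p₂ * r₂) * (p₁ * r₂ - p₂ * r₁)
        -- For F(s, t) = s² - 11qst - q²t², the middle terms cancel in F(p₁, p₂) r₁r₂ - F(r₁, r₂)
        -- p₁p₂, and what remains factors.
        ≈⟨ solve 5 (λ x p q r s → (p :* r :+ x :^ 2 :* q :* s) :* (p :* s :- q :* r)
             := (p :^ 2 :- con (+ 11) :* x :* q :* p :- x :^ 2 :* q :^ 2) :* (r :* s)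
                :- (r :^ 2 :- con (+ 11) :* r :* (x :* s) :- (x :* s) :^ 2) :* (p :* q)) refl X p₁ p₂ r₁ r₂ ⟩
      (p₁ ^ 2 - int (+ 11) * X * p₂ * p₁ - X ^ 2 * p₂ ^ 2) * (r₁ * r₂) - (r₁ ^ 2 - int (+ 11) * r₁ * (X * r₂) - (X * r₂) ^ 2) * (p₁ * p₂)
        ≈⟨ +-cong (*-congʳ Fp) (-‿cong (*-congʳ Fr)) ⟩
      (α * β) ^ 11 * (r₁ * r₂) - (α * β * (ᾱ * β̄) ^ 2) ^ 5 * (p₁ * p₂)
        ≈⟨ solve 6 (λ a b a′ b′ p m → (a :* b) :^ 11 :* ((b′ :* p) :* (a′ :* m)) :- (a :* b :* (a′ :* b′) :^ 2) :^ 5 :* (b :^ 5 :* a :^ 5)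
             := (a :* b) :^ 10 :* (a′ :* b′) :* (a :* b :* (p :* m) :- (a′ :* b′) :^ 9)) refl α β ᾱ β̄ (P β̄ w) (M β̄ w) ⟩
      (α * β) ^ 10 * (ᾱ * β̄) * (α * β * (P β̄ w * M β̄ w) - (ᾱ * β̄) ^ 9)
        ≈⟨ *-congˡ (trans (+-congʳ PM-value) (-‿inverseʳ _)) ⟩
      (α * β) ^ 10 * (ᾱ * β̄) * 0#
        ≈⟨ zeroʳ _ ⟩
      0# ∎
      where
      Fp : p₁ ^ 2 - int (+ 11) * X * p₂ * p₁ - X ^ 2 * p₂ ^ 2 ≈ (α * β) ^ 11
      Fp = trans (+-cong (+-congʳ (^-assocʳ β 5 2)) (-‿cong (*-congˡ (^-assocʳ α 5 2)))) (sym ramanujan)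
      Fr : r₁ ^ 2 - int (+ 11) * r₁ * (X * r₂) - (X * r₂) ^ 2 ≈ (α * β * (ᾱ * β̄) ^ 2) ^ 5
      Fr = trans (+-cong (+-congˡ (-‿cong (*-congˡ assoc′))) (-‿cong (^-congˡ 2 assoc′)))
        (trans (L⁵ β̄ w) (^-congˡ 5 L-value))
        where
        assoc′ : X * r₂ ≈ w * M β̄ w
        assoc′ = sym (*-assoc X ᾱ (M β̄ w))

    unit : p₁ * r₁ + X ^ 2 * p₂ * r₂ ≡[ 1 ] 1#
    unit = ≡[]-trans (≡[]-+ (≡[]-* (≡[]-^ β≡[1]1 5) (≡[]-* β̄≡[1]1 P≡)) X²≡) (≈⇒≡[]
      (solve 0 (con (+ 1) :^ 5 :* (con (+ 1) :* con (+ 1)) :+ con (+ 0) := con (+ 1)) refl))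
      where
      X²≡ : X ^ 2 * p₂ * r₂ ≡[ 1 ] 0#
      X²≡ = ≡[]-trans (≈⇒≡[] (solve 3 (λ x p r → x :* p :* r := p :* r :* x) refl (X ^ 2) p₂ r₂)) (vanish-*ˡ (p₂ * r₂) (X^≡[1]0 1))
      w≡ : w ≡[ 1 ] 0#
      w≡ = ≡[]-trans (≈⇒≡[] (*-comm X ᾱ)) (vanish-*ˡ ᾱ X≡[1]0)
      P≡ : P β̄ w ≡[ 1 ] 1#
      P≡ = ≡[]-trans (≈⇒≡[] (solve 2 (λ b w → b :^ 4 :+ con (+ 3) :* b :^ 3 :* w :+ con (+ 4) :* b :^ 2 :* w :^ 2 :+ con (+ 2) :* b :* w :^ 3 :+ w :^ 4
              := b :^ 4 :+ (con (+ 3) :* b :^ 3 :+ con (+ 4) :* b :^ 2 :* w :+ con (+ 2) :* b :* w :^ 2 :+ w :^ 3) :* w) refl β̄ w))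
        (≡[]-trans (≡[]-+ (≡[]-^ β̄≡[1]1 4) (vanish-*ˡ _ w≡)) (≈⇒≡[] (trans (+-identityʳ _) (1^ 4))))

  cancel-power : ∀ {x y} → x * y ≈ 1# → ∀ k i → x ^ k * y ^ (k ℕ.+ i) ≈ y ^ i
  cancel-power {x} {y} xy k i = trans (*-congˡ (^-homo-* y k i)) (trans (sym (*-assoc _ _ _))
    (trans (*-congʳ (trans (sym (^-distrib-* x y k)) (trans (^-congˡ k xy) (1^ k)))) (*-identityˡ _)))

  module _ {G H : Series} (αG : α * G ≈ 1#) (βH : β * H ≈ 1#) where
    private
      Ḡ H̄ : Series
      Ḡ = up G
      H̄ = up H

      ᾱḠ : ᾱ * Ḡ ≈ 1#
      ᾱḠ = trans (sym (Up.⟪⟫-* α G)) (trans (Up.⟪⟫-cong αG) Up.⟪⟫-1)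

      β̄H̄ : β̄ * H̄ ≈ 1#
      β̄H̄ = trans (sym (Up.⟪⟫-* β H)) (trans (Up.⟪⟫-cong βH) Up.⟪⟫-1)

    W : ℕ → ℕ → Series
    W i l = G ^ i * H ^ l

    -- By `R⁵-value` the left side is b̄P/(āM). Extending the fraction by PL turns its denominator
    -- into ā(āb̄)^11; with the b̄ of the numerator cancelled, the inverse powers 12 and 10 remain.
    quotient : β ^ 5 * G ^ 5 ≈ P β̄ w ^ 2 * L β̄ w * (Ḡ ^ 12 * H̄ ^ 10)
    quotient = begin
      β ^ 5 * G ^ 5
        ≈⟨ solve 2 (λ b g → b :* g := b :* g :* (con (+ 1) :* con (+ 1))) refl (β ^ 5) (G ^ 5) ⟩
      β ^ 5 * G ^ 5 * (Ḡ ^ 0 * H̄ ^ 0)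
        ≈⟨ *-congˡ (*-cong (cancel-power ᾱḠ 12 0) (cancel-power β̄H̄ 11 0)) ⟨
      β ^ 5 * G ^ 5 * ((ᾱ ^ 12 * Ḡ ^ 12) * (β̄ ^ 11 * H̄ ^ 11))
        ≈⟨ solve 6 (λ b g a′ b′ g′ h′ → b :* g :* ((a′ :^ 12 :* g′) :* (b′ :^ 11 :* h′)) := b :* a′ :* ((a′ :* b′) :^ 11) :* (g :* g′ :* h′)) refl
             (β ^ 5) (G ^ 5) ᾱ β̄ (Ḡ ^ 12) (H̄ ^ 11) ⟩
      β ^ 5 * ᾱ * (ᾱ * β̄) ^ 11 * (G ^ 5 * Ḡ ^ 12 * H̄ ^ 11)
        ≈⟨ *-congʳ (*-congˡ (sym LPM-value)) ⟩
      β ^ 5 * ᾱ * (L β̄ w * (P β̄ w * M β̄ w)) * (G ^ 5 * Ḡ ^ 12 * H̄ ^ 11)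
        ≈⟨ *-congʳ (solve 5 (λ b a l p m → b :* a :* (l :* (p :* m)) := b :* (a :* m) :* (p :* l)) refl (β ^ 5) ᾱ (L β̄ w) (P β̄ w) (M β̄ w)) ⟩
      β ^ 5 * (ᾱ * M β̄ w) * (P β̄ w * L β̄ w) * (G ^ 5 * Ḡ ^ 12 * H̄ ^ 11)
        ≈⟨ *-congʳ (*-congʳ R⁵-value) ⟩
      α ^ 5 * (β̄ * P β̄ w) * (P β̄ w * L β̄ w) * (G ^ 5 * Ḡ ^ 12 * H̄ ^ 11)
        ≈⟨ solve 8 (λ a b p l g g′ h h′ → a :* (b :* p) :* (p :* l) :* (g :* g′ :* (h :* h′)) := (a :* g) :* (b :* h) :* (p :^ 2 :* l :* (g′ :* h′))) refl
             (α ^ 5) β̄ (P β̄ w) (L β̄ w) (G ^ 5) (Ḡ ^ 12) H̄ (H̄ ^ 10) ⟩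
      (α ^ 5 * G ^ 5) * (β̄ * H̄) * (P β̄ w ^ 2 * L β̄ w * (Ḡ ^ 12 * H̄ ^ 10))
        ≈⟨ *-congʳ (trans (*-cong (cancel-power αG 5 0) β̄H̄) (*-identityˡ 1#)) ⟩
      1# * (P β̄ w ^ 2 * L β̄ w * (Ḡ ^ 12 * H̄ ^ 10))
        ≈⟨ *-identityˡ _ ⟩
      P β̄ w ^ 2 * L β̄ w * (Ḡ ^ 12 * H̄ ^ 10) ∎

    monomial : ∀ c k i j l → int c * w ^ k * β̄ ^ j * (Ḡ ^ (k ℕ.+ i) * H̄ ^ (j ℕ.+ l)) ≈ int c * (X ^ k * up (W i l))
    monomial c k i j l = begin
      int c * w ^ k * β̄ ^ j * (Ḡ ^ (k ℕ.+ i) * H̄ ^ (j ℕ.+ l))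
        ≈⟨ *-congʳ (*-congʳ (*-congˡ (^-distrib-* X ᾱ k))) ⟩
      int c * (X ^ k * ᾱ ^ k) * β̄ ^ j * (Ḡ ^ (k ℕ.+ i) * H̄ ^ (j ℕ.+ l))
        ≈⟨ solve 6 (λ c x a b g h → c :* (x :* a) :* b :* (g :* h) := c :* (x :* ((a :* g) :* (b :* h)))) refl (int c) (X ^ k) (ᾱ ^ k) (β̄ ^ j) _ _ ⟩
      int c * (X ^ k * ((ᾱ ^ k * Ḡ ^ (k ℕ.+ i)) * (β̄ ^ j * H̄ ^ (j ℕ.+ l))))
        ≈⟨ *-congˡ (*-congˡ (*-cong (cancel-power ᾱḠ k i) (cancel-power β̄H̄ j l))) ⟩
      int c * (X ^ k * (Ḡ ^ i * H̄ ^ l))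
        ≈⟨ *-congˡ (*-congˡ (trans (Up.⟪⟫-* _ _) (*-cong (Up.⟪⟫-^ G i) (Up.⟪⟫-^ H l)))) ⟨
      int c * (X ^ k * up (W i l)) ∎

    -- Each of these collects the terms whose k lies in one residue class modulo 5, with q^5
    -- rewritten as q.
    V₀ V₁ V₂ V₃ V₄ : Series
    V₀ = int (+ 1) * W 12 0 + int (ℤ.- + 36) * (X * W 7 5) + int (ℤ.- + 1) * (X ^ 2 * W 2 10)
    V₁ = int (+ 5) * W 11 1 + int (ℤ.- + 40) * (X * W 6 6)
    V₂ = int (+ 10) * W 10 2 + int (ℤ.- + 30) * (X * W 5 7)
    V₃ = int (+ 5) * W 9 3 + int (ℤ.- + 15) * (X * W 4 8)
    V₄ = int (ℤ.- + 15) * W 8 4 + int (ℤ.- + 5) * (X * W 3 9)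

    up-V : ∀ a b i j k l → up (int a * W i j + int b * (X * W k l)) ≈ int a * up (W i j) + int b * (X ^ 5 * up (W k l))
    up-V a b i j k l = trans (Up.⟪⟫-+ _ _) (+-cong (trans (Up.⟪⟫-* _ _) (*-congʳ (up-int a)))
      (trans (Up.⟪⟫-* _ _) (*-cong (up-int b) (trans (Up.⟪⟫-* _ _) (*-congʳ up-X)))))

    up-V₀ : up V₀ ≈ int (+ 1) * up (W 12 0) + int (ℤ.- + 36) * (X ^ 5 * up (W 7 5)) + int (ℤ.- + 1) * (X ^ 10 * up (W 2 10))
    up-V₀ = trans (Up.⟪⟫-+ _ _) (+-cong (up-V (+ 1) (ℤ.- + 36) 12 0 7 5)
      (trans (Up.⟪⟫-* _ _) (*-cong (up-int (ℤ.- + 1)) (trans (Up.⟪⟫-* _ _) (*-congʳ (up-X^ 2))))))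

    dissection : β ^ 5 * G ^ 5 ≈ up V₀ + X ^ 1 * up V₁ + X ^ 2 * up V₂ + X ^ 3 * up V₃ + X ^ 4 * up V₄
    dissection = begin
      β ^ 5 * G ^ 5
        ≈⟨ trans quotient (*-congʳ (P²L β̄ w)) ⟩
      _
        ≈⟨ ∑*11 _ _ _ _ _ _ _ _ _ _ _ _ ⟩
      _
        ≈⟨ +-cong (+-cong (+-cong (+-cong (+-cong (+-cong (+-cong (+-cong (+-cong (+-cong
             (monomial (+ 1) 0 12 10 0) (monomial (+ 5) 1 11 9 1)) (monomial (+ 10) 2 10 8 2)) (monomial (+ 5) 3 9 7 3))
             (monomial (ℤ.- + 15) 4 8 6 4)) (monomial (ℤ.- + 36) 5 7 5 5)) (monomial (ℤ.- + 40) 6 6 4 6)) (monomial (ℤ.- + 30) 7 5 3 7))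
             (monomial (ℤ.- + 15) 8 4 2 8)) (monomial (ℤ.- + 5) 9 3 1 9)) (monomial (ℤ.- + 1) 10 2 0 10) ⟩
      _
        ≈⟨ solve 12 (λ x u₀ u₁ u₂ u₃ u₄ u₅ u₆ u₇ u₈ u₉ u₁₀ →
             con (+ 1) :* (x :^ 0 :* u₀) :+ con (+ 5) :* (x :^ 1 :* u₁) :+ con (+ 10) :* (x :^ 2 :* u₂) :+ con (+ 5) :* (x :^ 3 :* u₃)
             :+ con (ℤ.- + 15) :* (x :^ 4 :* u₄) :+ con (ℤ.- + 36) :* (x :^ 5 :* u₅) :+ con (ℤ.- + 40) :* (x :^ 6 :* u₆) :+ con (ℤ.- + 30) :* (x :^ 7 :* u₇)
             :+ con (ℤ.- + 15) :* (x :^ 8 :* u₈) :+ con (ℤ.- + 5) :* (x :^ 9 :* u₉) :+ con (ℤ.- + 1) :* (x :^ 10 :* u₁₀)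
             := (con (+ 1) :* u₀ :+ con (ℤ.- + 36) :* (x :^ 5 :* u₅) :+ con (ℤ.- + 1) :* (x :^ 10 :* u₁₀))
                :+ x :^ 1 :* (con (+ 5) :* u₁ :+ con (ℤ.- + 40) :* (x :^ 5 :* u₆))
                :+ x :^ 2 :* (con (+ 10) :* u₂ :+ con (ℤ.- + 30) :* (x :^ 5 :* u₇))
                :+ x :^ 3 :* (con (+ 5) :* u₃ :+ con (ℤ.- + 15) :* (x :^ 5 :* u₈))
                :+ x :^ 4 :* (con (ℤ.- + 15) :* u₄ :+ con (ℤ.- + 5) :* (x :^ 5 :* u₉))) refl
             X (up (W 12 0)) (up (W 11 1)) (up (W 10 2)) (up (W 9 3)) (up (W 8 4)) (up (W 7 5)) (up (W 6 6)) (up (W 5 7)) (up (W 4 8)) (up (W 3 9)) (up (W 2 10)) ⟩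
      _
        ≈⟨ +-cong (+-cong (+-cong (+-cong up-V₀ (*-congˡ (up-V (+ 5) (ℤ.- + 40) 11 1 6 6))) (*-congˡ (up-V (+ 10) (ℤ.- + 30) 10 2 5 7)))
             (*-congˡ (up-V (+ 5) (ℤ.- + 15) 9 3 4 8))) (*-congˡ (up-V (ℤ.- + 15) (ℤ.- + 5) 8 4 3 9)) ⟨
      up V₀ + X ^ 1 * up V₁ + X ^ 2 * up V₂ + X ^ 3 * up V₃ + X ^ 4 * up V₄ ∎
      where
      ∑*11 : ∀ a b c d e f g h i j k y → (a + b + c + d + e + f + g + h + i + j + k) * y
        ≈ a * y + b * y + c * y + d * y + e * y + f * y + g * y + h * y + i * y + j * y + k * y
      ∑*11 = solve 12 (λ a b c d e f g h i j k y → (a :+ b :+ c :+ d :+ e :+ f :+ g :+ h :+ i :+ j :+ k) :* y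
        := a :* y :+ b :* y :+ c :* y :+ d :* y :+ e :* y :+ f :* y :+ g :* y :+ h :* y :+ i :* y :+ j :* y :+ k :* y) refl

  below : ∀ k d n f → d ℕ.< 4 → (X ^ k * up f) (k ℕ.+ (suc d ℕ.+ n ℕ.* 5)) R.≈ R.0#
  below k d n f d<4 = R.trans (X^*-≥ k (up f) (suc d ℕ.+ n ℕ.* 5)) (up-nonmultiple f d n d<4)

  -- Relative to the leading exponent s + e + 1, the index s + 5n is congruent to d + 1 = 4 - e
  -- modulo 5, hence never a multiple of 5. For n = 0 it lies below that exponent, so this case is
  -- settled by the order of vanishing.
  above : ∀ s e d n f → e ℕ.+ d ≡ 3 → (X ^ (s ℕ.+ suc e) * up f) (s ℕ.+ n ℕ.* 5) R.≈ R.0#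
  above s e d zero f eq = at< (≡[]-trans (≈⇒≡[] (*-comm (X ^ (s ℕ.+ suc e)) (up f))) (vanish-*ˡ (up f) (vanish-^ X≡[1]0 (s ℕ.+ suc e))))
    (s ℕ.+ 0) (ℕₚ.+-monoʳ-< s (s≤s z≤n))
  above s e d (suc n) f eq = ≡.subst (λ m → (X ^ (s ℕ.+ suc e) * up f) m R.≈ R.0#) index
    (below (s ℕ.+ suc e) d n f (s≤s (≡.subst (d ≤_) eq (ℕₚ.m≤n+m d e))))
    where
    index : s ℕ.+ suc e ℕ.+ (suc d ℕ.+ n ℕ.* 5) ≡ s ℕ.+ (5 ℕ.+ n ℕ.* 5)
    index = ≡.trans (ℕₚ.+-assoc s (suc e) _) (≡.cong (s ℕ.+_) (≡.trans (≡.sym (ℕₚ.+-assoc (suc e) (suc d) (n ℕ.* 5)))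
      (≡.cong (ℕ._+ n ℕ.* 5) (≡.trans (ℕₚ.+-suc (suc e) d) (≡.cong (λ m → suc (suc m)) eq)))))

  module _ {f V₀ V₁ V₂ V₃ V₄ : Series} (f≈ : f ≈ up V₀ + X ^ 1 * up V₁ + X ^ 2 * up V₂ + X ^ 3 * up V₃ + X ^ 4 * up V₄) where
    component₁ : ∀ n → f (1 ℕ.+ n ℕ.* 5) R.≈ V₁ n
    component₁ n = R.trans (at f≈ (1 ℕ.+ n ℕ.* 5)) (R.trans
      (R.+-cong (R.+-cong (R.+-cong (R.+-cong (up-nonmultiple V₀ 0 n (s≤s z≤n)) (R.trans (X^*-≥ 1 (up V₁) (n ℕ.* 5)) (up-multiple V₁ n)))
        (above 1 0 3 n V₂ ≡.refl)) (above 1 1 2 n V₃ ≡.refl)) (above 1 2 1 n V₄ ≡.refl))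
      (R.trans (R.+-identityʳ _) (R.trans (R.+-identityʳ _) (R.trans (R.+-identityʳ _) (R.+-identityˡ _)))))

    component₂ : ∀ n → f (2 ℕ.+ n ℕ.* 5) R.≈ V₂ n
    component₂ n = R.trans (at f≈ (2 ℕ.+ n ℕ.* 5)) (R.trans
      (R.+-cong (R.+-cong (R.+-cong (R.+-cong (up-nonmultiple V₀ 1 n (s≤s (s≤s z≤n))) (below 1 0 n V₁ (s≤s z≤n)))
        (R.trans (X^*-≥ 2 (up V₂) (n ℕ.* 5)) (up-multiple V₂ n))) (above 2 0 3 n V₃ ≡.refl)) (above 2 1 2 n V₄ ≡.refl))
      (R.trans (R.+-identityʳ _) (R.trans (R.+-identityʳ _) (R.trans (R.+-congʳ (R.+-identityˡ _)) (R.+-identityˡ _)))))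

    component₃ : ∀ n → f (3 ℕ.+ n ℕ.* 5) R.≈ V₃ n
    component₃ n = R.trans (at f≈ (3 ℕ.+ n ℕ.* 5)) (R.trans
      (R.+-cong (R.+-cong (R.+-cong (R.+-cong (up-nonmultiple V₀ 2 n (s≤s (s≤s (s≤s z≤n)))) (below 1 1 n V₁ (s≤s (s≤s z≤n))))
        (below 2 0 n V₂ (s≤s z≤n))) (R.trans (X^*-≥ 3 (up V₃) (n ℕ.* 5)) (up-multiple V₃ n))) (above 3 0 3 n V₄ ≡.refl))
      (R.trans (R.+-identityʳ _) (R.trans (R.+-congʳ (R.trans (R.+-congʳ (R.+-identityˡ _)) (R.+-identityˡ _))) (R.+-identityˡ _))))

    component₄ : ∀ n → f (4 ℕ.+ n ℕ.* 5) R.≈ V₄ n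
    component₄ n = R.trans (at f≈ (4 ℕ.+ n ℕ.* 5)) (R.trans
      (R.+-cong (R.+-cong (R.+-cong (R.+-cong (up-nonmultiple V₀ 3 n (s≤s (s≤s (s≤s (s≤s z≤n))))) (below 1 2 n V₁ (s≤s (s≤s (s≤s z≤n)))))
        (below 2 1 n V₂ (s≤s (s≤s z≤n)))) (below 3 0 n V₃ (s≤s z≤n))) (R.trans (X^*-≥ 4 (up V₄) (n ℕ.* 5)) (up-multiple V₄ n)))
      (R.trans (R.+-congʳ (R.trans (R.+-identityʳ _) (R.trans (R.+-identityʳ _) (R.+-identityʳ _)))) (R.+-identityˡ _)))

-- Coefficientwise positivity

module Positivity {c ℓ} (R : CommutativeRing c ℓ) (ι : IntegerMap R) where
  private module R = CommutativeRing R
  private module ι = _-Raw-AlmostCommutative⟶_ ι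
  open SeriesCalculus R ι

  -- `R` carries no order, since it will be ℤ[ζ]; a sign is witnessed by a natural number mapped
  -- through `ι`.
  Nonneg Pos : R.Carrier → Set ℓ
  Nonneg r = Σ ℕ λ k → r R.≈ ι.⟦ + k ⟧
  Pos r = Σ ℕ λ k → r R.≈ ι.⟦ + suc k ⟧

  Pos⇒Nonneg : ∀ {r} → Pos r → Nonneg r
  Pos⇒Nonneg (k , p) = suc k , p

  Pos-resp : ∀ {r s} → r R.≈ s → Pos s → Pos r
  Pos-resp p (k , q) = k , R.trans p q

  Nonneg-+ : ∀ {r s} → Nonneg r → Nonneg s → Nonneg (r R.+ s)
  Nonneg-+ (j , p) (k , q) = j ℕ.+ k , R.trans (R.+-cong p q) (R.sym (ι.+-homo (+ j) (+ k)))

  Pos-+ : ∀ {r s} → Pos r → Nonneg s → Pos (r R.+ s)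
  Pos-+ (j , p) (k , q) = j ℕ.+ k , R.trans (R.+-cong p q) (R.sym (ι.+-homo (+ suc j) (+ k)))

  Nonneg-* : ∀ {r s} → Nonneg r → Nonneg s → Nonneg (r R.* s)
  Nonneg-* (j , p) (k , q) = j ℕ.* k , R.trans (R.*-cong p q)
    (R.trans (R.sym (ι.*-homo (+ j) (+ k))) (R.reflexive (≡.cong ι.⟦_⟧ (≡.sym (ℤₚ.pos-* j k)))))

  Pos-* : ∀ {r s} → Pos r → Pos s → Pos (r R.* s)
  Pos-* (j , p) (k , q) = k ℕ.+ j ℕ.* suc k , R.trans (R.*-cong p q)
    (R.trans (R.sym (ι.*-homo (+ suc j) (+ suc k))) (R.reflexive (≡.cong ι.⟦_⟧ (≡.sym (ℤₚ.pos-* (suc j) (suc k))))))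

  Nonneg-0 : Nonneg R.0#
  Nonneg-0 = 0 , R.sym ι.0-homo

  Pos-1 : Pos R.1#
  Pos-1 = 0 , R.sym ι.1-homo

  -- Records rather than functions, so that the series can be inferred.
  record NonnegS (f : Series) : Set ℓ where
    constructor mkN
    field coeffN : ∀ n → Nonneg (f n)
  open NonnegS public

  record PosS (f : Series) : Set ℓ where
    constructor mkP
    field coeffP : ∀ n → Pos (f n)
  open PosS public

  NonnegS-resp : ∀ {f g} → f ≈ g → NonnegS g → NonnegS f
  NonnegS-resp p N = mkN λ n → proj₁ (coeffN N n) , R.trans (at p n) (proj₂ (coeffN N n))

  PosS-resp : ∀ {f g} → f ≈ g → PosS g → PosS f
  PosS-resp p N = mkP λ n → Pos-resp (at p n) (coeffP N n)

  PosS⇒NonnegS : ∀ {f} → PosS f → NonnegS f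
  PosS⇒NonnegS P = mkN λ n → Pos⇒Nonneg (coeffP P n)

  NonnegS-+ : ∀ {f g} → NonnegS f → NonnegS g → NonnegS (f + g)
  NonnegS-+ F G = mkN λ n → Nonneg-+ (coeffN F n) (coeffN G n)

  PosS-+ : ∀ {f g} → PosS f → NonnegS g → PosS (f + g)
  PosS-+ F G = mkP λ n → Pos-+ (coeffP F n) (coeffN G n)

  NonnegS-* : ∀ {f g} → NonnegS f → NonnegS g → NonnegS (f * g)
  NonnegS-* {f} {g} F G = mkN (go F)
    where
    go : ∀ {f} → NonnegS f → ∀ n → Nonneg ((f * g) n)
    go F zero    = Nonneg-* (coeffN F 0) (coeffN G 0)
    go F (suc n) = Nonneg-+ (Nonneg-* (coeffN F 0) (coeffN G (suc n))) (go (mkN λ i → coeffN F (suc i)) n)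

  NonnegS-0 : NonnegS 0#
  NonnegS-0 = mkN λ _ → Nonneg-0

  NonnegS-1 : NonnegS 1#
  NonnegS-1 = mkN λ { zero → Pos⇒Nonneg Pos-1 ; (suc n) → Nonneg-0 }

  NonnegS-X : NonnegS X
  NonnegS-X = mkN λ { zero → Nonneg-0 ; (suc n) → coeffN NonnegS-1 n }

  NonnegS-^ : ∀ {f} → NonnegS f → ∀ k → NonnegS (f ^ k)
  NonnegS-^ F zero    = NonnegS-1
  NonnegS-^ F (suc k) = NonnegS-* F (NonnegS-^ F k)

  NonnegS-int : ∀ k → NonnegS (int (+ k))
  NonnegS-int k = NonnegS-resp (int≈ι (+ k)) (mkN λ { zero → k , R.refl ; (suc n) → Nonneg-0 })

  NonnegS-∏ : ∀ {F} → (∀ j → NonnegS (F j)) → ∀ n → NonnegS (∏ n F)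
  NonnegS-∏ N zero    = NonnegS-1
  NonnegS-∏ N (suc n) = NonnegS-* (NonnegS-∏ N n) (N n)

  NonnegS-∏∞ : ∀ {F} → (∀ j → NonnegS (F j)) → NonnegS (∏∞ F)
  NonnegS-∏∞ N = mkN λ n → coeffN (NonnegS-∏ N (suc n)) n

  -- The factors that preserve strict positivity: the constant term 1 already reproduces every
  -- coefficient of the other factor, and the remaining terms only add to it.
  record Dominant (f : Series) : Set ℓ where
    constructor _&_
    field
      nonneg   : NonnegS f
      constant : f ≡[ 1 ] 1#
  open Dominant public

  Dominant-1 : Dominant 1#
  Dominant-1 = NonnegS-1 & ≡[]-refl

  Dominant-* : ∀ {f g} → Dominant f → Dominant g → Dominant (f * g)
  Dominant-* F G = NonnegS-* (nonneg F) (nonneg G) & ≡[]-trans (≡[]-* (constant F) (constant G)) (≈⇒≡[] (*-identityˡ 1#))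

  Dominant-^ : ∀ {f} → Dominant f → ∀ k → Dominant (f ^ k)
  Dominant-^ F zero    = Dominant-1
  Dominant-^ F (suc k) = Dominant-* F (Dominant-^ F k)

  PosS-* : ∀ {f g} → PosS f → Dominant g → PosS (f * g)
  PosS-* {f} {g} F G = PosS-resp (*-comm f g) (mkP λ
    { zero    → Pos-* g₀ (coeffP F 0)
    ; (suc n) → Pos-+ (Pos-* g₀ (coeffP F (suc n))) (coeffN (NonnegS-* (mkN λ i → coeffN (nonneg G) (suc i)) (PosS⇒NonnegS F)) n) })
    where
    g₀ : Pos (g 0)
    g₀ = Pos-resp (at< (constant G) 0 (s≤s z≤n)) Pos-1

  PosS-int* : ∀ k {f} → PosS f → PosS (int (+ suc k) * f)
  PosS-int* k {f} F = mkP λ n → Pos-resp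
    (R.trans (at (*-congʳ (int≈ι (+ suc k))) n) (⊗-const _ f n)) (Pos-* (k , R.refl) (coeffP F n))

  PosS-1+X* : ∀ {f} → PosS f → PosS (1# + X * f)
  PosS-1+X* {f} F = mkP λ
    { zero    → Pos-resp (R.trans (R.+-congˡ (X*-zero f)) (R.+-identityʳ _)) Pos-1
    ; (suc n) → Pos-resp (R.trans (R.+-identityˡ _) (X*-suc f n)) (coeffP F n) }

  -- The series 1/(1 - q^m), written with the same Boolean test as `invOneMinusQ^` so that the
  -- transfer is coefficientwise.
  geo : ℕ → Series
  geo m n = if ⌊ m ∣? n ⌋ then R.1# else R.0#

  geo-yes : ∀ {m n} → m ∣ n → geo m n R.≈ R.1#
  geo-yes {m} {n} d with m ∣? n
  ... | yes _ = R.refl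
  ... | no ¬d = ⊥-elim (¬d d)

  geo-no : ∀ {m n} → ¬ m ∣ n → geo m n R.≈ R.0#
  geo-no {m} {n} ¬d with m ∣? n
  ... | yes d = ⊥-elim (¬d d)
  ... | no _  = R.refl

  geo≡1 : ∀ m → geo m ≡[ m ] 1#
  geo≡1 m = mk≡ λ
    { zero    _   → geo-yes (m ∣0)
    ; (suc i) i<m → geo-no (λ d → ℕₚ.<⇒≱ i<m (∣⇒≤ d)) }

  geo-shift : ∀ m n → geo m (m ℕ.+ n) R.≈ geo m n
  geo-shift m n with m ∣? n
  ... | yes d = geo-yes (∣m∣n⇒∣m+n ∣-refl d)
  ... | no ¬d = geo-no (λ d → ¬d (∣m+n∣m⇒∣n d ∣-refl))

  geo-inverse : ∀ m → (1# - X ^ suc m) * geo (suc m) ≈ 1#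
  geo-inverse m = trans (solve 2 (λ x f → (con (+ 1) :- x) :* f := f :- x :* f) refl (X ^ k) f) (mk≋ coefficient)
    where
    k : ℕ
    k = suc m
    f : Series
    f = geo k
    coefficient : ∀ n → (f - X ^ k * f) n R.≈ 1# n
    coefficient n with n ℕₚ.<? k
    ... | yes n<k = at< (≡[]-trans (≡[]-+ (geo≡1 k) (≡[]-neg (≡[]-trans (≈⇒≡[] (*-comm (X ^ k) f)) (vanish-*ˡ f (vanish-^ X≡[1]0 k)))))
                          (≈⇒≡[] (solve 0 (con (+ 1) :- con (+ 0) := con (+ 1)) refl))) n n<k
    ... | no n≮k = ≡.subst (λ i → (f - X ^ k * f) i R.≈ 1# i) (ℕₚ.m+[n∸m]≡n (ℕₚ.≮⇒≥ n≮k))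
      (R.trans (R.+-cong (geo-shift k (n ℕ.∸ k)) (R.-‿cong (X^*-≥ k f (n ℕ.∸ k)))) (R.-‿inverseʳ _))

  geo-Dominant : ∀ m → Dominant (geo (suc m))
  geo-Dominant m = mkN go & ≡[]-weaken (s≤s z≤n) (geo≡1 (suc m))
    where
    go : ∀ n → Nonneg (geo (suc m) n)
    go n with suc m ∣? n
    ... | yes _ = Pos⇒Nonneg Pos-1
    ... | no _  = Nonneg-0

  geo₁-PosS : PosS (geo 1)
  geo₁-PosS = mkP λ n → Pos-resp (geo-yes (1∣ n)) Pos-1

-- Signs of the four components

module RogersRamanujanSigns {c ℓ} (R : CommutativeRing c ℓ) (ι : IntegerMap R) (root : PrimitiveFifthRoot R ι) where
  private module R = CommutativeRing R
  open SeriesCalculus R ι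
  open Positivity R ι
  open Substitutions R ι using (up)
  open ProductIdentities R ι using (α; β; Q⁵; Q⁵₀)
  open JacobiTripleProduct R ι using (theta∏; theta-convergent₁)
  open RogersRamanujanIdentities R ι root using (ramanujan)
  open Dissection R ι root
  open import Relation.Binary.Reasoning.Setoid setoid

  poch ipoch : ℕ → Series
  poch a = ∏∞ (λ j → 1# - X ^ (a ℕ.+ 5 ℕ.* j))
  ipoch a = ∏∞ (λ j → geo (a ℕ.+ 5 ℕ.* j))

  poch-convergent : ∀ a → Convergent (λ j → 1# - X ^ (a ℕ.+ 5 ℕ.* j))
  poch-convergent a j = 1-vanish (≡[]-weaken (ℕₚ.≤-trans (ℕₚ.m≤n*m j 5) (ℕₚ.m≤n+m _ a)) (vanish-^ X≡[1]0 (a ℕ.+ 5 ℕ.* j)))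

  ipoch-convergent : ∀ a → Convergent (λ j → geo (a ℕ.+ 5 ℕ.* j))
  ipoch-convergent a j = ≡[]-weaken (ℕₚ.≤-trans (ℕₚ.m≤n*m j 5) (ℕₚ.m≤n+m _ a)) (geo≡1 (a ℕ.+ 5 ℕ.* j))

  poch*ipoch : ∀ a → poch (suc a) * ipoch (suc a) ≈ 1#
  poch*ipoch a = trans (sym (∏∞-* (poch-convergent (suc a)) (ipoch-convergent (suc a))))
    (trans (∏∞-cong λ j → geo-inverse (a ℕ.+ 5 ℕ.* j)) (∏∞-^ {λ _ → 1#} (λ j → ≡[]-refl) 0))

  theta-poch : ∀ a b → theta∏ (- X ^ a) (- X ^ b) Q⁵ ≈ poch a * poch b
  theta-poch a b = trans (∏∞-* (theta-convergent₁ Q⁵₀ _) (theta-convergent₁ Q⁵₀ _)) (*-cong (one a) (one b))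
    where
    one : ∀ a → ∏∞ (λ j → 1# + - X ^ a * Q⁵ ^ j) ≈ poch a
    one a = ∏∞-cong λ j → +-congˡ (trans (solve 2 (λ x y → (:- x) :* y := :- (x :* y)) refl (X ^ a) (Q⁵ ^ j))
      (-‿cong (trans (*-congˡ (^-assocʳ X 5 j)) (sym (^-homo-* X a (5 ℕ.* j))))))

  G H : Series
  G = ipoch 1 * ipoch 4
  H = ipoch 2 * ipoch 3

  αG : α * G ≈ 1#
  αG = trans (*-congʳ (theta-poch 4 1)) (trans (solve 4 (λ a b x y → a :* b :* (x :* y) := (b :* x) :* (a :* y)) refl _ _ _ _)
    (trans (*-cong (poch*ipoch 0) (poch*ipoch 3)) (*-identityˡ 1#)))

  βH : β * H ≈ 1#
  βH = trans (*-congʳ (theta-poch 3 2)) (trans (solve 4 (λ a b x y → a :* b :* (x :* y) := (b :* x) :* (a :* y)) refl _ _ _ _)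
    (trans (*-cong (poch*ipoch 1) (poch*ipoch 2)) (*-identityˡ 1#)))

  -- The factors of `G` and `H` are paired so that the exponents in `g j` and `h j` have the same
  -- sum 10j + 5; this lets the difference of two pairs factor in `factor-difference`.
  g h g′ h′ : ℕ → Series
  g j = geo (1 ℕ.+ 5 ℕ.* j) * geo (4 ℕ.+ 5 ℕ.* j)
  h j = geo (2 ℕ.+ 5 ℕ.* j) * geo (3 ℕ.+ 5 ℕ.* j)
  g′ j = g (suc j)
  h′ j = h (suc j)

  G′ H′ J J₂ J₃ J₄ : Series
  G′ = ∏∞ g′
  H′ = ∏∞ h′
  J = geo 1
  J₂ = geo 2
  J₃ = geo 3
  J₄ = geo 4

  g-convergent : Convergent g
  g-convergent = Convergent-* (ipoch-convergent 1) (ipoch-convergent 4)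

  h-convergent : Convergent h
  h-convergent = Convergent-* (ipoch-convergent 2) (ipoch-convergent 3)

  G≈JJ₄G′ : G ≈ J * (J₄ * G′)
  G≈JJ₄G′ = trans (sym (∏∞-* (ipoch-convergent 1) (ipoch-convergent 4))) (trans (∏∞-head g-convergent) (*-assoc J J₄ G′))

  H≈J₂J₃H′ : H ≈ J₂ * (J₃ * H′)
  H≈J₂J₃H′ = trans (sym (∏∞-* (ipoch-convergent 2) (ipoch-convergent 3))) (trans (∏∞-head h-convergent) (*-assoc J₂ J₃ H′))

  shrink : ∀ {x y u v} → (1# - x) * u ≈ 1# → (1# - y) * v ≈ 1# → ∀ p → (1# - x) * p ≈ 1# - y → u ≈ p * v
  shrink {x} {y} {u} {v} xu yv p xp = begin
    u                     ≈⟨ *-identityʳ u ⟨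
    u * 1#                ≈⟨ *-congˡ (trans (*-congʳ xp) yv) ⟨
    u * ((1# - x) * p * v) ≈⟨ solve 4 (λ u x p v → u :* (x :* p :* v) := (x :* u) :* (p :* v)) refl u (1# - x) p v ⟩
    ((1# - x) * u) * (p * v) ≈⟨ *-congʳ xu ⟩
    1# * (p * v)          ≈⟨ *-identityˡ _ ⟩
    p * v                 ∎

  -- γ = (1 - q³)/(1 - q) and η = (1 - q⁴)/(1 - q²). They bring the first factors of `G` and `H` to
  -- the common denominator (1 - q³)(1 - q⁴).
  γ η : Series
  γ = 1# + X + X ^ 2
  η = 1# + X ^ 2

  J≈γJ₃ : J ≈ γ * J₃
  J≈γJ₃ = shrink (geo-inverse 0) (geo-inverse 2) γ
    (solve 1 (λ x → (con (+ 1) :- x :^ 1) :* (con (+ 1) :+ x :+ x :^ 2) := con (+ 1) :- x :^ 3) refl X)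

  J₂≈ηJ₄ : J₂ ≈ η * J₄
  J₂≈ηJ₄ = shrink (geo-inverse 1) (geo-inverse 3) η
    (solve 1 (λ x → (con (+ 1) :- x :^ 2) :* (con (+ 1) :+ x :^ 2) := con (+ 1) :- x :^ 4) refl X)

  G′-Dominant : Dominant G′
  G′-Dominant = NonnegS-∏∞ (λ j → nonneg (Dominant-* (geo-Dominant (5 ℕ.* suc j)) (geo-Dominant (3 ℕ.+ 5 ℕ.* suc j))))
    & ∏∞≡[1] (≡[]-weaken (s≤s z≤n) (g-convergent 1))

  H′-Dominant : Dominant H′
  H′-Dominant = NonnegS-∏∞ (λ j → nonneg (Dominant-* (geo-Dominant (1 ℕ.+ 5 ℕ.* suc j)) (geo-Dominant (2 ℕ.+ 5 ℕ.* suc j))))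
    & ∏∞≡[1] (≡[]-weaken (s≤s z≤n) (h-convergent 1))

  Dominant-resp : ∀ {f g} → f ≈ g → Dominant g → Dominant f
  Dominant-resp p F = NonnegS-resp p (nonneg F) & ≡[]-trans (≈⇒≡[] p) (constant F)

  G-PosS : PosS G
  G-PosS = PosS-resp G≈JJ₄G′ (PosS-* geo₁-PosS (Dominant-* (geo-Dominant 3) G′-Dominant))

  G-Dominant : Dominant G
  G-Dominant = Dominant-resp G≈JJ₄G′ (Dominant-* (geo-Dominant 0) (Dominant-* (geo-Dominant 3) G′-Dominant))

  H-Dominant : Dominant H
  H-Dominant = Dominant-resp H≈J₂J₃H′ (Dominant-* (geo-Dominant 1) (Dominant-* (geo-Dominant 2) H′-Dominant))

  W-PosS : ∀ i l → PosS (G ^ suc i * H ^ l)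
  W-PosS i l = PosS-* (PosS-* G-PosS (Dominant-^ G-Dominant i)) (Dominant-^ H-Dominant l)

  -- (1 - q^(m+1))(1 - q^(m+2)) - (1 - q^m)(1 - q^(m+3)) = q^m (1 - q)(1 - q²)
  factor-difference : ∀ m → NonnegS (J * J₂ * (geo (suc m) * geo (4 ℕ.+ m) - geo (2 ℕ.+ m) * geo (3 ℕ.+ m)))
  factor-difference m = NonnegS-resp eq
    (NonnegS-* (NonnegS-^ NonnegS-X (suc m)) (NonnegS-* (NonnegS-* (nonneg (geo-Dominant m)) (nonneg (geo-Dominant (3 ℕ.+ m))))
      (NonnegS-* (nonneg (geo-Dominant (1 ℕ.+ m))) (nonneg (geo-Dominant (2 ℕ.+ m))))))
    where
    a b c′ d y : Series
    a = geo (suc m)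
    b = geo (2 ℕ.+ m)
    c′ = geo (3 ℕ.+ m)
    d = geo (4 ℕ.+ m)
    y = X ^ suc m
    eq : J * J₂ * (a * d - b * c′) ≈ y * ((a * d) * (b * c′))
    eq = begin
      J * J₂ * (a * d - b * c′)
        ≈⟨ *-congˡ (+-cong
             (trans (solve 1 (λ x → x := x :* (con (+ 1) :* con (+ 1))) refl (a * d)) (*-congˡ (*-cong (sym (geo-inverse (suc m))) (sym (geo-inverse (2 ℕ.+ m))))))
             (-‿cong (trans (solve 1 (λ x → x := x :* (con (+ 1) :* con (+ 1))) refl (b * c′)) (*-congˡ (*-cong (sym (geo-inverse m)) (sym (geo-inverse (3 ℕ.+ m)))))))) ⟩
      J * J₂ * (a * d * (((1# - X * y) * b) * ((1# - X * (X * y)) * c′)) - b * c′ * (((1# - y) * a) * ((1# - X * (X * (X * y))) * d)))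
        ≈⟨ solve 8 (λ j j₂ x y a b c d → j :* j₂ :* (a :* d :* (((con (+ 1) :- x :* y) :* b) :* ((con (+ 1) :- x :* (x :* y)) :* c))
                 :- b :* c :* (((con (+ 1) :- y) :* a) :* ((con (+ 1) :- x :* (x :* (x :* y))) :* d)))
               := ((con (+ 1) :- x :^ 1) :* j) :* ((con (+ 1) :- x :^ 2) :* j₂) :* (y :* ((a :* d) :* (b :* c)))) refl J J₂ X y a b c′ d ⟩
      ((1# - X ^ 1) * J) * ((1# - X ^ 2) * J₂) * (y * ((a * d) * (b * c′)))
        ≈⟨ trans (*-congʳ (trans (*-cong (geo-inverse 0) (geo-inverse 1)) (*-identityˡ 1#))) (*-identityˡ _) ⟩
      y * ((a * d) * (b * c′)) ∎

  -- The difference of finite products telescopes by p a - q b = (p - q) a + q (a - b), with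
  -- `factor-difference` for each new pair; truncation passes to the limit.
  G′-H′ : NonnegS (J * J₂ * (G′ - H′))
  G′-H′ = mkN λ n → let k , p = coeffN (finite (suc n)) n in k , R.trans (at< (truncate (suc n)) n ℕₚ.≤-refl) p
    where
    finite : ∀ n → NonnegS (J * J₂ * (∏ n g′ - ∏ n h′))
    finite zero    = NonnegS-resp (trans (*-congˡ (-‿inverseʳ 1#)) (zeroʳ _)) NonnegS-0
    finite (suc n) = NonnegS-resp
      (solve 5 (λ j p q a b → j :* (p :* a :- q :* b) := j :* (p :- q) :* a :+ q :* (j :* (a :- b))) refl (J * J₂) (∏ n g′) (∏ n h′) (g′ n) (h′ n))
      (NonnegS-+ (NonnegS-* (finite n) (NonnegS-* (nonneg (geo-Dominant (5 ℕ.* suc n))) (nonneg (geo-Dominant (3 ℕ.+ 5 ℕ.* suc n)))))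
        (NonnegS-* (NonnegS-∏ (λ j → NonnegS-* (nonneg (geo-Dominant (1 ℕ.+ 5 ℕ.* suc j))) (nonneg (geo-Dominant (2 ℕ.+ 5 ℕ.* suc j)))) n)
          (factor-difference (5 ℕ.* suc n))))

    truncate : ∀ n → J * J₂ * (G′ - H′) ≡[ n ] J * J₂ * (∏ n g′ - ∏ n h′)
    truncate n = ≡[]-* ≡[]-refl (≡[]-+ (∏∞-∏ (λ j → ≡[]-weaken (ℕₚ.n≤1+n j) (g-convergent (suc j))) ℕₚ.≤-refl)
      (≡[]-neg (∏∞-∏ (λ j → ≡[]-weaken (ℕₚ.n≤1+n j) (h-convergent (suc j))) ℕₚ.≤-refl)))

  T : Series
  T = G ^ 5 - int (+ 3) * (X * H ^ 5)

  T≡[1]1 : T ≡[ 1 ] 1#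
  T≡[1]1 = ≡[]-trans (≡[]-+ (constant (Dominant-^ G-Dominant 5))
      (≡[]-neg (vanish-*ˡ (int (+ 3)) (≡[]-trans (≈⇒≡[] (*-comm X (H ^ 5))) (vanish-*ˡ (H ^ 5) X≡[1]0)))))
    (≈⇒≡[] (solve 0 (con (+ 1) :- con (+ 0) := con (+ 1)) refl))

  -- The partial sums of the coefficients of (1 + q + q²)^5 - 3q(1 + q²)^5.
  S₁₀ : Series
  S₁₀ = 1# + int (+ 3) * X + int (+ 18) * X ^ 2 + int (+ 33) * X ^ 3 + int (+ 78) * X ^ 4 + int (+ 99) * X ^ 5 + int (+ 144) * X ^ 6
    + int (+ 144) * X ^ 7 + int (+ 159) * X ^ 8 + int (+ 149) * X ^ 9 + int (+ 150) * X ^ 10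

  S₁₀-NonnegS : NonnegS S₁₀
  S₁₀-NonnegS = NonnegS-+ (NonnegS-+ (NonnegS-+ (NonnegS-+ (NonnegS-+ (NonnegS-+ (NonnegS-+ (NonnegS-+ (NonnegS-+ (NonnegS-+ NonnegS-1
      (NonnegS-* (NonnegS-int 3) NonnegS-X)) (t 18 2)) (t 33 3)) (t 78 4)) (t 99 5)) (t 144 6)) (t 144 7)) (t 159 8)) (t 149 9)) (t 150 10)
    where
    t : ∀ a k → NonnegS (int (+ a) * X ^ k)
    t a k = NonnegS-* (NonnegS-int a) (NonnegS-^ NonnegS-X k)

  -- With G = γKG′ and H = ηKH′, T is K⁵ times γ⁵(G′⁵ - H′⁵) + H′⁵(γ⁵ - 3qη⁵). The factor `J * J₂`
  -- makes the first summand nonnegative through `G′-H′`; in the second, `J` alone produces the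
  -- partial sums of the polynomial.
  JJ₂T-Dominant : Dominant (J * J₂ * T)
  JJ₂T-Dominant = NonnegS-resp eq
      (NonnegS-+ (NonnegS-* (NonnegS-* (NonnegS-^ γ-N 5) (NonnegS-^ K-N 5)) (NonnegS-* G′-H′ quotient-N))
        (NonnegS-* (NonnegS-* (NonnegS-* (NonnegS-^ K-N 5) (NonnegS-^ (nonneg H′-Dominant) 5)) (nonneg (geo-Dominant 1)))
          (NonnegS-+ S₁₀-NonnegS (NonnegS-* (NonnegS-int 147) (NonnegS-* (NonnegS-^ NonnegS-X 11) (nonneg (geo-Dominant 0)))))))
    & ≡[]-trans (≡[]-* (constant (Dominant-* (geo-Dominant 0) (geo-Dominant 1))) T≡[1]1) (≈⇒≡[] (*-identityˡ 1#))
    where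
    K quotient′ : Series
    K = J₃ * J₄
    quotient′ = G′ ^ 4 + G′ ^ 3 * H′ + G′ ^ 2 * H′ ^ 2 + G′ * H′ ^ 3 + H′ ^ 4

    K-N : NonnegS K
    K-N = NonnegS-* (nonneg (geo-Dominant 2)) (nonneg (geo-Dominant 3))

    γ-N : NonnegS γ
    γ-N = NonnegS-+ (NonnegS-+ NonnegS-1 NonnegS-X) (NonnegS-^ NonnegS-X 2)

    quotient-N : NonnegS quotient′
    quotient-N = NonnegS-+ (NonnegS-+ (NonnegS-+ (NonnegS-+ (NonnegS-^ G′-N 4) (NonnegS-* (NonnegS-^ G′-N 3) H′-N))
      (NonnegS-* (NonnegS-^ G′-N 2) (NonnegS-^ H′-N 2))) (NonnegS-* G′-N (NonnegS-^ H′-N 3))) (NonnegS-^ H′-N 4)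
      where
      G′-N = nonneg G′-Dominant
      H′-N = nonneg H′-Dominant

    G≈γKG′ : G ≈ γ * (K * G′)
    G≈γKG′ = trans G≈JJ₄G′ (trans (*-congʳ J≈γJ₃) (solve 4 (λ g a b x → g :* a :* (b :* x) := g :* (a :* b :* x)) refl γ J₃ J₄ G′))

    H≈ηKH′ : H ≈ η * (K * H′)
    H≈ηKH′ = trans H≈J₂J₃H′ (trans (*-congʳ J₂≈ηJ₄) (solve 4 (λ g a b x → g :* b :* (a :* x) := g :* (a :* b :* x)) refl η J₃ J₄ H′))

    -- Division with remainder by 1 - q, continued through degree 10. The constant 147 = 3⁵ - 3·2⁵
    -- is the value of the polynomial at q = 1, at which the partial sums stay from degree 11 on.
    polynomial : γ ^ 5 - int (+ 3) * (X * η ^ 5) ≈ (1# - X ^ 1) * S₁₀ + int (+ 147) * X ^ 11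
    polynomial = solve 1 (λ x → (con (+ 1) :+ x :+ x :^ 2) :^ 5 :- con (+ 3) :* (x :* (con (+ 1) :+ x :^ 2) :^ 5)
      := (con (+ 1) :- x :^ 1) :* (con (+ 1) :+ con (+ 3) :* x :+ con (+ 18) :* x :^ 2 :+ con (+ 33) :* x :^ 3 :+ con (+ 78) :* x :^ 4 :+ con (+ 99) :* x :^ 5
           :+ con (+ 144) :* x :^ 6 :+ con (+ 144) :* x :^ 7 :+ con (+ 159) :* x :^ 8 :+ con (+ 149) :* x :^ 9 :+ con (+ 150) :* x :^ 10)
         :+ con (+ 147) :* x :^ 11) refl X

    eq : J * J₂ * T ≈ γ ^ 5 * K ^ 5 * (J * J₂ * (G′ - H′) * quotient′) + K ^ 5 * H′ ^ 5 * J₂ * (S₁₀ + int (+ 147) * (X ^ 11 * J))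
    eq = begin
      J * J₂ * T
        ≈⟨ *-congˡ (+-cong (^-congˡ 5 G≈γKG′) (-‿cong (*-congˡ (*-congˡ (^-congˡ 5 H≈ηKH′))))) ⟩
      J * J₂ * ((γ * (K * G′)) ^ 5 - int (+ 3) * (X * (η * (K * H′)) ^ 5))
        ≈⟨ solve 8 (λ j j₂ γ η x k g h → j :* j₂ :* ((γ :* (k :* g)) :^ 5 :- con (+ 3) :* (x :* (η :* (k :* h)) :^ 5))
             := γ :^ 5 :* k :^ 5 :* (j :* j₂ :* (g :- h) :* (g :^ 4 :+ g :^ 3 :* h :+ g :^ 2 :* h :^ 2 :+ g :* h :^ 3 :+ h :^ 4))
                :+ k :^ 5 :* h :^ 5 :* j₂ :* (j :* (γ :^ 5 :- con (+ 3) :* (x :* η :^ 5)))) refl J J₂ γ η X K G′ H′ ⟩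
      γ ^ 5 * K ^ 5 * (J * J₂ * (G′ - H′) * quotient′) + K ^ 5 * H′ ^ 5 * J₂ * (J * (γ ^ 5 - int (+ 3) * (X * η ^ 5)))
        ≈⟨ +-congˡ (*-congˡ (begin
             J * (γ ^ 5 - int (+ 3) * (X * η ^ 5))
               ≈⟨ *-congˡ polynomial ⟩
             J * ((1# - X ^ 1) * S₁₀ + int (+ 147) * X ^ 11)
               ≈⟨ solve 5 (λ j u s c y → j :* (u :* s :+ c :* y) := (u :* j) :* s :+ c :* (y :* j)) refl J (1# - X ^ 1) S₁₀ (int (+ 147)) (X ^ 11) ⟩
             ((1# - X ^ 1) * J) * S₁₀ + int (+ 147) * (X ^ 11 * J)
               ≈⟨ +-congʳ (trans (*-congʳ (geo-inverse 0)) (*-identityˡ S₁₀)) ⟩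
             S₁₀ + int (+ 147) * (X ^ 11 * J) ∎)) ⟩
      γ ^ 5 * K ^ 5 * (J * J₂ * (G′ - H′) * quotient′) + K ^ 5 * H′ ^ 5 * J₂ * (S₁₀ + int (+ 147) * (X ^ 11 * J)) ∎

  -- Two factors `G` and one `H` are required: one `J` and one `J₂` are spent on making T
  -- nonnegative, and the second `J`, all of whose coefficients are 1, makes the product strictly
  -- positive.
  WT-PosS : ∀ a b → PosS (G ^ (2 ℕ.+ a) * H ^ suc b * T)
  WT-PosS a b = PosS-resp eq (PosS-* geo₁-PosS
    (Dominant-* (Dominant-* (Dominant-* (Dominant-^ (geo-Dominant 0) a) (Dominant-^ G₁ (2 ℕ.+ a)))
      (Dominant-* (Dominant-^ (geo-Dominant 1) b) (Dominant-^ H₁ (suc b)))) JJ₂T-Dominant))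
    where
    G₁ : Dominant (J₄ * G′)
    G₁ = Dominant-* (geo-Dominant 3) G′-Dominant
    H₁ : Dominant (J₃ * H′)
    H₁ = Dominant-* (geo-Dominant 2) H′-Dominant
    eq : G ^ (2 ℕ.+ a) * H ^ suc b * T ≈ J * (J ^ a * (J₄ * G′) ^ (2 ℕ.+ a) * (J₂ ^ b * (J₃ * H′) ^ suc b) * (J * J₂ * T))
    eq = trans (*-congʳ (*-cong (trans (^-congˡ (2 ℕ.+ a) G≈JJ₄G′) (^-distrib-* J (J₄ * G′) (2 ℕ.+ a)))
                                (trans (^-congˡ (suc b) H≈J₂J₃H′) (^-distrib-* J₂ (J₃ * H′) (suc b)))))
      (solve 7 (λ j ja g j₂ jb h t → (j :* (j :* ja)) :* g :* ((j₂ :* jb) :* h) :* t := j :* (ja :* g :* (jb :* h) :* (j :* j₂ :* t))) refl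
        J (J ^ a) ((J₄ * G′) ^ (2 ℕ.+ a)) J₂ (J₂ ^ b) ((J₃ * H′) ^ suc b) T)

  V₁-PosS : PosS (V₁ αG βH)
  V₁-PosS = PosS-resp (begin
    int (+ 5) * (G ^ 11 * H ^ 1) + int (ℤ.- + 40) * (X * (G ^ 6 * H ^ 6))
      -- Ramanujan's identity trades G^11 H for 11qG⁶H⁶ and positive terms; 5·11 outweighs the 40
      -- and leaves 15.
      ≈⟨ +-congʳ (*-congˡ ramanujan-GH) ⟩
    int (+ 5) * (1# + int (+ 11) * X * (G ^ 6 * H ^ 6) + X ^ 2 * (G ^ 1 * H ^ 11)) + int (ℤ.- + 40) * (X * (G ^ 6 * H ^ 6))
      ≈⟨ solve 3 (λ x u v → con (+ 5) :* (con (+ 1) :+ con (+ 11) :* x :* u :+ x :^ 2 :* v) :+ con (ℤ.- + 40) :* (x :* u)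
           := con (+ 5) :* (con (+ 1) :+ x :* (con (+ 3) :* u :+ x :* v))) refl X (G ^ 6 * H ^ 6) (G ^ 1 * H ^ 11) ⟩
    int (+ 5) * (1# + X * (int (+ 3) * (G ^ 6 * H ^ 6) + X * (G ^ 1 * H ^ 11))) ∎)
    (PosS-int* 4 (PosS-1+X* (PosS-+ (PosS-int* 2 (W-PosS 5 6)) (NonnegS-* NonnegS-X (PosS⇒NonnegS (W-PosS 0 11))))))
    where
    -- Ramanujan's identity multiplied by (GH)^11, where `G` and `H` cancel against α and β.
    ramanujan-GH : G ^ 11 * H ^ 1 ≈ 1# + int (+ 11) * X * (G ^ 6 * H ^ 6) + X ^ 2 * (G ^ 1 * H ^ 11)
    ramanujan-GH = begin
      G ^ 11 * H ^ 1
        ≈⟨ solve 3 (λ p x y → p := (p :- x :- y) :+ x :+ y) refl _ (int (+ 11) * X * (G ^ 6 * H ^ 6)) (X ^ 2 * (G ^ 1 * H ^ 11)) ⟩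
      (G ^ 11 * H ^ 1 - int (+ 11) * X * (G ^ 6 * H ^ 6) - X ^ 2 * (G ^ 1 * H ^ 11)) + int (+ 11) * X * (G ^ 6 * H ^ 6) + X ^ 2 * (G ^ 1 * H ^ 11)
        ≈⟨ +-congʳ (+-congʳ (begin
             G ^ 11 * H ^ 1 - int (+ 11) * X * (G ^ 6 * H ^ 6) - X ^ 2 * (G ^ 1 * H ^ 11)
               ≈⟨ +-cong (+-cong (*-cong (cancel-power αG 0 11) (cancel-power βH 10 1)) (-‿cong (*-congˡ (*-cong (cancel-power αG 5 6) (cancel-power βH 5 6)))))
                    (-‿cong (*-congˡ (*-cong (cancel-power αG 10 1) (cancel-power βH 0 11)))) ⟨
             α ^ 0 * G ^ 11 * (β ^ 10 * H ^ 11) - int (+ 11) * X * (α ^ 5 * G ^ 11 * (β ^ 5 * H ^ 11)) - X ^ 2 * (α ^ 10 * G ^ 11 * (β ^ 0 * H ^ 11))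
               ≈⟨ solve 8 (λ x a5 a10 b5 b10 g h c → con (+ 1) :* g :* (b10 :* h) :- c :* x :* (a5 :* g :* (b5 :* h)) :- x :^ 2 :* (a10 :* g :* (con (+ 1) :* h))
                    := (b10 :- c :* x :* a5 :* b5 :- x :^ 2 :* a10) :* (g :* h)) refl X (α ^ 5) (α ^ 10) (β ^ 5) (β ^ 10) (G ^ 11) (H ^ 11) (int (+ 11)) ⟩
             (β ^ 10 - int (+ 11) * X * α ^ 5 * β ^ 5 - X ^ 2 * α ^ 10) * (G ^ 11 * H ^ 11)
               ≈⟨ *-congʳ (trans (sym ramanujan) (^-distrib-* α β 11)) ⟩
             α ^ 11 * β ^ 11 * (G ^ 11 * H ^ 11)
               ≈⟨ solve 4 (λ a b g h → a :* b :* (g :* h) := (a :* g) :* (b :* h)) refl (α ^ 11) (β ^ 11) (G ^ 11) (H ^ 11) ⟩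
             (α ^ 11 * G ^ 11) * (β ^ 11 * H ^ 11)
               ≈⟨ trans (*-cong (cancel-power αG 11 0) (cancel-power βH 11 0)) (*-identityˡ 1#) ⟩
             1# ∎)) ⟩
      1# + int (+ 11) * X * (G ^ 6 * H ^ 6) + X ^ 2 * (G ^ 1 * H ^ 11) ∎

  V₂-PosS : PosS (V₂ αG βH)
  V₂-PosS = PosS-resp
    (solve 3 (λ x g h → con (+ 10) :* (g :^ 10 :* h :^ 2) :+ con (ℤ.- + 30) :* (x :* (g :^ 5 :* h :^ 7))
      := con (+ 10) :* (g :^ 5 :* h :^ 2 :* (g :^ 5 :- con (+ 3) :* (x :* h :^ 5)))) refl X G H)
    (PosS-int* 9 (WT-PosS 3 1))

  V₃-PosS : PosS (V₃ αG βH)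
  V₃-PosS = PosS-resp
    (solve 3 (λ x g h → con (+ 5) :* (g :^ 9 :* h :^ 3) :+ con (ℤ.- + 15) :* (x :* (g :^ 4 :* h :^ 8))
      := con (+ 5) :* (g :^ 4 :* h :^ 3 :* (g :^ 5 :- con (+ 3) :* (x :* h :^ 5)))) refl X G H)
    (PosS-int* 4 (WT-PosS 2 2))

  -V₄-PosS : PosS (- V₄ αG βH)
  -V₄-PosS = PosS-resp
    (solve 3 (λ x u v → :- (con (ℤ.- + 15) :* u :+ con (ℤ.- + 5) :* (x :* v)) := con (+ 15) :* u :+ con (+ 5) :* (x :* v)) refl X (G ^ 8 * H ^ 4) (G ^ 3 * H ^ 9))
    (PosS-+ (PosS-int* 14 (W-PosS 7 4)) (NonnegS-* (NonnegS-int 5) (NonnegS-* NonnegS-X (PosS⇒NonnegS (W-PosS 2 9)))))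

  module _ {f : Series} (f≈ : f ≈ (poch 2 * poch 3) ^ 5 * (ipoch 1 * ipoch 4) ^ 5) where
    private
      f-dissection : f ≈ up (V₀ αG βH) + X ^ 1 * up (V₁ αG βH) + X ^ 2 * up (V₂ αG βH) + X ^ 3 * up (V₃ αG βH) + X ^ 4 * up (V₄ αG βH)
      f-dissection = trans f≈ (trans (*-congʳ (^-congˡ 5 (trans (*-comm (poch 2) (poch 3)) (sym (theta-poch 3 2))))) (dissection αG βH))

    sign₁ : ∀ n → Pos (f (1 ℕ.+ n ℕ.* 5))
    sign₁ n = Pos-resp (component₁ f-dissection n) (coeffP V₁-PosS n)

    sign₂ : ∀ n → Pos (f (2 ℕ.+ n ℕ.* 5))
    sign₂ n = Pos-resp (component₂ f-dissection n) (coeffP V₂-PosS n)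

    sign₃ : ∀ n → Pos (f (3 ℕ.+ n ℕ.* 5))
    sign₃ n = Pos-resp (component₃ f-dissection n) (coeffP V₃-PosS n)

    sign₄ : ∀ n → Pos (R.- f (4 ℕ.+ n ℕ.* 5))
    sign₄ n = Pos-resp (R.-‿cong (component₄ f-dissection n)) (coeffP -V₄-PosS n)

-- The ring ℤ[ζ]

module Cyclotomic where
  open import Data.Integer.Base using (_+_; _*_; -_; _-_)
  open +-*-Solver using (solve; _:+_; _:*_; _:-_; :-_; _:=_; con)

  infix 5 ⟨_,_,_,_⟩
  -- ⟨ a , b , c , d ⟩ stands for a + bζ + cζ² + dζ³, where ζ⁴ = -1 - ζ - ζ² - ζ³.
  record ℤ[ζ] : Set where
    constructor ⟨_,_,_,_⟩
    field
      c₀ c₁ c₂ c₃ : ℤ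
  open ℤ[ζ]

  ⟨⟩-cong : ∀ {a b c d a′ b′ c′ d′} → a ≡ a′ → b ≡ b′ → c ≡ c′ → d ≡ d′ → ⟨ a , b , c , d ⟩ ≡ ⟨ a′ , b′ , c′ , d′ ⟩
  ⟨⟩-cong ≡.refl ≡.refl ≡.refl ≡.refl = ≡.refl

  infixl 6 _⊞_
  infixl 7 _⊠_
  _⊞_ _⊠_ : ℤ[ζ] → ℤ[ζ] → ℤ[ζ]
  ⟨ a , b , c , d ⟩ ⊞ ⟨ e , f , g , h ⟩ = ⟨ a + e , b + f , c + g , d + h ⟩
  -- The common subtrahend is the coefficient of ζ⁴ in the product; ζ⁵ = 1 and ζ⁶ = ζ account for
  -- `c * h + d * g` and `d * h`.
  ⟨ a , b , c , d ⟩ ⊠ ⟨ e , f , g , h ⟩ =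
    ⟨ a * e + (c * h + d * g) - (b * h + c * g + d * f)
    , a * f + b * e + d * h - (b * h + c * g + d * f)
    , a * g + b * f + c * e - (b * h + c * g + d * f)
    , a * h + b * g + c * f + d * e - (b * h + c * g + d * f) ⟩

  ⊟_ : ℤ[ζ] → ℤ[ζ]
  ⊟ ⟨ a , b , c , d ⟩ = ⟨ - a , - b , - c , - d ⟩

  fromℤ : ℤ → ℤ[ζ]
  fromℤ a = ⟨ a , + 0 , + 0 , + 0 ⟩

  private
    module _ {n : ℕ} where
      Poly : Set
      Poly = +-*-Solver.Polynomial n

      m₀ m₁ m₂ m₃ : Poly → Poly → Poly → Poly → Poly → Poly → Poly → Poly → Poly
      m₀ a b c d e f g h = a :* e :+ (c :* h :+ d :* g) :- (b :* h :+ c :* g :+ d :* f)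
      m₁ a b c d e f g h = a :* f :+ b :* e :+ d :* h :- (b :* h :+ c :* g :+ d :* f)
      m₂ a b c d e f g h = a :* g :+ b :* f :+ c :* e :- (b :* h :+ c :* g :+ d :* f)
      m₃ a b c d e f g h = a :* h :+ b :* g :+ c :* f :+ d :* e :- (b :* h :+ c :* g :+ d :* f)

      left right distributed product-sum : (Poly → Poly → Poly → Poly → Poly → Poly → Poly → Poly → Poly) →
        Poly → Poly → Poly → Poly → Poly → Poly → Poly → Poly → Poly → Poly → Poly → Poly → Poly
      left m a b c d e f g h i j k l =
        m (m₀ a b c d e f g h) (m₁ a b c d e f g h) (m₂ a b c d e f g h) (m₃ a b c d e f g h) i j k l
      right m a b c d e f g h i j k l =
        m a b c d (m₀ e f g h i j k l) (m₁ e f g h i j k l) (m₂ e f g h i j k l) (m₃ e f g h i j k l)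
      distributed m a b c d e f g h i j k l = m a b c d e f g h :+ m a b c d i j k l
      product-sum m a b c d e f g h i j k l = m a b c d (e :+ i) (f :+ j) (g :+ k) (h :+ l)

  ⊠-comm : ∀ x y → x ⊠ y ≡ y ⊠ x
  ⊠-comm ⟨ a , b , c , d ⟩ ⟨ e , f , g , h ⟩ = ⟨⟩-cong
    (solve 8 (λ a b c d e f g h → m₀ a b c d e f g h := m₀ e f g h a b c d) ≡.refl a b c d e f g h)
    (solve 8 (λ a b c d e f g h → m₁ a b c d e f g h := m₁ e f g h a b c d) ≡.refl a b c d e f g h)
    (solve 8 (λ a b c d e f g h → m₂ a b c d e f g h := m₂ e f g h a b c d) ≡.refl a b c d e f g h)
    (solve 8 (λ a b c d e f g h → m₃ a b c d e f g h := m₃ e f g h a b c d) ≡.refl a b c d e f g h)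

  ⊠-assoc : ∀ x y z → (x ⊠ y) ⊠ z ≡ x ⊠ (y ⊠ z)
  ⊠-assoc ⟨ a , b , c , d ⟩ ⟨ e , f , g , h ⟩ ⟨ i , j , k , l ⟩ = ⟨⟩-cong
    (solve 12 (λ a b c d e f g h i j k l → left m₀ a b c d e f g h i j k l := right m₀ a b c d e f g h i j k l) ≡.refl a b c d e f g h i j k l)
    (solve 12 (λ a b c d e f g h i j k l → left m₁ a b c d e f g h i j k l := right m₁ a b c d e f g h i j k l) ≡.refl a b c d e f g h i j k l)
    (solve 12 (λ a b c d e f g h i j k l → left m₂ a b c d e f g h i j k l := right m₂ a b c d e f g h i j k l) ≡.refl a b c d e f g h i j k l)
    (solve 12 (λ a b c d e f g h i j k l → left m₃ a b c d e f g h i j k l := right m₃ a b c d e f g h i j k l) ≡.refl a b c d e f g h i j k l)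

  ⊠-distribˡ : ∀ x y z → x ⊠ (y ⊞ z) ≡ x ⊠ y ⊞ x ⊠ z
  ⊠-distribˡ ⟨ a , b , c , d ⟩ ⟨ e , f , g , h ⟩ ⟨ i , j , k , l ⟩ = ⟨⟩-cong
    (solve 12 (λ a b c d e f g h i j k l → product-sum m₀ a b c d e f g h i j k l := distributed m₀ a b c d e f g h i j k l) ≡.refl a b c d e f g h i j k l)
    (solve 12 (λ a b c d e f g h i j k l → product-sum m₁ a b c d e f g h i j k l := distributed m₁ a b c d e f g h i j k l) ≡.refl a b c d e f g h i j k l)
    (solve 12 (λ a b c d e f g h i j k l → product-sum m₂ a b c d e f g h i j k l := distributed m₂ a b c d e f g h i j k l) ≡.refl a b c d e f g h i j k l)
    (solve 12 (λ a b c d e f g h i j k l → product-sum m₃ a b c d e f g h i j k l := distributed m₃ a b c d e f g h i j k l) ≡.refl a b c d e f g h i j k l)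

  fromℤ-⊠ : ∀ x e f g h → fromℤ x ⊠ ⟨ e , f , g , h ⟩ ≡ ⟨ x * e , x * f , x * g , x * h ⟩
  fromℤ-⊠ x e f g h = ⟨⟩-cong
    (solve 5 (λ x e f g h → m₀ x (con (+ 0)) (con (+ 0)) (con (+ 0)) e f g h := x :* e) ≡.refl x e f g h)
    (solve 5 (λ x e f g h → m₁ x (con (+ 0)) (con (+ 0)) (con (+ 0)) e f g h := x :* f) ≡.refl x e f g h)
    (solve 5 (λ x e f g h → m₂ x (con (+ 0)) (con (+ 0)) (con (+ 0)) e f g h := x :* g) ≡.refl x e f g h)
    (solve 5 (λ x e f g h → m₃ x (con (+ 0)) (con (+ 0)) (con (+ 0)) e f g h := x :* h) ≡.refl x e f g h)

  ⊠-identityˡ : ∀ x → fromℤ (+ 1) ⊠ x ≡ x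
  ⊠-identityˡ ⟨ e , f , g , h ⟩ = ≡.trans (fromℤ-⊠ (+ 1) e f g h) (⟨⟩-cong (ℤₚ.*-identityˡ e) (ℤₚ.*-identityˡ f) (ℤₚ.*-identityˡ g) (ℤₚ.*-identityˡ h))

  ring : CommutativeRing 0ℓ 0ℓ
  ring = record
    { Carrier = ℤ[ζ]
    ; _≈_ = _≡_
    ; _+_ = _⊞_
    ; _*_ = _⊠_
    ; -_ = ⊟_
    ; 0# = fromℤ (+ 0)
    ; 1# = fromℤ (+ 1)
    ; isCommutativeRing = record
      { isRing = record
        { +-isAbelianGroup = record
          { isGroup = record
            { isMonoid = record
              { isSemigroup = record
                { isMagma = record { isEquivalence = ≡.isEquivalence ; ∙-cong = ≡.cong₂ _⊞_ }
                ; assoc = λ { ⟨ a , b , c , d ⟩ ⟨ e , f , g , h ⟩ ⟨ i , j , k , l ⟩ →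
                    ⟨⟩-cong (ℤₚ.+-assoc a e i) (ℤₚ.+-assoc b f j) (ℤₚ.+-assoc c g k) (ℤₚ.+-assoc d h l) }
                }
              ; identity =
                  (λ { ⟨ a , b , c , d ⟩ → ⟨⟩-cong (ℤₚ.+-identityˡ a) (ℤₚ.+-identityˡ b) (ℤₚ.+-identityˡ c) (ℤₚ.+-identityˡ d) })
                , (λ { ⟨ a , b , c , d ⟩ → ⟨⟩-cong (ℤₚ.+-identityʳ a) (ℤₚ.+-identityʳ b) (ℤₚ.+-identityʳ c) (ℤₚ.+-identityʳ d) })
              }
            ; inverse =
                (λ { ⟨ a , b , c , d ⟩ → ⟨⟩-cong (ℤₚ.+-inverseˡ a) (ℤₚ.+-inverseˡ b) (ℤₚ.+-inverseˡ c) (ℤₚ.+-inverseˡ d) })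
              , (λ { ⟨ a , b , c , d ⟩ → ⟨⟩-cong (ℤₚ.+-inverseʳ a) (ℤₚ.+-inverseʳ b) (ℤₚ.+-inverseʳ c) (ℤₚ.+-inverseʳ d) })
            ; ⁻¹-cong = ≡.cong ⊟_
            }
          ; comm = λ { ⟨ a , b , c , d ⟩ ⟨ e , f , g , h ⟩ → ⟨⟩-cong (ℤₚ.+-comm a e) (ℤₚ.+-comm b f) (ℤₚ.+-comm c g) (ℤₚ.+-comm d h) }
          }
        ; *-cong = ≡.cong₂ _⊠_
        ; *-assoc = ⊠-assoc
        ; *-identity = ⊠-identityˡ , λ x → ≡.trans (⊠-comm x (fromℤ (+ 1))) (⊠-identityˡ x)
        ; distrib = ⊠-distribˡ
                  , λ x y z → ≡.trans (⊠-comm (y ⊞ z) x) (≡.trans (⊠-distribˡ x y z) (≡.cong₂ _⊞_ (⊠-comm x y) (⊠-comm x z)))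
        }
      ; *-comm = ⊠-comm
      }
    }

  embedding : IntegerMap ring
  embedding = record
    { ⟦_⟧ = fromℤ
    ; +-homo = λ x y → ≡.refl
    ; *-homo = λ x y → ≡.sym (≡.trans (fromℤ-⊠ x y (+ 0) (+ 0) (+ 0)) (⟨⟩-cong ≡.refl (ℤₚ.*-zeroʳ x) (ℤₚ.*-zeroʳ x) (ℤₚ.*-zeroʳ x)))
    ; -‿homo = λ x → ≡.refl
    ; 0-homo = ≡.refl
    ; 1-homo = ≡.refl
    }

  5-torsion-free : ∀ {x} → fromℤ (+ 5) ⊠ x ≡ fromℤ (+ 0) → x ≡ fromℤ (+ 0)
  5-torsion-free {⟨ a , b , c , d ⟩} p = ⟨⟩-cong (cancel a (≡.cong c₀ q)) (cancel b (≡.cong c₁ q)) (cancel c (≡.cong c₂ q)) (cancel d (≡.cong c₃ q))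
    where
    q : ⟨ + 5 * a , + 5 * b , + 5 * c , + 5 * d ⟩ ≡ fromℤ (+ 0)
    q = ≡.trans (≡.sym (fromℤ-⊠ (+ 5) a b c d)) p
    cancel : ∀ x → + 5 * x ≡ + 0 → x ≡ + 0
    cancel x p = ℤₚ.*-cancelˡ-≡ (+ 5) x (+ 0) p

  root : PrimitiveFifthRoot ring embedding
  root = record { ζ = ⟨ + 0 , + 1 , + 0 , + 0 ⟩ ; Φζ = ≡.refl ; 5-torsion-free = 5-torsion-free }

-- Transfer of integer series to series over the coefficient ring

Σ<-head : ∀ n f → Σ< (suc n) f ≡ f 0 ℤ.+ Σ< n (λ i → f (suc i))
Σ<-head zero    f = ℤₚ.+-comm 0ℤ (f 0)
Σ<-head (suc n) f = ≡.trans (≡.cong (ℤ._+ f (suc n)) (Σ<-head n f)) (ℤₚ.+-assoc (f 0) _ (f (suc n)))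

module Transfer {c ℓ} (R : CommutativeRing c ℓ) (ι : IntegerMap R) where
  private module R = CommutativeRing R
  private module ι = _-Raw-AlmostCommutative⟶_ ι
  open SeriesCalculus R ι
  open Positivity R ι using (geo)

  embed : PS → Series
  embed f n = ι.⟦ f n ⟧

  -- `Σ<` grows at its last term, whereas the product of series recurs on the first; `Σ<-head`
  -- reconciles the two.
  embed-⊛ : ∀ f g → embed (f ⊛ g) ≈ embed f * embed g
  embed-⊛ f g = mk≋ (go f)
    where
    go : ∀ f n → ι.⟦ (f ⊛ g) n ⟧ R.≈ (embed f * embed g) n
    go f zero    = R.trans (R.reflexive (≡.cong ι.⟦_⟧ (ℤₚ.+-identityˡ (f 0 ℤ.* g 0)))) (ι.*-homo (f 0) (g 0))
    go f (suc n) = R.trans (R.reflexive (≡.cong ι.⟦_⟧ (Σ<-head (suc n) (λ i → f i ℤ.* g (suc n ℕ.∸ i)))))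
      (R.trans (ι.+-homo _ _) (R.+-cong (ι.*-homo (f 0) (g (suc n))) (go (λ i → f (suc i)) n)))

  embed-1 : embed onePS ≈ 1#
  embed-1 = mk≋ λ { zero → ι.1-homo ; (suc n) → ι.0-homo }

  embed-^ : ∀ f k → embed (f ^PS k) ≈ embed f ^ k
  embed-^ f zero    = embed-1
  embed-^ f (suc k) = trans (embed-⊛ f (f ^PS k)) (*-congˡ (embed-^ f k))

  embed-Π : ∀ F n → embed (ΠPS n F) ≈ ∏ n (λ j → embed (F j))
  embed-Π F zero    = embed-1
  embed-Π F (suc n) = trans (embed-⊛ (ΠPS n F) (F n)) (*-congʳ (embed-Π F n))

  embed-if : ∀ b → ι.⟦ if b then 1ℤ else 0ℤ ⟧ R.≈ (if b then R.1# else R.0#)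
  embed-if true  = ι.1-homo
  embed-if false = ι.0-homo

  X^-coefficient : ∀ m n → (X ^ m) n R.≈ (if n ≡ᵇ m then R.1# else R.0#)
  X^-coefficient zero    zero    = R.refl
  X^-coefficient zero    (suc n) = R.refl
  X^-coefficient (suc m) zero    = X*-zero (X ^ m)
  X^-coefficient (suc m) (suc n) = R.trans (X*-suc (X ^ m) n) (X^-coefficient m n)

  embed-oneMinusQ^ : ∀ m → embed (oneMinusQ^ m) ≈ 1# - X ^ m
  embed-oneMinusQ^ m = mk≋ λ n → R.trans (ι.+-homo _ _)
    (R.+-cong (at embed-1 n) (R.trans (ι.-‿homo _) (R.-‿cong (R.trans (embed-if (n ≡ᵇ m)) (R.sym (X^-coefficient m n))))))

  embed-poch∞ : ∀ a → embed (poch∞ a 5) ≈ ∏∞ (λ j → 1# - X ^ (a ℕ.+ 5 ℕ.* j))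
  embed-poch∞ a = mk≋ λ n → at (trans (embed-Π _ (suc n)) (∏-cong (λ j → embed-oneMinusQ^ (a ℕ.+ 5 ℕ.* j)) (suc n))) n

  embed-invPoch∞ : ∀ a → embed (invPoch∞ a 5) ≈ ∏∞ (λ j → geo (a ℕ.+ 5 ℕ.* j))
  embed-invPoch∞ a = mk≋ λ n → at (trans (embed-Π _ (suc n))
    (∏-cong (λ j → mk≋ λ i → embed-if ⌊ (a ℕ.+ 5 ℕ.* j) ∣? i ⌋) (suc n))) n

  embed-recipR5 : embed recipR5 ≈ (∏∞ (λ j → 1# - X ^ (2 ℕ.+ 5 ℕ.* j)) * ∏∞ (λ j → 1# - X ^ (3 ℕ.+ 5 ℕ.* j))) ^ 5
    * (∏∞ (λ j → geo (1 ℕ.+ 5 ℕ.* j)) * ∏∞ (λ j → geo (4 ℕ.+ 5 ℕ.* j))) ^ 5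
  embed-recipR5 = trans (embed-⊛ numerator denominator) (*-cong
    (trans (embed-^ (poch∞ 2 5 ⊛ poch∞ 3 5) 5) (^-congˡ 5 (trans (embed-⊛ (poch∞ 2 5) (poch∞ 3 5)) (*-cong (embed-poch∞ 2) (embed-poch∞ 3)))))
    (trans (embed-^ (invPoch∞ 1 5 ⊛ invPoch∞ 4 5) 5)
      (^-congˡ 5 (trans (embed-⊛ (invPoch∞ 1 5) (invPoch∞ 4 5)) (*-cong (embed-invPoch∞ 1) (embed-invPoch∞ 4))))))
    where
    numerator denominator : PS
    numerator = (poch∞ 2 5 ⊛ poch∞ 3 5) ^PS 5
    denominator = (invPoch∞ 1 5 ⊛ invPoch∞ 4 5) ^PS 5

-- The signs over the integers

open Cyclotomic using (ring; embedding; root; module ℤ[ζ])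
open RogersRamanujanSigns ring embedding root using (sign₁; sign₂; sign₃; sign₄)
open Positivity ring embedding using (Pos)
open Transfer ring embedding using (embed-recipR5)

index : ∀ n r → r ℕ.+ n ℕ.* 5 ≡ 5 ℕ.* n ℕ.+ r
index n r = ≡.trans (ℕₚ.+-comm r (n ℕ.* 5)) (≡.cong (ℕ._+ r) (ℕₚ.*-comm n 5))

-- The coordinate `c₀` recovers an integer from its image, so a positive image comes from a positive
-- integer.
Pos⇒0< : ∀ {z} → Pos (Cyclotomic.fromℤ z) → 0ℤ ℤ.< z
Pos⇒0< (k , p) = ≡.subst (0ℤ ℤ.<_) (≡.sym (≡.cong ℤ[ζ].c₀ p)) (ℤ.+<+ (ℕ.s≤s ℕ.z≤n))

open import Data.Nat using (ℕ; _+_; _*_)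
open import Data.Integer using (_<_; 0ℤ)
open import Data.Product using (_×_)

theorem1p2 : (n : ℕ) →
    (0ℤ < A (5 * n + 1)) × (0ℤ < A (5 * n + 2)) × (0ℤ < A (5 * n + 3)) × (A (5 * n + 4) < 0ℤ)
theorem1p2 n =
    positive 1 (sign₁ embed-recipR5 n) , positive 2 (sign₂ embed-recipR5 n) , positive 3 (sign₃ embed-recipR5 n)
  -- The negative of an embedded integer computes to the embedded negative, so `sign₄` is directly a
  -- statement about the integer - A.
  , ℤₚ.neg-cancel-< (≡.subst (λ i → 0ℤ ℤ.< ℤ.- A i) (index n 4) (Pos⇒0< (sign₄ embed-recipR5 n)))
  where
  positive : ∀ r → Pos (Cyclotomic.fromℤ (A (r ℕ.+ n ℕ.* 5))) → 0ℤ ℤ.< A (5 ℕ.* n ℕ.+ r)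
  positive r p = ≡.subst (λ i → 0ℤ ℤ.< A i) (index n r) (Pos⇒0< p)
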